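{- There is an absolute constant $K>0$ such that the following holds. Let $n\ge1$, $\epsilon\ge0$, and let $f\colon S_n\to\mathbb{R}$ be linear with $\mathbb{E}[\operatorname{dist}(f,\{0,1\})^2]\le\epsilon$ and $\mathbb{E}[f]\le1/2$. Then there is a set $\mathcal{C}\subseteq[n]^2$ of cosets with $|\mathcal{C}|\le Kn$ and at most $K\epsilon n^2$ unordered pairs of non-disjoint cosets in $\mathcal{C}$, such that $g=\sum_{(i,j)\in\mathcal{C}}x_{i,j}$ satisfies $\mathbb{E}[(f-g)^2]\le K\epsilon$. Conversely, for every $A>0$ there is $B>0$ such that for all $n\ge1$, $\epsilon\ge0$ and every $\mathcal{C}\subseteq[n]^2$ with $|\mathcal{C}|\le An$ and at most $A\epsilon n^2$ unordered pairs of non-disjoint cosets, $g=\sum_{(i,j)\in\mathcal{C}}x_{i,j}$ satisfies $\mathbb{E}[\operatorname{dist}(g,\{0,1\})^2]\le B\epsilon$.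
   Context: $S_n$ is the symmetric group on $[n]$; expectations and probabilities are over a uniformly random $\pi\in S_n$. $x_{i,j}(\pi)=1$ if $\pi(i)=j$ and $0$ otherwise. A function $S_n\to\mathbb{R}$ is linear if it equals $\sum_{i,j}c_{i,j}x_{i,j}$ for some reals $c_{i,j}$. $\operatorname{dist}(y,\{0,1\})=\min(|y|,|y-1|)$. The coset $(i,j)$ is $\{\pi:\pi(i)=j\}$; two distinct cosets $(i,j),(k,\ell)$ are non-disjoint iff $i\neq k$ and $j\neq\ell$.
   Formalization: The coefficients of the linear function f (hence its values), the error ε and the constant A are taken to be rational numbers instead of real numbers; the constants K and B are produced as rationals. -}

module Defs where

open import Data.Bool using (Bool; true; false; T; _∧_; _∨_; not; if_then_else_)
open import Data.Nat as ℕ using (ℕ; zero; suc; _!)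
open import Data.Nat.Properties using (_!≢0)
open import Data.Fin as Fin using (Fin; zero; suc; _<?_)
open import Data.Fin.Properties using () renaming (_≟_ to _≟F_)
open import Data.List using (List; []; _∷_; map; concatMap; allFin; foldr; filterᵇ; length)
open import Data.Vec.Functional using () renaming (_∷_ to _◂_)
open import Data.Integer using (+_)
open import Data.Rational using (ℚ; 0ℚ; 1ℚ; _+_; _*_; _-_; _⊓_; ∣_∣; _/_)
open import Relation.Nullary.Decidable using (⌊_⌋)

allFuns : ∀ m n → List (Fin m → Fin n)
allFuns zero    n = (λ ()) ∷ []
allFuns (suc m) n = concatMap (λ f → map (λ j → j ◂ f) (allFin n)) (allFuns m n)

allᵇ : ∀ {A : Set} → (A → Bool) → List A → Bool
allᵇ p = foldr (λ a b → p a ∧ b) true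

isInjective : ∀ {n} → (Fin n → Fin n) → Bool
isInjective {n} π =
  allᵇ (λ i → allᵇ (λ j → not ⌊ π i ≟F π j ⌋ ∨ ⌊ i ≟F j ⌋) (allFin n)) (allFin n)

-- The symmetric group S_n, enumerated as the list of all bijections [n] → [n]
-- (injective self-maps of a finite set).
Sym : ℕ → Set
Sym n = Fin n → Fin n

perms : ∀ n → List (Sym n)
perms n = filterᵇ isInjective (allFuns n n)

sumℚ : List ℚ → ℚ
sumℚ = foldr _+_ 0ℚ

Σℚ : ∀ n → (Fin n → ℚ) → ℚ
Σℚ n h = sumℚ (map h (allFin n))

𝔼 : ∀ n → (Sym n → ℚ) → ℚ
𝔼 n h = sumℚ (map h (perms n)) * _/_ (+ 1) (n !) {{n !≢0}}

x : ∀ {n} → Fin n → Fin n → Sym n → ℚ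
x i j π = if ⌊ π i ≟F j ⌋ then 1ℚ else 0ℚ

linear : ∀ n → (Fin n → Fin n → ℚ) → Sym n → ℚ
linear n c π = Σℚ n (λ i → Σℚ n (λ j → c i j * x i j π))

dist01 : ℚ → ℚ
dist01 y = ∣ y ∣ ⊓ ∣ y - 1ℚ ∣

sq : ℚ → ℚ
sq y = y * y

CosetSet : ℕ → Set
CosetSet n = Fin n → Fin n → Bool

indicatorSum : ∀ n → CosetSet n → Sym n → ℚ
indicatorSum n C = linear n (λ i j → if C i j then 1ℚ else 0ℚ)

countᵇ : ∀ {A : Set} → (A → Bool) → List A → ℕ
countᵇ p xs = length (filterᵇ p xs)

card : ∀ n → CosetSet n → ℕ
card n C = foldr ℕ._+_ 0 (map (λ i → countᵇ (λ j → C i j) (allFin n)) (allFin n))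

-- Number of unordered pairs {(i,j),(k,l)} of distinct cosets in 𝒞 that are
-- non-disjoint (i ≠ k and j ≠ l).  Each such pair is counted once, via the
-- ordering with i < k.
nonDisjointPairs : ∀ n → CosetSet n → ℕ
nonDisjointPairs n C =
  foldr ℕ._+_ 0 (map (λ i → foldr ℕ._+_ 0 (map (λ j → foldr ℕ._+_ 0 (map (λ k →
    countᵇ (λ l → C i j ∧ C k l ∧ ⌊ i <? k ⌋ ∧ not ⌊ j ≟F l ⌋) (allFin n))
    (allFin n))) (allFin n))) (allFin n))

ℕtoℚ : ℕ → ℚ
ℕtoℚ m = + m / 1

{-# OPTIONS --safe #-}
module Submission where

-- The proof is elementary. Write Δ = c(i,j) + c(k,l) - c(i,l) - c(k,j) for the change of f when the images of two rows are
-- exchanged, and D(t) for its value at a pair t of rows.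
--
-- (1) For a matching of the rows, exchanging each pair independently with small probability changes f by a random sum of the
--     D(t). Both ends are close to {0,1}, so this sum is close to ℤ; a fourth-moment argument turns this into
--     E[Σ_t dist(D(t),ℤ)²] = O(ε), and averaging over matchings gives Σ dist(Δ,ℤ)² = O(ε n³) over all (i,k,j,l).
-- (2) For an average base coset (i₀,j₀) the matrix of the Δ with i = i₀, j = j₀ is within O(ε n) of an integer matrix z that
--     vanishes on row i₀ and column j₀, and Σ z² is at most about 4n·Var f ≤ 4n·p(1-p), where p = E[f]. As a linear function with
--     coefficients e has variance at most Σ e²/(n-1), f is O(ε)-close to a₀ + Σ z x with a constant integer a₀; the bound on Σ z²
--     forces a₀ ∈ {0,1}, and a₀ = 1 is reduced to a₀ = 0 by passing to 1 - f.
-- (3) The bound on Σ z² and a parity argument show that a permutation with i₀ ↦ j₀ hits no nonzero entry of z with probability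
--     at least 1/32. Redirecting it through (k,l) hits exactly that entry, so every entry outside {0,1} costs Ω(1/n) in
--     E[dist(f,{0,1})²]. Hence C = {z = 1} works: h(h-1) ≤ 2 dist(h,{0,1})² for integers h bounds the number of pairs.
-- (4) If a₀ = 1, then E[f] ≤ 1/2 makes the set C for 1 - f have about n/2 elements or more; with few non-disjoint pairs it must
--     lie in one line up to O(ε n) cosets, and the complement of C in that line serves for f.
--
-- The converse is dist(h,{0,1})² ≤ h(h-1), whose mean counts the non-disjoint pairs.

open import Defs
open import Data.Nat as ℕ using (ℕ; zero; suc)
open import Data.Product using (Σ; _×_; _,_; proj₁; proj₂; ∃)
open import Data.Fin as Fin using (Fin; zero; suc)
open import Data.Rational using (ℚ; 0ℚ; 1ℚ; ½; _≤_; _<_; _*_; _-_; _+_; -_; ∣_∣)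
open import Agda.Builtin.FromNat using (Number; fromNat)
open import Data.Bool using (Bool; true; false; T; if_then_else_; _∧_; _∨_; not)
open import Data.Empty using (⊥-elim)
open import Data.Fin using (punchIn; punchOut)
open import Data.Fin.Properties using (any?; toℕ-injective; punchIn-injective; punchInᵢ≢i; punchOut-injective; punchIn-punchOut; punchOut-punchIn; punchOut-cong) renaming (_≟_ to _≟F_)
open import Data.Fin.Permutation.Components using (transpose)
open import Data.Integer as ℤ using (ℤ)
import Data.Integer.DivMod as ℤ
import Data.Integer.Properties as ℤ
open import Data.List using (List; []; _∷_; map; concatMap; allFin; filterᵇ; tabulate; _++_)
open import Data.List.Properties using (map-tabulate; map-∘)
open import Data.List.Relation.Unary.All as Every using (All)
import Data.Nat.Properties as ℕ
import Data.Rational as ℚ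
import Data.Rational.Literals as Lit
import Data.Rational.Properties as ℚ
open import Data.Rational.Properties using (≤-trans; ≤-refl; ≤-antisym) renaming (≤-reflexive to ≡⇒≤)
import Data.Rational.Unnormalised as ℚᵘ
import Data.Rational.Unnormalised.Properties as ℚᵘ
open import Data.Sum using (_⊎_; inj₁; inj₂)
open import Data.Unit using (⊤; tt)
open import Data.Vec.Functional using () renaming (_∷_ to _◂_)
open import Function using (_∘_)
open import Relation.Binary.PropositionalEquality
open import Relation.Nullary using (¬_; yes; no; Dec; contradiction)
open import Relation.Nullary.Decidable using (True; toWitness; dec⇒maybe; ⌊_⌋)
open import Tactic.RingSolver using (solve; solve-∀)
open import Tactic.RingSolver.Core.AlmostCommutativeRing using (AlmostCommutativeRing; fromCommutativeRing)

-- The fourth moment controls the random sum only while the squares of its steps have bounded total.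
-- On the permutations where Σ D(t)² reaches 4 an L² argument takes over: this event is invariant
-- under the exchanges, so on it the mean of (f - ½)² is at least a quarter of that of Σ D(t)²,
-- whereas closeness to {0,1} keeps (f - ½)² near ¼. Such permutations therefore contribute only
-- O(ε).
--
-- The bound on Σ z² must be almost sharp. The parity argument gives 2·P(no hit) ≥ 2 - 4p(1 - p) -
-- p·n/(n - 1) up to small errors, and for n = 3 the subtracted part reaches 121/64. A base coset
-- found by Markov's inequality with a lost factor 2 would be useless, so the choice of the base
-- favours the energy at the expense of the error terms, whose constants are free.
--
-- Everything is done in ℚ without square roots: distances are squared, the triangle inequality
-- reads (x + y)² ≤ 2x² + 2y², and a polynomial inequality is proved by writing the difference of
-- its sides as a sum of visibly nonnegative terms. The unusual numerals are coefficients of these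
-- certificates.

instance
  ℚ-number : Number ℚ
  ℚ-number = Lit.number

  ℕ-number : Number ℕ
  ℕ-number = record { Constraint = λ _ → ⊤ ; fromNat = λ n → n }

R : AlmostCommutativeRing _ _
R = fromCommutativeRing ℚ.+-*-commutativeRing (λ x → dec⇒maybe (0ℚ ℚ.≟ x))

-- Ordered-field arithmetic

-- The `True` argument is solved by evaluation, so inside a certificate a nonnegative numeral proves
-- itself.
≥0 : ∀ {q} → {True (0ℚ ℚ.≤? q)} → 0ℚ ≤ q
≥0 {_} {p} = toWitness p

>0 : ∀ {q} → {True (0ℚ ℚ.<? q)} → 0ℚ < q
>0 {_} {p} = toWitness p

diff : ∀ {a b} → a ≤ b → 0ℚ ≤ b - a
diff {a} {b} p = subst (_≤ b - a) (ℚ.+-inverseʳ a) (ℚ.+-monoˡ-≤ (- a) p)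

infixl 6 _⊞_
infixl 7 _⊡_

_⊞_ : ∀ {a b} → 0ℚ ≤ a → 0ℚ ≤ b → 0ℚ ≤ a + b
p ⊞ q = ℚ.+-mono-≤ p q

_⊡_ : ∀ {a b} → 0ℚ ≤ a → 0ℚ ≤ b → 0ℚ ≤ a * b
_⊡_ {a} {b} p q = subst (_≤ a * b) (ℚ.*-zeroʳ a) (ℚ.*-monoˡ-≤-nonNeg a {{ℚ.nonNegative p}} q)

-- A certificate: the difference of the two sides is visibly nonnegative.
by : ∀ {a b r} → 0ℚ ≤ r → b ≡ a + r → a ≤ b
by {a} {b} {r} p e = subst (a ≤_) (sym e) (subst (_≤ a + r) (ℚ.+-identityʳ a) (ℚ.+-monoʳ-≤ a p))

sq-neg : ∀ x → sq (- x) ≡ sq x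
sq-neg = lem
  where lem : ∀ x → (- x) * (- x) ≡ x * x
        lem = solve-∀ R

sq-swap : ∀ x y → sq (x - y) ≡ sq (y - x)
sq-swap = lem
  where lem : ∀ x y → (x - y) * (x - y) ≡ (y - x) * (y - x)
        lem = solve-∀ R

split-at : ∀ x y → x ≡ y + (x - y)
split-at = solve-∀ R

*-exchange : ∀ x y z → x * (y * z) ≡ y * (x * z)
*-exchange = solve-∀ R

minus-0 : ∀ x → x - 0ℚ ≡ x
minus-0 = solve-∀ R

0≤sq : ∀ a → 0ℚ ≤ sq a
0≤sq a with ℚ.≤-total 0ℚ a
... | inj₁ p = p ⊡ p
... | inj₂ p = by (diff p ⊡ diff p) (solve (a ∷ []) R)

neg-≤ : ∀ {a} → a ≤ 0ℚ → 0ℚ ≤ - a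
neg-≤ {a} p = by (diff p) (solve (a ∷ []) R)

≰-≥ : ∀ {a b} → ¬ (a ≤ b) → b ≤ a
≰-≥ p = ℚ.<⇒≤ (ℚ.≰⇒> p)

<⇒≱ : ∀ {a b} → a < b → ¬ (b ≤ a)
<⇒≱ p q = ℚ.<-irrefl refl (ℚ.<-≤-trans p q)

infixl 7 _⊡<_
_⊡<_ : ∀ {a b} → 0ℚ < a → 0ℚ < b → 0ℚ < a * b
_⊡<_ {a} {b} p q = subst (_< a * b) (ℚ.*-zeroʳ a) (ℚ.*-monoʳ-<-pos a {{ℚ.positive p}} q)

*-cancelˡ-≤ : ∀ k {a b} → 0ℚ < k → k * a ≤ k * b → a ≤ b
*-cancelˡ-≤ k p q = ℚ.*-cancelˡ-≤-pos k {{ℚ.positive p}} q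

*-cancelˡ : ∀ k {a b} → 0ℚ < k → k * a ≡ k * b → a ≡ b
*-cancelˡ k p e = ≤-antisym (*-cancelˡ-≤ k p (≡⇒≤ e)) (*-cancelˡ-≤ k p (≡⇒≤ (sym e)))

*-monoˡ : ∀ {k a b} → 0ℚ ≤ k → a ≤ b → k * a ≤ k * b
*-monoˡ {k} p q = ℚ.*-monoˡ-≤-nonNeg k {{ℚ.nonNegative p}} q

-- Stands in for a square root, which need not exist in ℚ.
sq≤1⇒≤1 : ∀ k {a} → 0ℚ ≤ k → sq a ≤ sq k → a ≤ k
sq≤1⇒≤1 k {a} 0≤k p with a ℚ.≤? k
... | yes q = q
... | no ¬q = ⊥-elim (<⇒≱ (k²<a² ) p)
  where
  k<a : k < a
  k<a = ℚ.≰⇒> ¬q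
  0<a : 0ℚ < a
  0<a = ℚ.≤-<-trans 0≤k k<a
  k²<a² : sq k < sq a
  k²<a² = ℚ.≤-<-trans (*-monoˡ 0≤k (ℚ.<⇒≤ k<a)) (subst₂ _<_ (ℚ.*-comm a k) refl (ℚ.*-monoʳ-<-pos a {{ℚ.positive 0<a}} k<a))

-- Natural numbers and integers inside ℚ

fromℤ-≃ : ∀ {z q} → ℚᵘ.mkℚᵘ z 0 ℚᵘ.≃ ℚ.toℚᵘ q → Lit.fromℤ z ≡ q
fromℤ-≃ p = ℚ.toℚᵘ-injective p

fromℤ-+ : ∀ a b → Lit.fromℤ (a ℤ.+ b) ≡ Lit.fromℤ a + Lit.fromℤ b
fromℤ-+ a b = fromℤ-≃ (ℚᵘ.≃-trans (ℚᵘ.*≡* (cong (ℤ._* ℤ.+ 1) (sym (cong₂ ℤ._+_ (ℤ.*-identityʳ a) (ℤ.*-identityʳ b)))))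
  (ℚᵘ.≃-sym (ℚ.toℚᵘ-homo-+ (Lit.fromℤ a) (Lit.fromℤ b))))

fromℤ-* : ∀ a b → Lit.fromℤ (a ℤ.* b) ≡ Lit.fromℤ a * Lit.fromℤ b
fromℤ-* a b = fromℤ-≃ (ℚᵘ.≃-sym (ℚ.toℚᵘ-homo-* (Lit.fromℤ a) (Lit.fromℤ b)))

fromℤ-neg : ∀ a → Lit.fromℤ (ℤ.- a) ≡ - Lit.fromℤ a
fromℤ-neg a = fromℤ-≃ (ℚᵘ.≃-sym (ℚ.toℚᵘ-homo‿- (Lit.fromℤ a)))

ℕtoℚ≡ : ∀ n → ℕtoℚ n ≡ Lit.fromℤ (ℤ.+ n)
ℕtoℚ≡ n = sym (fromℤ-≃ (ℚᵘ.≃-sym (ℚ.toℚᵘ-fromℚᵘ (ℚᵘ.mkℚᵘ (ℤ.+ n) 0))))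

opaque
  -- Opaque, so that `ι n` stays an atom instead of unfolding to a normalised fraction; `∑` and `E`
  -- are sealed for the same reason.
  ι : ℕ → ℚ
  ι = ℕtoℚ

opaque
  unfolding ι

  ι-def : ∀ n → ℕtoℚ n ≡ ι n
  ι-def n = refl

  ι-0 : ι 0 ≡ 0ℚ
  ι-0 = refl

  ι-+ : ∀ m n → ι (m ℕ.+ n) ≡ ι m + ι n
  ι-+ m n rewrite ℕtoℚ≡ (m ℕ.+ n) | ℕtoℚ≡ m | ℕtoℚ≡ n = trans (cong Lit.fromℤ (ℤ.pos-+ m n)) (fromℤ-+ (ℤ.+ m) (ℤ.+ n))

  ι-* : ∀ m n → ι (m ℕ.* n) ≡ ι m * ι n
  ι-* m n rewrite ℕtoℚ≡ (m ℕ.* n) | ℕtoℚ≡ m | ℕtoℚ≡ n = trans (cong Lit.fromℤ (ℤ.pos-* m n)) (fromℤ-* (ℤ.+ m) (ℤ.+ n))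

  ι-suc : ∀ n → ι (suc n) ≡ 1 + ι n
  ι-suc = ι-+ 1

  0≤ι : ∀ n → 0ℚ ≤ ι n
  0≤ι zero = ≥0
  0≤ι (suc n) = subst (0ℚ ≤_) (sym (ι-suc n)) (≥0 {1} ⊞ 0≤ι n)

  0<ι : ∀ n → 0ℚ < ι (suc n)
  0<ι n = ℚ.<-≤-trans (>0 {1ℚ}) (by (0≤ι n) (ι-suc n))

ι-2+ : ∀ n → ι (suc (suc n)) ≡ 2 + ι n
ι-2+ n = trans (ι-suc (suc n)) (trans (cong (1 +_) (ι-suc n)) (sym (ℚ.+-assoc 1 1 (ι n))))

ι-3+ : ∀ n → ι (suc (suc (suc n))) ≡ 3 + ι n
ι-3+ n = trans (ι-suc (suc (suc n))) (trans (cong (1 +_) (ι-2+ n)) (sym (ℚ.+-assoc 1 2 (ι n))))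

Int : ℚ → Set
Int q = ∃ λ z → q ≡ Lit.fromℤ z

Int-+ : ∀ {a b} → Int a → Int b → Int (a + b)
Int-+ (x , refl) (y , refl) = x ℤ.+ y , sym (fromℤ-+ x y)

Int-* : ∀ {a b} → Int a → Int b → Int (a * b)
Int-* (x , refl) (y , refl) = x ℤ.* y , sym (fromℤ-* x y)

Int-neg : ∀ {a} → Int a → Int (- a)
Int-neg (x , refl) = ℤ.- x , sym (fromℤ-neg x)

Int-- : ∀ {a b} → Int a → Int b → Int (a - b)
Int-- p q = Int-+ p (Int-neg q)

Int0 : Int 0ℚ
Int0 = ℤ.+ 0 , refl

Int1 : Int 1ℚ
Int1 = ℤ.+ 1 , refl

-- No integer lies strictly between 0 and 1. The disjunction of inequalities lets integrality enter
-- polynomial certificates.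
int-gap : ∀ {q} → Int q → q ≤ 0ℚ ⊎ 1ℚ ≤ q
int-gap (ℤ.+ zero , refl) = inj₁ ≥0
int-gap (ℤ.+ (suc n) , refl) = inj₂ (ℚ.*≤* (subst₂ ℤ._≤_ refl (sym (ℤ.*-identityʳ (ℤ.+ suc n))) (ℤ.+≤+ (ℕ.s≤s ℕ.z≤n))))
int-gap (ℤ.-[1+ n ] , refl) = inj₁ (ℚ.*≤* (subst₂ ℤ._≤_ (sym (ℤ.*-identityʳ (ℤ.-[1+ n ]))) refl ℤ.-≤+))

int-gap-at : ∀ k {q} → Int k → Int q → q ≤ k ⊎ k + 1 ≤ q
int-gap-at k {q} ik iq with int-gap (Int-- iq ik)
... | inj₁ p = inj₁ (by (diff p) (solve (k ∷ q ∷ []) R))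
... | inj₂ p = inj₂ (by (diff p) (solve (k ∷ q ∷ []) R))

floor-bounds : ∀ q → Lit.fromℤ (ℚ.floor q) ≤ q × q ≤ Lit.fromℤ (ℚ.floor q) + 1
floor-bounds q@(ℚ.mkℚ n d-1 _) = lo , hi
  where
  d = suc d-1
  f = n ℤ./ℕ d
  eq : ℚ.floor q ≡ f
  eq = ℤ.div-pos-is-/ℕ n d
  lo : Lit.fromℤ (ℚ.floor q) ≤ q
  lo rewrite eq = ℚ.*≤* (subst₂ ℤ._≤_ refl (sym (ℤ.*-identityʳ n)) (ℤ.[n/ℕd]*d≤n n d))
  hi : q ≤ Lit.fromℤ (ℚ.floor q) + 1
  hi rewrite eq | sym (fromℤ-+ f (ℤ.+ 1)) = ℚ.*≤* (subst₂ ℤ._≤_ (sym (ℤ.*-identityʳ n)) (cong (ℤ._* ℤ.+ d) (ℤ.+-comm (ℤ.+ 1) f))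
     (ℤ.<⇒≤ (ℤ.n<s[n/ℕd]*d n d)))

rnd : ℚ → ℚ
rnd q = Lit.fromℤ (ℚ.floor (q + ½))

Int-rnd : ∀ q → Int (rnd q)
Int-rnd q = ℚ.floor (q + ½) , refl

rnd-hi : ∀ q → q - rnd q ≤ ½
rnd-hi q = by (diff (proj₂ (floor-bounds (q + ½)))) (lem q (rnd q))
  where lem : ∀ q r → ½ ≡ (q - r) + (r + 1 - (q + ½))
        lem = solve-∀ R

rnd-lo : ∀ q → - ½ ≤ q - rnd q
rnd-lo q = by (diff (proj₁ (floor-bounds (q + ½)))) (lem q (rnd q))
  where lem : ∀ q r → q - r ≡ - ½ + (q + ½ - r)
        lem = solve-∀ R

distℤ² : ℚ → ℚ
distℤ² q = sq (q - rnd q)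

-- For m ≥ 1 the difference of the squares is m(m - 2u) with 2u ≤ 1; the case m ≤ -1 is symmetric.
small-or-far : ∀ {u} → - ½ ≤ u → u ≤ ½ → ∀ {m} → Int m → sq u ≤ sq (u - m)
small-or-far {u} lo hi {m} im with int-gap im
... | inj₂ 1≤m = by ((diff 1≤m ⊞ ≥0 {1}) ⊡ (diff 1≤m ⊞ diff hi ⊞ diff hi)) (solve (u ∷ m ∷ []) R)
... | inj₁ m≤0 with int-gap (Int-neg im)
...   | inj₂ 1≤-m = by ((diff 1≤-m ⊞ ≥0 {1}) ⊡ (diff 1≤-m ⊞ diff lo ⊞ diff lo)) (solve (u ∷ m ∷ []) R)
...   | inj₁ -m≤0 = subst (λ z → sq u ≤ sq (u - z)) (sym m≡0) (≡⇒≤ (cong sq {u} {u - 0ℚ} (solve (u ∷ []) R)))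
  where m≡0 : m ≡ 0ℚ
        m≡0 = ≤-antisym m≤0 (by (diff -m≤0) (solve (m ∷ []) R))

distℤ²-min : ∀ q {m} → Int m → distℤ² q ≤ sq (q - m)
distℤ²-min q {m} im = subst (distℤ² q ≤_) (cong sq (lem q (rnd q) m)) (small-or-far (rnd-lo q) (rnd-hi q) (Int-- im (Int-rnd q)))
  where lem : ∀ q r m → q - r - (m - r) ≡ q - m
        lem = solve-∀ R

distℤ²-≤¼ : ∀ q → distℤ² q ≤ ½ * ½
distℤ²-≤¼ q = by (diff (rnd-lo q) ⊡ diff (rnd-hi q)) (lem q (rnd q))
  where lem : ∀ q r → ½ * ½ ≡ (q - r) * (q - r) + (q - r - - ½) * (½ - (q - r))
        lem = solve-∀ R

private variable
  A B : Set
  m n : ℕ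

-- Finite sums

*-zero : ∀ {a} → a ≡ 0ℚ → ∀ b → a * b ≡ 0ℚ
*-zero p b = trans (cong (_* b) p) (ℚ.*-zeroˡ b)


S : List A → (A → ℚ) → ℚ
S xs h = sumℚ (map h xs)

S-cong : ∀ (xs : List A) {g h : A → ℚ} → (∀ a → g a ≡ h a) → S xs g ≡ S xs h
S-cong []       p = refl
S-cong (a ∷ xs) p = cong₂ _+_ (p a) (S-cong xs p)

S-0 : ∀ (xs : List A) → S xs (λ _ → 0ℚ) ≡ 0ℚ
S-0 []       = refl
S-0 (a ∷ xs) = trans (ℚ.+-identityˡ _) (S-0 xs)

S-+ : ∀ (xs : List A) g h → S xs (λ a → g a + h a) ≡ S xs g + S xs h
S-+ []       g h = refl
S-+ (a ∷ xs) g h rewrite S-+ xs g h = lem (g a) (h a) (S xs g) (S xs h)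
  where lem : ∀ a b c d → a + b + (c + d) ≡ a + c + (b + d)
        lem = solve-∀ R

S-* : ∀ (xs : List A) k h → S xs (λ a → k * h a) ≡ k * S xs h
S-* []       k h = sym (ℚ.*-zeroʳ k)
S-* (a ∷ xs) k h rewrite S-* xs k h = sym (ℚ.*-distribˡ-+ k (h a) (S xs h))

S-*ʳ : ∀ (xs : List A) k h → S xs (λ a → h a * k) ≡ S xs h * k
S-*ʳ xs k h = trans (S-cong xs λ a → ℚ.*-comm (h a) k) (trans (S-* xs k h) (ℚ.*-comm k _))

S-swap : ∀ (xs : List A) (ys : List B) (h : A → B → ℚ) → S xs (λ a → S ys (h a)) ≡ S ys (λ b → S xs (λ a → h a b))
S-swap []       ys h = sym (S-0 ys)
S-swap (a ∷ xs) ys h rewrite S-swap xs ys h = sym (S-+ ys (h a) _)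

S-mono : ∀ (xs : List A) {g h : A → ℚ} → (∀ a → g a ≤ h a) → S xs g ≤ S xs h
S-mono []       p = ≤-refl
S-mono (a ∷ xs) p = ℚ.+-mono-≤ (p a) (S-mono xs p)

S-nonneg : ∀ (xs : List A) {h : A → ℚ} → (∀ a → 0ℚ ≤ h a) → 0ℚ ≤ S xs h
S-nonneg xs {h} p = subst (λ z → z ≤ S xs h) (S-0 xs) (S-mono xs p)

S-++ : ∀ (xs ys : List A) h → S (xs ++ ys) h ≡ S xs h + S ys h
S-++ []       ys h = sym (ℚ.+-identityˡ _)
S-++ (a ∷ xs) ys h rewrite S-++ xs ys h = sym (ℚ.+-assoc (h a) _ _)

S-map : ∀ (xs : List A) (f : A → B) h → S (map f xs) h ≡ S xs (h ∘ f)
S-map xs f h = cong sumℚ (sym (map-∘ xs))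

S-concatMap : ∀ (xs : List A) (f : A → List B) h → S (concatMap f xs) h ≡ S xs (λ a → S (f a) h)
S-concatMap []       f h = refl
S-concatMap (a ∷ xs) f h = trans (S-++ (f a) (concatMap f xs) h) (cong (S (f a) h +_) (S-concatMap xs f h))

⟦_⟧ : Bool → ℚ
⟦ b ⟧ = if b then 1ℚ else 0ℚ

S-filter : ∀ (p : A → Bool) xs h → S (filterᵇ p xs) h ≡ S xs (λ a → ⟦ p a ⟧ * h a)
S-filter p []       h = refl
S-filter p (a ∷ xs) h with p a
... | true  = cong₂ _+_ (sym (ℚ.*-identityˡ (h a))) (S-filter p xs h)
... | false = trans (S-filter p xs h) (sym (trans (cong (_+ S xs (λ a → ⟦ p a ⟧ * h a)) (ℚ.*-zeroˡ (h a))) (ℚ.+-identityˡ (S xs (λ a → ⟦ p a ⟧ * h a)))))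

opaque
  ∑ : (Fin n → ℚ) → ℚ
  ∑ {n} = Σℚ n

opaque
  unfolding ∑

  ∑-def : ∀ (h : Fin n → ℚ) → S (allFin n) h ≡ ∑ h
  ∑-def h = refl

  ∑-empty : ∀ (h : Fin 0 → ℚ) → ∑ h ≡ 0ℚ
  ∑-empty h = refl

  ∑-suc : ∀ (h : Fin (suc n) → ℚ) → ∑ h ≡ h zero + ∑ (h ∘ suc)
  ∑-suc h = cong (λ xs → h zero + sumℚ xs) (trans (map-tabulate suc h) (sym (map-tabulate (λ i → i) (h ∘ suc))))

  ∑-cong : ∀ {f g : Fin n → ℚ} → (∀ i → f i ≡ g i) → ∑ f ≡ ∑ g
  ∑-cong {n} = S-cong (allFin n)

  ∑-0 : ∀ n → ∑ {n} (λ _ → 0ℚ) ≡ 0ℚ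
  ∑-0 n = S-0 (allFin n)

  ∑-+ : ∀ (f g : Fin n → ℚ) → ∑ (λ i → f i + g i) ≡ ∑ f + ∑ g
  ∑-+ {n} = S-+ (allFin n)

  ∑-* : ∀ k (f : Fin n → ℚ) → ∑ (λ i → k * f i) ≡ k * ∑ f
  ∑-* {n} = S-* (allFin n)

  ∑-*ʳ : ∀ k (f : Fin n → ℚ) → ∑ (λ i → f i * k) ≡ ∑ f * k
  ∑-*ʳ {n} = S-*ʳ (allFin n)

  ∑-mono : ∀ {f g : Fin n → ℚ} → (∀ i → f i ≤ g i) → ∑ f ≤ ∑ g
  ∑-mono {n} = S-mono (allFin n)

  ∑-nonneg : ∀ {f : Fin n → ℚ} → (∀ i → 0ℚ ≤ f i) → 0ℚ ≤ ∑ f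
  ∑-nonneg {n} = S-nonneg (allFin n)

  ∑-S : ∀ (xs : List A) (h : A → Fin n → ℚ) → S xs (λ a → ∑ (h a)) ≡ ∑ (λ j → S xs (λ a → h a j))
  ∑-S {n = n} xs = S-swap xs (allFin n)

  ∑-swap : ∀ {m n} (h : Fin m → Fin n → ℚ) → ∑ (λ i → ∑ (h i)) ≡ ∑ (λ j → ∑ (λ i → h i j))
  ∑-swap {m} {n} = S-swap (allFin m) (allFin n)

∑-neg : ∀ (f : Fin n → ℚ) → ∑ (λ i → - f i) ≡ - ∑ f
∑-neg f = trans (∑-cong λ i → lem (f i)) (trans (∑-* (- 1ℚ) f) (sym (lem (∑ f))))
  where lem : ∀ x → - x ≡ (- 1ℚ) * x
        lem = solve-∀ R

∑-- : ∀ (f g : Fin n → ℚ) → ∑ (λ i → f i - g i) ≡ ∑ f - ∑ g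
∑-- f g = trans (∑-+ f (λ i → - g i)) (cong (∑ f +_) (∑-neg g))

∑-prod : ∀ {m n} (f : Fin m → ℚ) (g : Fin n → ℚ) → ∑ f * ∑ g ≡ ∑ (λ i → ∑ (λ k → f i * g k))
∑-prod f g = sym (trans (∑-cong λ i → ∑-* (f i) g) (∑-*ʳ (∑ g) f))

δ : Fin n → Fin n → ℚ
δ i j = ⟦ ⌊ i ≟F j ⌋ ⟧

δ-yes : ∀ {i j : Fin n} → i ≡ j → δ i j ≡ 1ℚ
δ-yes {i = i} {j} p with i ≟F j
... | yes _ = refl
... | no ¬p = contradiction p ¬p

δ-no : ∀ {i j : Fin n} → ¬ (i ≡ j) → δ i j ≡ 0ℚ
δ-no {i = i} {j} ¬p with i ≟F j
... | yes p = contradiction p ¬p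
... | no _ = refl

δ-cases : ∀ (i j : Fin n) → (i ≡ j × δ i j ≡ 1ℚ) ⊎ (¬ (i ≡ j) × δ i j ≡ 0ℚ)
δ-cases i j with i ≟F j
... | yes p = inj₁ (p , refl)
... | no p = inj₂ (p , refl)

∑-δ : ∀ (i : Fin n) (h : Fin n → ℚ) → ∑ (λ j → δ i j * h j) ≡ h i
∑-δ {suc n} zero h = begin
  ∑ (λ j → δ zero j * h j) ≡⟨ ∑-suc (λ j → δ zero j * h j) ⟩
  1ℚ * h zero + ∑ (λ j → 0ℚ * h (suc j)) ≡⟨ cong₂ _+_ (ℚ.*-identityˡ (h zero)) (trans (∑-cong λ j → ℚ.*-zeroˡ (h (suc j))) (∑-0 n)) ⟩
  h zero + 0ℚ ≡⟨ ℚ.+-identityʳ (h zero) ⟩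
  h zero ∎
  where open ≡-Reasoning
∑-δ {suc n} (suc i) h = begin
  ∑ (λ j → δ (suc i) j * h j) ≡⟨ ∑-suc (λ j → δ (suc i) j * h j) ⟩
  0ℚ * h zero + ∑ (λ j → δ (suc i) (suc j) * h (suc j)) ≡⟨ cong₂ _+_ (ℚ.*-zeroˡ (h zero)) (∑-cong λ j → cong (_* h (suc j)) (lem j)) ⟩
  0ℚ + ∑ (λ j → δ i j * h (suc j)) ≡⟨ ℚ.+-identityˡ _ ⟩
  ∑ (λ j → δ i j * h (suc j)) ≡⟨ ∑-δ i (h ∘ suc) ⟩
  h (suc i) ∎
  where
  open ≡-Reasoning
  lem : ∀ j → δ (suc i) (suc j) ≡ δ i j
  lem j with δ-cases i j
  ... | inj₁ (p , q) = trans (δ-yes (cong suc p)) (sym q)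
  ... | inj₂ (p , q) = trans (δ-no λ { refl → p refl }) (sym q)

∑-punch : ∀ (j : Fin (suc n)) h → ∑ h ≡ h j + ∑ (h ∘ punchIn j)
∑-punch zero h = ∑-suc h
∑-punch {suc n} (suc j) h = begin
  ∑ h ≡⟨ ∑-suc h ⟩
  h zero + ∑ (h ∘ suc) ≡⟨ cong (h zero +_) (∑-punch j (h ∘ suc)) ⟩
  h zero + (h (suc j) + ∑ (h ∘ suc ∘ punchIn j)) ≡⟨ lem (h zero) (h (suc j)) _ ⟩
  h (suc j) + (h zero + ∑ (h ∘ suc ∘ punchIn j)) ≡⟨ cong (h (suc j) +_) (sym (∑-suc (h ∘ punchIn (suc j)))) ⟩
  h (suc j) + ∑ (h ∘ punchIn (suc j)) ∎
  where
  open ≡-Reasoning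
  lem : ∀ a b c → a + (b + c) ≡ b + (a + c)
  lem = solve-∀ R

∑∑-nonneg : ∀ {m n} {f : Fin m → Fin n → ℚ} → (∀ i j → 0ℚ ≤ f i j) → 0ℚ ≤ ∑ (λ i → ∑ (f i))
∑∑-nonneg p = ∑-nonneg λ i → ∑-nonneg (p i)

∑∑-mono : ∀ {m n} {f g : Fin m → Fin n → ℚ} → (∀ i j → f i j ≤ g i j) → ∑ (λ i → ∑ (f i)) ≤ ∑ (λ i → ∑ (g i))
∑∑-mono p = ∑-mono λ i → ∑-mono (p i)

∑∑-* : ∀ {m n} k (f : Fin m → Fin n → ℚ) → ∑ (λ i → ∑ (λ j → k * f i j)) ≡ k * ∑ (λ i → ∑ (f i))
∑∑-* k f = trans (∑-cong λ i → ∑-* k (f i)) (∑-* k _)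

∑-const : ∀ n k → ∑ {n} (λ _ → k) ≡ ι n * k
∑-const zero k = trans (∑-empty (λ _ → k)) (sym (*-zero ι-0 k))
∑-const (suc n) k = trans (∑-suc {n} (λ _ → k)) (trans (cong (k +_) (∑-const n k)) (trans (lem k (ι n)) (cong (_* k) (sym (ι-suc n)))))
  where lem : ∀ k n → k + n * k ≡ (1 + n) * k
        lem = solve-∀ R

-- Permutations as injective functions

-- Function extensionality is not assumed, and `allFuns` contains a given function only up to
-- pointwise equality. Sums can be reindexed for summands that respect this equality.
Ext : {C : Set} → ((Fin m → Fin n) → C) → Set
Ext h = ∀ {f g} → (∀ i → f i ≡ g i) → h f ≡ h g

-- The indicator of pointwise equality, written as a product so that sums over `allFuns` factor one
-- coordinate at a time.
agree : (Fin m → Fin n) → (Fin m → Fin n) → ℚ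
agree {zero}  f g = 1ℚ
agree {suc m} f g = δ (f zero) (g zero) * agree (f ∘ suc) (g ∘ suc)

agree-cases : ∀ (f g : Fin m → Fin n) → ((∀ i → f i ≡ g i) × agree f g ≡ 1ℚ) ⊎ (¬ (∀ i → f i ≡ g i) × agree f g ≡ 0ℚ)
agree-cases {zero} f g = inj₁ ((λ ()) , refl)
agree-cases {suc m} f g with δ-cases (f zero) (g zero) | agree-cases (f ∘ suc) (g ∘ suc)
... | inj₁ (p , p′) | inj₁ (q , q′) = inj₁ ((λ { zero → p ; (suc i) → q i }) , cong₂ _*_ p′ q′)
... | inj₁ (p , p′) | inj₂ (q , q′) = inj₂ ((λ r → q (r ∘ suc)) , cong₂ _*_ p′ q′)
... | inj₂ (p , p′) | _ = inj₂ ((λ r → p (r zero)) , *-zero p′ _)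

agree-iff : ∀ {k l} (f g : Fin m → Fin n) (f′ g′ : Fin k → Fin l) → ((∀ i → f i ≡ g i) → ∀ i → f′ i ≡ g′ i) → ((∀ i → f′ i ≡ g′ i) → ∀ i → f i ≡ g i) → agree f g ≡ agree f′ g′
agree-iff f g f′ g′ to from with agree-cases f g | agree-cases f′ g′
... | inj₁ (p , q) | inj₁ (p′ , q′) = trans q (sym q′)
... | inj₂ (p , q) | inj₂ (p′ , q′) = trans q (sym q′)
... | inj₁ (p , q) | inj₂ (p′ , q′) = contradiction (to p) p′
... | inj₂ (p , q) | inj₁ (p′ , q′) = contradiction (from p′) p

-- Expresses that `allFuns` lists every function exactly once up to pointwise equality, in the
-- weighted form used for changes of variables.
pick : ∀ (σ : Fin m → Fin n) {h} → Ext h → S (allFuns m n) (λ φ → agree σ φ * h φ) ≡ h σ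
pick {zero} {n} σ {h} ext = trans (ℚ.+-identityʳ _) (trans (ℚ.*-identityˡ _) (ext λ ()))
pick {suc m} {n} σ {h} ext = begin
  S (allFuns (suc m) n) (λ φ → agree σ φ * h φ)
    ≡⟨ S-concatMap (allFuns m n) (λ f → map (λ j → j ◂ f) (allFin n)) _ ⟩
  S (allFuns m n) (λ f → S (map (λ j → j ◂ f) (allFin n)) (λ φ → agree σ φ * h φ))
    ≡⟨ S-cong (allFuns m n) (λ f → trans (S-map (allFin n) (λ j → j ◂ f) _) (∑-def _)) ⟩
  S (allFuns m n) (λ f → ∑ (λ j → δ (σ zero) j * agree (σ ∘ suc) f * h (j ◂ f)))
    ≡⟨ S-cong (allFuns m n) (λ f → trans (∑-cong λ j → ℚ.*-assoc (δ (σ zero) j) (agree (σ ∘ suc) f) (h (j ◂ f))) (∑-δ (σ zero) (λ j → agree (σ ∘ suc) f * h (j ◂ f)))) ⟩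
  S (allFuns m n) (λ f → agree (σ ∘ suc) f * h (σ zero ◂ f))
    ≡⟨ pick (σ ∘ suc) (λ p → ext λ { zero → refl ; (suc i) → p i }) ⟩
  h (σ zero ◂ (σ ∘ suc))
    ≡⟨ ext (λ { zero → refl ; (suc i) → refl }) ⟩
  h σ ∎
  where open ≡-Reasoning

Inj : Sym n → Set
Inj π = ∀ {i j} → π i ≡ π j → i ≡ j

allᵇ-sound : ∀ {k} (p : A → Bool) (f : Fin k → A) → T (allᵇ p (tabulate f)) → ∀ i → T (p (f i))
allᵇ-sound p f t zero with p (f zero)
... | true = tt
allᵇ-sound p f t (suc i) with p (f zero)
... | true = allᵇ-sound p (f ∘ suc) t i

allᵇ-complete : ∀ {k} (p : A → Bool) (f : Fin k → A) → (∀ i → T (p (f i))) → T (allᵇ p (tabulate f))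
allᵇ-complete {k = zero} p f t = tt
allᵇ-complete {k = suc k} p f t with p (f zero) | t zero
... | true | _ = allᵇ-complete p (f ∘ suc) (t ∘ suc)

isInjective-sound : ∀ (π : Sym n) → T (isInjective π) → Inj π
isInjective-sound π t {i} {j} p with allᵇ-sound _ (λ j → j) (allᵇ-sound _ (λ i → i) t i) j
... | q with π i ≟F π j | i ≟F j
...   | _      | yes r = r
...   | no ¬p  | no _  = contradiction p ¬p

isInjective-complete : ∀ (π : Sym n) → Inj π → T (isInjective π)
isInjective-complete π inj = allᵇ-complete _ (λ i → i) λ i → allᵇ-complete _ (λ j → j) λ j → lem i j
  where
  lem : ∀ i j → T (not ⌊ π i ≟F π j ⌋ ∨ ⌊ i ≟F j ⌋)
  lem i j with π i ≟F π j | i ≟F j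
  ... | no _  | _     = tt
  ... | yes _ | yes _ = tt
  ... | yes p | no ¬q = contradiction (inj p) ¬q

Inj-cases : ∀ (π : Sym n) → (Inj π × ⟦ isInjective π ⟧ ≡ 1ℚ) ⊎ (¬ Inj π × ⟦ isInjective π ⟧ ≡ 0ℚ)
Inj-cases π with isInjective π | isInjective-sound π | isInjective-complete π
... | true  | s | _ = inj₁ ((λ {i} {j} → s tt) , refl)
... | false | _ | c = inj₂ ((λ i → c i) , refl)

Inj-≡ : ∀ {k} (π : Sym n) (σ : Sym k) → (Inj π → Inj σ) → (Inj σ → Inj π) → ⟦ isInjective π ⟧ ≡ ⟦ isInjective σ ⟧
Inj-≡ π σ to from with Inj-cases π | Inj-cases σ
... | inj₁ (p , q) | inj₁ (p′ , q′) = trans q (sym q′)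
... | inj₂ (p , q) | inj₂ (p′ , q′) = trans q (sym q′)
... | inj₁ (p , q) | inj₂ (p′ , q′) = contradiction (λ {i} {j} → to p {i} {j}) p′
... | inj₂ (p , q) | inj₁ (p′ , q′) = contradiction (λ {i} {j} → from p′ {i} {j}) p

Inj-ext : ∀ {π σ : Sym n} → (∀ i → π i ≡ σ i) → Inj π → Inj σ
Inj-ext p inj q = inj (trans (p _) (trans q (sym (p _))))

injective-Ext : Ext {n} {n} (λ π → ⟦ isInjective π ⟧)
injective-Ext {f = f} {g} p = Inj-≡ f g (Inj-ext p) (Inj-ext (sym ∘ p))

SP : ∀ n → (Sym n → ℚ) → ℚ
SP n h = S (perms n) h

SP-all : ∀ n h → SP n h ≡ S (allFuns n n) (λ φ → ⟦ isInjective φ ⟧ * h φ)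
SP-all n h = S-filter isInjective (allFuns n n) h

SP-cong : ∀ n {g h} → (∀ π → Inj π → g π ≡ h π) → SP n g ≡ SP n h
SP-cong n {g} {h} p = trans (SP-all n g) (trans (S-cong (allFuns n n) lem) (sym (SP-all n h)))
  where
  lem : ∀ φ → ⟦ isInjective φ ⟧ * g φ ≡ ⟦ isInjective φ ⟧ * h φ
  lem φ with Inj-cases φ
  ... | inj₁ (i , _) = cong (⟦ isInjective φ ⟧ *_) (p φ i)
  ... | inj₂ (_ , q) = trans (*-zero q (g φ)) (sym (*-zero q (h φ)))

SP-mono : ∀ n {g h} → (∀ π → Inj π → g π ≤ h π) → SP n g ≤ SP n h
SP-mono n {g} {h} p = subst₂ _≤_ (sym (SP-all n g)) (sym (SP-all n h)) (S-mono (allFuns n n) lem)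
  where
  lem : ∀ φ → ⟦ isInjective φ ⟧ * g φ ≤ ⟦ isInjective φ ⟧ * h φ
  lem φ with Inj-cases φ
  ... | inj₁ (i , q) = *-monoˡ (subst (0ℚ ≤_) (sym q) ≥0) (p φ i)
  ... | inj₂ (_ , q) = ≡⇒≤ (trans (*-zero q (g φ)) (sym (*-zero q (h φ))))

-- Change of variables: a sum over any index set that parametrises S_n bijectively.
transfer : ∀ (as : List A) (F : A → Sym n) {h} → Ext h → (∀ φ → S as (λ a → agree (F a) φ) ≡ ⟦ isInjective φ ⟧) → S as (h ∘ F) ≡ SP n h
transfer {n = n} as F {h} ext c = begin
  S as (h ∘ F) ≡⟨ S-cong as (λ a → sym (pick (F a) ext)) ⟩
  S as (λ a → S (allFuns n n) (λ φ → agree (F a) φ * h φ)) ≡⟨ S-swap as (allFuns n n) _ ⟩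
  S (allFuns n n) (λ φ → S as (λ a → agree (F a) φ * h φ)) ≡⟨ S-cong (allFuns n n) (λ φ → trans (S-*ʳ as (h φ) _) (cong (_* h φ) (c φ))) ⟩
  S (allFuns n n) (λ φ → ⟦ isInjective φ ⟧ * h φ) ≡⟨ sym (SP-all n h) ⟩
  SP n h ∎
  where open ≡-Reasoning

-- Involutions are their own inverses, so `b ∘ π ∘ a` agrees with φ exactly when `b ∘ φ ∘ a` agrees
-- with π. The relabellings applied later are transpositions and the identity.
SP-reindex : ∀ {h} → Ext h → (a b : Sym n) → (∀ i → a (a i) ≡ i) → (∀ i → b (b i) ≡ i) → SP n (λ π → h (b ∘ π ∘ a)) ≡ SP n h
SP-reindex {n} {h} ext a b aa bb = transfer (perms n) (λ π → b ∘ π ∘ a) ext count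
  where
  open ≡-Reasoning
  flip : ∀ φ π → (∀ i → b (π (a i)) ≡ φ i) → ∀ i → b (φ (a i)) ≡ π i
  flip φ π p i = trans (cong b (sym (p (a i)))) (trans (bb _) (cong π (aa i)))
  a-inj : Inj a
  a-inj p = trans (sym (aa _)) (trans (cong a p) (aa _))
  b-inj : Inj b
  b-inj p = trans (sym (bb _)) (trans (cong b p) (bb _))
  count : ∀ φ → SP n (λ π → agree (b ∘ π ∘ a) φ) ≡ ⟦ isInjective φ ⟧
  count φ = begin
    SP n (λ π → agree (b ∘ π ∘ a) φ)
      ≡⟨ SP-all n _ ⟩
    S (allFuns n n) (λ π → ⟦ isInjective π ⟧ * agree (b ∘ π ∘ a) φ)
      ≡⟨ S-cong (allFuns n n) (λ π → trans (cong (⟦ isInjective π ⟧ *_) (agree-iff _ _ (b ∘ φ ∘ a) π (flip φ π) (flip π φ))) (ℚ.*-comm ⟦ isInjective π ⟧ (agree (b ∘ φ ∘ a) π))) ⟩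
    S (allFuns n n) (λ π → agree (b ∘ φ ∘ a) π * ⟦ isInjective π ⟧)
      ≡⟨ pick (b ∘ φ ∘ a) injective-Ext ⟩
    ⟦ isInjective (b ∘ φ ∘ a) ⟧
      ≡⟨ Inj-≡ _ φ (λ inj p → trans (sym (aa _)) (trans (cong a (inj (cong b (trans (cong φ (aa _)) (trans p (sym (cong φ (aa _)))))))) (aa _))) (λ inj p → a-inj (inj (b-inj p))) ⟩
    ⟦ isInjective φ ⟧ ∎

-- The permutation with i ↦ j that acts as σ between the other rows and the other columns,
-- renumbered by skipping i and j.
ins : Fin (suc n) → Fin (suc n) → Sym n → Sym (suc n)
ins i j σ k with i ≟F k
... | yes _  = j
... | no i≢k = punchIn j (σ (punchOut i≢k))

ins-at : ∀ (i j : Fin (suc n)) σ → ins i j σ i ≡ j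
ins-at i j σ with i ≟F i
... | yes _ = refl
... | no ¬p = contradiction refl ¬p

ins-in : ∀ (i j : Fin (suc n)) σ k → ins i j σ (punchIn i k) ≡ punchIn j (σ k)
ins-in i j σ k with i ≟F punchIn i k
... | yes p = contradiction (sym p) (punchInᵢ≢i i k)
... | no ¬p = cong (punchIn j ∘ σ) (trans (punchOut-cong i refl) (punchOut-punchIn i))

data View (i : Fin (suc n)) : Fin (suc n) → Set where
  at : View i i
  in′ : ∀ k → View i (punchIn i k)

view : ∀ (i k : Fin (suc n)) → View i k
view i k with i ≟F k
... | yes refl = at
... | no i≢k = subst (View i) (punchIn-punchOut i≢k) (in′ (punchOut i≢k))

ins-Inj : ∀ (i j : Fin (suc n)) {σ : Sym n} → Inj σ → Inj (ins i j σ)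
ins-Inj i j {σ} inj {k} {l} p with view i k | view i l
... | at | at = refl
... | at | in′ l = contradiction (trans (sym (ins-in i j σ l)) (trans (sym p) (ins-at i j σ))) (punchInᵢ≢i j (σ l))
... | in′ k | at = contradiction (trans (sym (ins-in i j σ k)) (trans p (ins-at i j σ))) (punchInᵢ≢i j (σ k))
... | in′ k | in′ l = cong (punchIn i) (inj (punchIn-injective j _ _ (trans (sym (ins-in i j σ k)) (trans p (ins-in i j σ l)))))

-- Conditioning on the value at one point: the permutations with i ↦ j form a copy of S_n.
∑-SP-ins : ∀ (i : Fin (suc n)) {h} → Ext h → ∑ (λ j → SP n (h ∘ ins i j)) ≡ SP (suc n) h
∑-SP-ins {n} i {h} ext = trans (sym (split h)) (transfer pairs F ext count)
  where
  open ≡-Reasoning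
  pairs : List (Fin (suc n) × Sym n)
  pairs = concatMap (λ j → map (j ,_) (perms n)) (allFin (suc n))
  F : Fin (suc n) × Sym n → Sym (suc n)
  F (j , σ) = ins i j σ
  split : ∀ g → S pairs (g ∘ F) ≡ ∑ (λ j → SP n (g ∘ ins i j))
  split g = trans (S-concatMap (allFin (suc n)) (λ j → map (j ,_) (perms n)) (g ∘ F)) (trans (∑-def _) (∑-cong λ j → S-map (perms n) (j ,_) (g ∘ F)))
  count : ∀ φ → S pairs (λ a → agree (F a) φ) ≡ ⟦ isInjective φ ⟧
  count φ with Inj-cases φ
  ... | inj₂ (¬inj , q) = begin
    S pairs (λ a → agree (F a) φ) ≡⟨ split (λ π → agree π φ) ⟩
    ∑ (λ j → SP n (λ σ → agree (ins i j σ) φ)) ≡⟨ ∑-cong (λ j → trans (SP-cong n (λ σ inj → zero-e j σ inj)) (S-0 (perms n))) ⟩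
    ∑ {suc n} (λ j → 0ℚ) ≡⟨ ∑-0 (suc n) ⟩
    0ℚ ≡⟨ sym q ⟩
    ⟦ isInjective φ ⟧ ∎
    where
    zero-e : ∀ j σ → Inj σ → agree (ins i j σ) φ ≡ 0ℚ
    zero-e j σ inj with agree-cases (ins i j σ) φ
    ... | inj₁ (p , _) = contradiction (λ {k} {l} → Inj-ext p (ins-Inj i j inj) {k} {l}) ¬inj
    ... | inj₂ (_ , r) = r
  ... | inj₁ (inj , q) = begin
    S pairs (λ a → agree (F a) φ) ≡⟨ split (λ π → agree π φ) ⟩
    ∑ (λ j → SP n (λ σ → agree (ins i j σ) φ)) ≡⟨ ∑-cong (λ j → trans (S-cong (perms n) (factor j)) (S-* (perms n) (δ (φ i) j) (λ σ → agree rem σ))) ⟩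
    ∑ (λ j → δ (φ i) j * SP n (λ σ → agree rem σ)) ≡⟨ ∑-δ (φ i) (λ _ → SP n (λ σ → agree rem σ)) ⟩
    SP n (λ σ → agree rem σ) ≡⟨ SP-all n _ ⟩
    S (allFuns n n) (λ σ → ⟦ isInjective σ ⟧ * agree rem σ) ≡⟨ S-cong (allFuns n n) (λ σ → ℚ.*-comm ⟦ isInjective σ ⟧ (agree rem σ)) ⟩
    S (allFuns n n) (λ σ → agree rem σ * ⟦ isInjective σ ⟧) ≡⟨ pick rem injective-Ext ⟩
    ⟦ isInjective rem ⟧ ≡⟨ Inj-≡ rem φ (λ _ → inj) (λ _ {k} {l} p → punchIn-injective i k l (inj (punchOut-injective (φi≢ k) (φi≢ l) p))) ⟩
    ⟦ isInjective φ ⟧ ∎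
    where
    φi≢ : ∀ k → ¬ (φ i ≡ φ (punchIn i k))
    φi≢ k p = punchInᵢ≢i i k (sym (inj p))
    -- φ with row i and column φ i struck out: the only σ from which φ can be rebuilt.
    rem : Sym n
    rem k = punchOut (φi≢ k)
    factor : ∀ j σ → agree (ins i j σ) φ ≡ δ (φ i) j * agree rem σ
    factor j σ with δ-cases (φ i) j
    ... | inj₂ (p , r) = trans (lem (agree-cases (ins i j σ) φ)) (sym (*-zero r (agree rem σ)))
      where
      lem : ((∀ k → ins i j σ k ≡ φ k) × agree (ins i j σ) φ ≡ 1ℚ) ⊎ (¬ (∀ k → ins i j σ k ≡ φ k) × agree (ins i j σ) φ ≡ 0ℚ) → agree (ins i j σ) φ ≡ 0ℚ
      lem (inj₁ (s , _)) = contradiction (trans (sym (s i)) (ins-at i j σ)) p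
      lem (inj₂ (_ , s)) = s
    ... | inj₁ (refl , r) = trans (agree-iff (ins i j σ) φ rem σ to from) (sym (trans (cong (_* agree rem σ) r) (ℚ.*-identityˡ (agree rem σ))))
      where
      to : (∀ k → ins i j σ k ≡ φ k) → ∀ k → rem k ≡ σ k
      to s k = punchIn-injective (φ i) _ _ (trans (punchIn-punchOut (φi≢ k)) (trans (sym (s (punchIn i k))) (ins-in i j σ k)))
      from : (∀ k → rem k ≡ σ k) → ∀ k → ins i j σ k ≡ φ k
      from s k with view i k
      ... | at = ins-at i j σ
      ... | in′ k = trans (ins-in i j σ k) (trans (cong (punchIn (φ i)) (sym (s k))) (punchIn-punchOut (φi≢ k)))

-- Expectations

1/_! : ℕ → ℚ
1/ n ! = ℚ._/_ (ℤ.+ 1) (n ℕ.!) {{n ℕ.!≢0}}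

opaque
  unfolding ι

  ι-inverse : ∀ k .{{nz : ℕ.NonZero k}} → ι k * ℚ._/_ (ℤ.+ 1) k ≡ 1ℚ
  ι-inverse (suc k) = ℚ.toℚᵘ-injective (ℚᵘ.≃-trans (ℚ.toℚᵘ-homo-* (ι (suc k)) (ℤ.+ 1 ℚ./ suc k))
    (ℚᵘ.≃-trans (ℚᵘ.*-cong (ℚ.toℚᵘ-fromℚᵘ (ℚᵘ.mkℚᵘ (ℤ.+ suc k) 0)) (ℚ.toℚᵘ-fromℚᵘ (ℚᵘ.mkℚᵘ (ℤ.+ 1) k)))
    (ℚᵘ.*≡* (trans (ℤ.*-identityʳ _) (trans (ℤ.*-identityʳ (ℤ.+ suc k)) (sym (trans (ℤ.*-identityˡ _) (cong (λ z → ℤ.+ suc z) (ℕ.+-identityʳ k)))))))))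

1/!-suc : ∀ n → ι (suc n) * 1/ suc n ! ≡ 1/ n !
1/!-suc n = *-cancelˡ (ι (n ℕ.!)) 0<n! (begin
  ι (n ℕ.!) * (ι (suc n) * 1/ suc n !) ≡⟨ lem (ι (n ℕ.!)) (ι (suc n)) (1/ suc n !) ⟩
  ι (suc n) * ι (n ℕ.!) * 1/ suc n ! ≡⟨ cong (_* 1/ suc n !) (sym (ι-* (suc n) (n ℕ.!))) ⟩
  ι (suc n ℕ.!) * 1/ suc n ! ≡⟨ ι-inverse (suc n ℕ.!) {{suc n ℕ.!≢0}} ⟩
  1ℚ ≡⟨ sym (ι-inverse (n ℕ.!) {{n ℕ.!≢0}}) ⟩
  ι (n ℕ.!) * 1/ n ! ∎)
  where
  open ≡-Reasoning
  lem : ∀ a b c → a * (b * c) ≡ b * a * c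
  lem = solve-∀ R
  0<n! : 0ℚ < ι (n ℕ.!)
  0<n! with n ℕ.! | n ℕ.!≢0
  ... | suc k | _ = 0<ι k

0≤1/! : ∀ n → 0ℚ ≤ 1/ n !
0≤1/! zero = ≥0
0≤1/! (suc n) = *-cancelˡ-≤ (ι (suc n)) (0<ι n) (subst₂ _≤_ (sym (ℚ.*-zeroʳ (ι (suc n)))) (sym (1/!-suc n)) (0≤1/! n))

opaque
  E : ∀ n → (Sym n → ℚ) → ℚ
  E = 𝔼

opaque
  unfolding E

  E-def : ∀ n h → 𝔼 n h ≡ E n h
  E-def n h = refl

  E-cong : ∀ n {g h} → (∀ π → Inj π → g π ≡ h π) → E n g ≡ E n h
  E-cong n p = cong (_* 1/ n !) (SP-cong n p)

  E-mono : ∀ n {g h} → (∀ π → Inj π → g π ≤ h π) → E n g ≤ E n h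
  E-mono n p = ℚ.*-monoʳ-≤-nonNeg (1/ n !) {{ℚ.nonNegative (0≤1/! n)}} (SP-mono n p)

  E-+ : ∀ n g h → E n (λ π → g π + h π) ≡ E n g + E n h
  E-+ n g h = trans (cong (_* 1/ n !) (S-+ (perms n) g h)) (ℚ.*-distribʳ-+ (1/ n !) (SP n g) (SP n h))

  E-* : ∀ n k h → E n (λ π → k * h π) ≡ k * E n h
  E-* n k h = trans (cong (_* 1/ n !) (S-* (perms n) k h)) (ℚ.*-assoc k (SP n h) (1/ n !))

  E-∑ : ∀ n (g : Fin m → Sym n → ℚ) → E n (λ π → ∑ (λ a → g a π)) ≡ ∑ (λ a → E n (g a))
  E-∑ {m} n g = trans (cong (λ z → z * 1/ n !) (∑-S (perms n) (λ π a → g a π))) (sym (∑-*ʳ (1/ n !) (λ a → SP n (g a))))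

  E-reindex : ∀ {h} → Ext h → (a b : Sym n) → (∀ i → a (a i) ≡ i) → (∀ i → b (b i) ≡ i) → E n (λ π → h (b ∘ π ∘ a)) ≡ E n h
  E-reindex {n} ext a b p q = cong (_* 1/ n !) (SP-reindex ext a b p q)

  E-ins : ∀ (i : Fin (suc n)) {h} → Ext h → ι (suc n) * E (suc n) h ≡ ∑ (λ j → E n (h ∘ ins i j))
  E-ins {n} i {h} ext = begin
    ι (suc n) * (SP (suc n) h * 1/ suc n !) ≡⟨ *-exchange (ι (suc n)) (SP (suc n) h) (1/ suc n !) ⟩
    SP (suc n) h * (ι (suc n) * 1/ suc n !) ≡⟨ cong₂ _*_ (sym (∑-SP-ins i ext)) (1/!-suc n) ⟩
    ∑ (λ j → SP n (h ∘ ins i j)) * 1/ n ! ≡⟨ sym (∑-*ʳ (1/ n !) (λ j → SP n (h ∘ ins i j))) ⟩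
    ∑ (λ j → E n (h ∘ ins i j)) ∎
    where
    open ≡-Reasoning

  E-zero : ∀ h → Ext h → E 0 h ≡ h (λ ())
  E-zero h ext = trans (ℚ.*-identityʳ (h (λ ()) + 0ℚ)) (ℚ.+-identityʳ (h (λ ())))

E-const : ∀ n k → E n (λ _ → k) ≡ k
E-const zero k = E-zero (λ _ → k) (λ _ → refl)
E-const (suc n) k = *-cancelˡ (ι (suc n)) (0<ι n) (trans (E-ins {n} zero {λ _ → k} (λ _ → refl))
  (trans (∑-cong (λ _ → E-const n k)) (∑-const (suc n) k)))

E-nonneg : ∀ n {h} → (∀ π → Inj π → 0ℚ ≤ h π) → 0ℚ ≤ E n h
E-nonneg n {h} p = subst (λ z → z ≤ E n h) (E-const n 0ℚ) (E-mono n p)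

E-at : ∀ (i : Fin (suc n)) g → ι (suc n) * E (suc n) (λ π → g (π i)) ≡ ∑ g
E-at {n} i g = trans (E-ins i {λ π → g (π i)} (λ p → cong g (p i)))
  (∑-cong λ j → trans (E-cong n (λ σ _ → cong g (ins-at i j σ))) (E-const n (g j)))

-- Two distinct rows are sent to a uniformly random ordered pair of distinct columns, hence the
-- subtracted diagonal.
E-at₂ : ∀ (i : Fin (suc (suc n))) k (g : Fin (suc (suc n)) → Fin (suc (suc n)) → ℚ) →
  ι (suc (suc n)) * ι (suc n) * E (suc (suc n)) (λ π → g (π i) (π (punchIn i k))) ≡ ∑ (λ j → ∑ (g j)) - ∑ (λ j → g j j)
E-at₂ {n} i k g = begin
  a * b * E (suc (suc n)) h ≡⟨ lem₁ a b (E (suc (suc n)) h) ⟩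
  b * (a * E (suc (suc n)) h) ≡⟨ cong (b *_) (E-ins i {h} λ p → cong₂ g (p i) (p _)) ⟩
  b * ∑ (λ j → E (suc n) (h ∘ ins i j)) ≡⟨ sym (∑-* b _) ⟩
  ∑ (λ j → b * E (suc n) (h ∘ ins i j)) ≡⟨ ∑-cong inner ⟩
  ∑ (λ j → ∑ (g j) + (- 1ℚ) * g j j) ≡⟨ ∑-+ (λ j → ∑ (g j)) (λ j → (- 1ℚ) * g j j) ⟩
  ∑ (λ j → ∑ (g j)) + ∑ (λ j → (- 1ℚ) * g j j) ≡⟨ cong (∑ (λ j → ∑ (g j)) +_) (trans (∑-* (- 1ℚ) (λ j → g j j)) (lem₂ (∑ (λ j → g j j)))) ⟩
  ∑ (λ j → ∑ (g j)) - ∑ (λ j → g j j) ∎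
  where
  open ≡-Reasoning
  a b : ℚ
  a = ι (suc (suc n))
  b = ι (suc n)
  h : Sym (suc (suc n)) → ℚ
  h π = g (π i) (π (punchIn i k))
  lem₁ : ∀ a b c → a * b * c ≡ b * (a * c)
  lem₁ = solve-∀ R
  lem₂ : ∀ a → (- 1ℚ) * a ≡ - a
  lem₂ = solve-∀ R
  lem₃ : ∀ x y → y ≡ x + y + (- 1ℚ) * x
  lem₃ = solve-∀ R
  inner : ∀ j → b * E (suc n) (h ∘ ins i j) ≡ ∑ (g j) + (- 1ℚ) * g j j
  inner j = begin
    b * E (suc n) (h ∘ ins i j) ≡⟨ cong (b *_) (E-cong (suc n) λ σ _ → cong₂ g (ins-at i j σ) (ins-in i j σ k)) ⟩
    b * E (suc n) (λ σ → g j (punchIn j (σ k))) ≡⟨ E-at k (λ l → g j (punchIn j l)) ⟩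
    ∑ (λ l → g j (punchIn j l)) ≡⟨ lem₃ (g j j) _ ⟩
    g j j + ∑ (λ l → g j (punchIn j l)) + (- 1ℚ) * g j j ≡⟨ cong (_+ (- 1ℚ) * g j j) (sym (∑-punch j (g j))) ⟩
    ∑ (g j) + (- 1ℚ) * g j j ∎

-- Moments of linear functions

Matrix : ℕ → Set
Matrix n = Fin n → Fin n → ℚ

L : Matrix n → Sym n → ℚ
L c π = ∑ (λ i → c i (π i))

L-Ext : ∀ (c : Matrix n) → Ext (L c)
L-Ext {n} c p = ∑-cong λ i → cong (c i) (p i)

linear≡L : ∀ (c : Matrix n) π → linear n c π ≡ L c π
linear≡L {n} c π = trans (S-cong (allFin n) λ i → ∑-def _) (trans (∑-def _) (∑-cong λ i → trans (∑-cong λ j → ℚ.*-comm (c i j) (δ (π i) j)) (∑-δ (π i) (c i))))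

row col : Matrix n → Fin n → ℚ
row c i = ∑ (c i)
col c j = ∑ (λ i → c i j)

total N₂ R₂ C₂ : Matrix n → ℚ
total c = ∑ (row c)
N₂ c = ∑ (λ i → ∑ (λ j → sq (c i j)))
R₂ c = ∑ (λ i → sq (row c i))
C₂ c = ∑ (λ j → sq (col c j))

E-L : ∀ (c : Matrix (suc n)) → ι (suc n) * E (suc n) (L c) ≡ total c
E-L {n} c = trans (cong (ι (suc n) *_) (E-∑ (suc n) (λ i π → c i (π i))))
  (trans (sym (∑-* (ι (suc n)) (λ i → E (suc n) (λ π → c i (π i))))) (∑-cong λ i → E-at i (c i)))

-- Two entries in different rows and columns are hit together with probability 1/(ab), where a = n +
-- 2 and b = n + 1. By inclusion and exclusion their products sum to total² - R₂ - C₂ + N₂; the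
-- squares of single entries add b·N₂, and b + 1 = a.
E-L² : ∀ (c : Matrix (suc (suc n))) → ι (suc (suc n)) * ι (suc n) * E (suc (suc n)) (sq ∘ L c) ≡
  ι (suc (suc n)) * N₂ c + sq (total c) - R₂ c - C₂ c
E-L² {n} c = begin
  a * b * E N (sq ∘ L c)
    ≡⟨ cong (a * b *_) (E-cong N λ π _ → ∑-prod (λ i → c i (π i)) (λ k → c k (π k))) ⟩
  a * b * E N (λ π → ∑ λ i → ∑ λ k → c i (π i) * c k (π k))
    ≡⟨ cong (a * b *_) (trans (E-∑ N _) (∑-cong λ i → E-∑ N _)) ⟩
  a * b * ∑ (λ i → ∑ λ k → P i k)
    ≡⟨ sym (∑-* (a * b) _) ⟩
  ∑ (λ i → a * b * ∑ λ k → P i k)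
    ≡⟨ ∑-cong inner ⟩
  ∑ (λ i → a * n₂ i + (∑ (G i) - sq (row c i)))
    ≡⟨ trans (∑-+ (λ i → a * n₂ i) _) (cong₂ _+_ (∑-* a n₂) (∑-- (λ i → ∑ (G i)) (λ i → sq (row c i)))) ⟩
  a * N₂ c + (∑ (λ i → ∑ (G i)) - R₂ c)
    ≡⟨ cong (λ z → a * N₂ c + (z - R₂ c)) sumG ⟩
  a * N₂ c + (sq (total c) - C₂ c - R₂ c)
    ≡⟨ lem (a * N₂ c) (sq (total c)) (C₂ c) (R₂ c) ⟩
  a * N₂ c + sq (total c) - R₂ c - C₂ c ∎
  where
  open ≡-Reasoning
  N : ℕ
  N = suc (suc n)
  a b : ℚ
  a = ι (suc (suc n))
  b = ι (suc n)
  n₂ : Fin N → ℚ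
  n₂ i = ∑ (λ j → sq (c i j))
  P G : Fin N → Fin N → ℚ
  P i k = E N (λ π → c i (π i) * c k (π k))
  G i k = row c i * row c k - ∑ (λ j → c i j * c k j)
  lem : ∀ x y z w → x + (y - z - w) ≡ x + y - w - z
  lem = solve-∀ R
  diag : ∀ i → a * P i i ≡ n₂ i
  diag i = E-at i (λ j → sq (c i j))
  off : ∀ i k → a * b * P i (punchIn i k) ≡ G i (punchIn i k)
  off i k = trans (E-at₂ i k (λ j l → c i j * c (punchIn i k) l)) (cong (_- ∑ (λ j → c i j * c (punchIn i k) j)) (sym (∑-prod (c i) (c (punchIn i k)))))
  lem₂ : ∀ a b x y → a * b * (x + y) ≡ b * (a * x) + a * b * y
  lem₂ = solve-∀ R
  lem₃ : ∀ b q z y → b * q + y ≡ (1 + b) * q + (z - q + y - z)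
  lem₃ = solve-∀ R
  inner : ∀ i → a * b * ∑ (λ k → P i k) ≡ a * n₂ i + (∑ (G i) - sq (row c i))
  inner i = begin
    a * b * ∑ (P i) ≡⟨ cong (a * b *_) (∑-punch i (P i)) ⟩
    a * b * (P i i + ∑ (λ k → P i (punchIn i k))) ≡⟨ lem₂ a b (P i i) _ ⟩
    b * (a * P i i) + a * b * ∑ (λ k → P i (punchIn i k)) ≡⟨ cong₂ _+_ (cong (b *_) (diag i)) (trans (sym (∑-* (a * b) (λ k → P i (punchIn i k)))) (∑-cong (off i))) ⟩
    b * n₂ i + ∑ (λ k → G i (punchIn i k)) ≡⟨ lem₃ b (n₂ i) (sq (row c i)) _ ⟩
    (1 + b) * n₂ i + (G i i + ∑ (λ k → G i (punchIn i k)) - sq (row c i)) ≡⟨ cong₂ (λ x y → x * n₂ i + (y - sq (row c i))) (sym (ι-suc (suc n))) (sym (∑-punch i (G i))) ⟩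
    a * n₂ i + (∑ (G i) - sq (row c i)) ∎
  sumG : ∑ (λ i → ∑ (G i)) ≡ sq (total c) - C₂ c
  sumG = begin
    ∑ (λ i → ∑ (G i))
      ≡⟨ ∑-cong (λ i → ∑-- (λ k → row c i * row c k) (λ k → ∑ (λ j → c i j * c k j))) ⟩
    ∑ (λ i → ∑ (λ k → row c i * row c k) - ∑ (λ k → ∑ (λ j → c i j * c k j)))
      ≡⟨ ∑-- _ _ ⟩
    ∑ (λ i → ∑ (λ k → row c i * row c k)) - ∑ (λ i → ∑ (λ k → ∑ (λ j → c i j * c k j)))
      ≡⟨ cong₂ _-_ (sym (∑-prod (row c) (row c))) swapped ⟩
    sq (total c) - C₂ c ∎
    where
    swapped : ∑ (λ i → ∑ (λ k → ∑ (λ j → c i j * c k j))) ≡ C₂ c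
    swapped = trans (∑-cong λ i → ∑-swap (λ k j → c i j * c k j))
      (trans (∑-swap (λ i j → ∑ (λ k → c i j * c k j))) (∑-cong λ j → sym (∑-prod (λ i → c i j) (λ k → c k j))))

E-- : ∀ n g h → E n (λ π → g π - h π) ≡ E n g - E n h
E-- n g h = trans (E-+ n g (λ π → - h π)) (cong (E n g +_) (trans (E-cong n λ π _ → lem (h π)) (trans (E-* n (- 1ℚ) h) (sym (lem (E n h))))))
  where lem : ∀ x → - x ≡ (- 1ℚ) * x
        lem = solve-∀ R

module _ {n : ℕ} (g : Sym n → ℚ) {m : ℚ} (mean : E n g ≡ m) where

  -- The cross term vanishes because m is the mean. Later β is the distance of the mean from a more
  -- convenient constant, often an integer.
  E-shift : ∀ β → E n (λ π → sq (β + (g π - m))) ≡ sq β + E n (λ π → sq (g π - m))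
  E-shift β = begin
    E n (λ π → sq (β + (g π - m)))
      ≡⟨ E-cong n (λ π _ → lem₁ β (g π) m) ⟩
    E n (λ π → sq β + (2 * β * (g π - m) + sq (g π - m)))
      ≡⟨ trans (E-+ n _ _) (cong₂ _+_ (E-const n (sq β)) (trans (E-+ n _ _) (cong (_+ V) (trans (E-* n (2 * β) _) (cong (2 * β *_) (trans (E-- n g (λ _ → m)) (cong₂ _-_ mean (E-const n m)))))))) ⟩
    sq β + (2 * β * (m - m) + V)
      ≡⟨ lem₂ β m V ⟩
    sq β + V ∎
    where
    open ≡-Reasoning
    V : ℚ
    V = E n (λ π → sq (g π - m))
    lem₁ : ∀ β g m → (β + (g - m)) * (β + (g - m)) ≡ β * β + (2 * β * (g - m) + (g - m) * (g - m))
    lem₁ = solve-∀ R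
    lem₂ : ∀ β m V → β * β + (2 * β * (m - m) + V) ≡ β * β + V
    lem₂ = solve-∀ R

  variance : E n (λ π → sq (g π - m)) ≡ E n (sq ∘ g) - sq m
  variance = begin
    V ≡⟨ lem m V ⟩
    sq m + V - sq m ≡⟨ cong (_- sq m) (sym (E-shift m)) ⟩
    E n (λ π → sq (m + (g π - m))) - sq m ≡⟨ cong (_- sq m) (E-cong n λ π _ → cong sq (lem₂ m (g π))) ⟩
    E n (sq ∘ g) - sq m ∎
    where
    open ≡-Reasoning
    V : ℚ
    V = E n (λ π → sq (g π - m))
    lem : ∀ m V → V ≡ m * m + V - m * m
    lem = solve-∀ R
    lem₂ : ∀ m g → m + (g - m) ≡ g
    lem₂ = solve-∀ R

∑∑-sq-diff : ∀ (u : Fin n → ℚ) → ∑ (λ i → ∑ (λ k → sq (u i - u k))) ≡ 2 * (ι n * ∑ (sq ∘ u) - sq (∑ u))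
∑∑-sq-diff {n} u = begin
  ∑ (λ i → ∑ (λ k → sq (u i - u k)))
    ≡⟨ ∑-cong (λ i → trans (∑-cong λ k → lem₁ (u i) (u k)) (trans (∑-+ _ _) (cong₂ _+_ (∑-const n (sq (u i))) (∑-- (sq ∘ u) _)))) ⟩
  ∑ (λ i → ι n * sq (u i) + (Q - ∑ (λ k → 2 * u i * u k)))
    ≡⟨ trans (∑-+ _ _) (cong₂ _+_ (∑-* (ι n) (sq ∘ u)) (trans (∑-- (λ _ → Q) _) (cong₂ _-_ (∑-const n Q) (trans (∑-cong λ i → ∑-* (2 * u i) u) (trans (∑-*ʳ (∑ u) (λ i → 2 * u i)) (cong (_* ∑ u) (∑-* 2 u))))))) ⟩
  ι n * Q + (ι n * Q - 2 * ∑ u * ∑ u)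
    ≡⟨ lem₂ (ι n) Q (∑ u) ⟩
  2 * (ι n * Q - sq (∑ u)) ∎
  where
  open ≡-Reasoning
  Q : ℚ
  Q = ∑ (sq ∘ u)
  lem₁ : ∀ x y → (x - y) * (x - y) ≡ x * x + (y * y - 2 * x * y)
  lem₁ = solve-∀ R
  lem₂ : ∀ a q s → a * q + (a * q - 2 * s * s) ≡ 2 * (a * q - s * s)
  lem₂ = solve-∀ R

Δ : Matrix n → Fin n → Fin n → Fin n → Fin n → ℚ
Δ c i k j l = c i j + c k l - c i l - c k j

∑⁴ : (Fin n → Fin n → Fin n → Fin n → ℚ) → ℚ
∑⁴ F = ∑ (λ i → ∑ (λ k → ∑ (λ j → ∑ (λ l → F i k j l))))

-- Δ is a second difference: for fixed rows it is a difference of two values of the vector c i - c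
-- k. The identity for pairwise differences is applied in the columns and then in the rows.
∑⁴-Δ² : ∀ (c : Matrix n) → ∑⁴ (λ i k j l → sq (Δ c i k j l)) ≡ 4 * (sq (ι n) * N₂ c + sq (total c) - ι n * R₂ c - ι n * C₂ c)
∑⁴-Δ² {n} c = begin
  ∑⁴ (λ i k j l → sq (Δ c i k j l))
    ≡⟨ ∑-cong (λ i → ∑-cong λ k → inner i k) ⟩
  ∑ (λ i → ∑ λ k → 2 * (a * ∑ (λ j → sq (c i j - c k j)) - sq (row c i - row c k)))
    ≡⟨ ∑-cong (λ i → trans (∑-* 2 _) (cong (2 *_) (trans (∑-- _ _) (cong (_- ∑ (λ k → sq (row c i - row c k))) (∑-* a _))))) ⟩
  ∑ (λ i → 2 * (a * ∑ (λ k → ∑ (λ j → sq (c i j - c k j))) - ∑ (λ k → sq (row c i - row c k))))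
    ≡⟨ trans (∑-* 2 _) (cong (2 *_) (trans (∑-- _ _) (cong₂ _-_ (trans (∑-* a _) (cong (a *_) cols)) (∑∑-sq-diff (row c))))) ⟩
  2 * (a * (2 * (a * N₂ c - C₂ c)) - 2 * (a * R₂ c - sq (total c)))
    ≡⟨ lem a (N₂ c) (R₂ c) (C₂ c) (total c) ⟩
  4 * (sq a * N₂ c + sq (total c) - a * R₂ c - a * C₂ c) ∎
  where
  open ≡-Reasoning
  a : ℚ
  a = ι n
  lem : ∀ a n r c t → 2 * (a * (2 * (a * n - c)) - 2 * (a * r - t * t)) ≡ 4 * (a * a * n + t * t - a * r - a * c)
  lem = solve-∀ R
  lem₁ : ∀ x y z w → x + y - z - w ≡ x - w - (z - y)
  lem₁ = solve-∀ R
  inner : ∀ i k → ∑ (λ j → ∑ (λ l → sq (Δ c i k j l))) ≡ 2 * (a * ∑ (λ j → sq (c i j - c k j)) - sq (row c i - row c k))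
  inner i k = trans (∑-cong λ j → ∑-cong λ l → cong sq (lem₁ (c i j) (c k l) (c i l) (c k j)))
    (trans (∑∑-sq-diff (λ j → c i j - c k j)) (cong (λ z → 2 * (a * ∑ (λ j → sq (c i j - c k j)) - sq z)) (∑-- (c i) (c k))))
  cols : ∑ (λ i → ∑ (λ k → ∑ (λ j → sq (c i j - c k j)))) ≡ 2 * (a * N₂ c - C₂ c)
  cols = begin
    ∑ (λ i → ∑ (λ k → ∑ (λ j → sq (c i j - c k j))))
      ≡⟨ trans (∑-cong λ i → ∑-swap _) (∑-swap _) ⟩
    ∑ (λ j → ∑ (λ i → ∑ (λ k → sq (c i j - c k j))))
      ≡⟨ ∑-cong (λ j → ∑∑-sq-diff (λ i → c i j)) ⟩
    ∑ (λ j → 2 * (a * ∑ (λ i → sq (c i j)) - sq (col c j)))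
      ≡⟨ trans (∑-* 2 _) (cong (2 *_) (trans (∑-- _ _) (cong (_- C₂ c) (trans (∑-* a _) (cong (a *_) (∑-swap (λ j i → sq (c i j)))))))) ⟩
    2 * (a * N₂ c - C₂ c) ∎

module _ {n : ℕ} (c : Matrix (suc (suc n))) where
  private
    N : ℕ
    N = suc (suc n)
    a b : ℚ
    a = ι N
    b = ι (suc n)
    0<a : 0ℚ < a
    0<a = 0<ι (suc n)

  mean-L : ∀ {m} → a * m ≡ total c → E N (L c) ≡ m
  mean-L p = *-cancelˡ a 0<a (trans (E-L c) (sym p))

  -- Dividing by the a² choices of (i , j) shows that the matrix of Δ with a fixed base has mean
  -- energy exactly 4b times the variance. This is the source of the bound on Σ z².
  ∑⁴-Δ²-variance : ∑⁴ (λ i k j l → sq (Δ c i k j l)) ≡ sq a * (4 * b * (E N (sq ∘ L c) - sq (E N (L c))))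
  ∑⁴-Δ²-variance = begin
    ∑⁴ (λ i k j l → sq (Δ c i k j l)) ≡⟨ ∑⁴-Δ² c ⟩
    4 * (sq a * N₂ c + sq (total c) - a * R₂ c - a * C₂ c) ≡⟨ lem₁ a b (N₂ c) (total c) (R₂ c) (C₂ c) (ι-suc (suc n)) ⟩
    4 * (a * (a * N₂ c + sq (total c) - R₂ c - C₂ c) - b * sq (total c)) ≡⟨ cong₂ (λ x y → 4 * (a * x - b * sq y)) (sym (E-L² c)) (sym (E-L c)) ⟩
    4 * (a * (a * b * E N (sq ∘ L c)) - b * sq (a * E N (L c))) ≡⟨ lem₂ a b (E N (sq ∘ L c)) (E N (L c)) ⟩
    sq a * (4 * b * (E N (sq ∘ L c) - sq (E N (L c)))) ∎
    where
    open ≡-Reasoning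
    lem₁ : ∀ a b n t r c → a ≡ 1 + b → 4 * (a * a * n + t * t - a * r - a * c) ≡ 4 * (a * (a * n + t * t - r - c) - b * (t * t))
    lem₁ _ b n t r c refl = solve (b ∷ n ∷ t ∷ r ∷ c ∷ []) R
    lem₂ : ∀ a b x y → 4 * (a * (a * b * x) - b * ((a * y) * (a * y))) ≡ a * a * (4 * b * (x - y * y))
    lem₂ = solve-∀ R

  -- The row sums average to m, so R₂ ≥ a·m², which pays for the contribution of the mean; C₂ ≥ 0 is
  -- dropped.
  variance-bound : ∀ {m} → a * m ≡ total c → b * E N (λ π → sq (L c π - m)) ≤ N₂ c
  variance-bound {m} p = *-cancelˡ-≤ a 0<a (subst (_≤ a * N₂ c) (sym eq) bound)
    where
    open ≡-Reasoning
    rows : 0ℚ ≤ R₂ c - a * sq m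
    rows = subst (0ℚ ≤_) (begin
      ∑ (λ i → sq (row c i - m)) ≡⟨ ∑-cong (λ i → lem (row c i) m) ⟩
      ∑ (λ i → sq (row c i) - (2 * m * row c i - sq m)) ≡⟨ trans (∑-- _ _) (cong (λ z → R₂ c - z) (trans (∑-- _ _) (cong₂ _-_ (∑-* (2 * m) (row c)) (∑-const N (sq m))))) ⟩
      R₂ c - (2 * m * total c - a * sq m) ≡⟨ cong (λ z → R₂ c - (2 * m * z - a * sq m)) (sym p) ⟩
      R₂ c - (2 * m * (a * m) - a * sq m) ≡⟨ lem₃ (R₂ c) m a ⟩
      R₂ c - a * sq m ∎) (∑-nonneg λ i → 0≤sq (row c i - m))
      where
      lem : ∀ r m → (r - m) * (r - m) ≡ r * r - (2 * m * r - m * m)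
      lem = solve-∀ R
      lem₃ : ∀ r m a → r - (2 * m * (a * m) - a * (m * m)) ≡ r - a * (m * m)
      lem₃ = solve-∀ R
    eq : a * (b * E N (λ π → sq (L c π - m))) ≡ a * N₂ c + sq (a * m) - R₂ c - C₂ c - a * b * sq m
    eq = begin
      a * (b * E N (λ π → sq (L c π - m))) ≡⟨ cong (λ z → a * (b * z)) (variance (L c) (mean-L p)) ⟩
      a * (b * (E N (sq ∘ L c) - sq m)) ≡⟨ lem a b (E N (sq ∘ L c)) m ⟩
      a * b * E N (sq ∘ L c) - a * b * sq m ≡⟨ cong (_- a * b * sq m) (trans (E-L² c) (cong (λ z → a * N₂ c + sq z - R₂ c - C₂ c) (sym p))) ⟩
      a * N₂ c + sq (a * m) - R₂ c - C₂ c - a * b * sq m ∎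
      where lem : ∀ a b x m → a * (b * (x - m * m)) ≡ a * b * x - a * b * (m * m)
            lem = solve-∀ R
    bound : a * N₂ c + sq (a * m) - R₂ c - C₂ c - a * b * sq m ≤ a * N₂ c
    bound = by (rows ⊞ ∑-nonneg (λ j → 0≤sq (col c j))) (lem a b m (N₂ c) (R₂ c) (C₂ c) (ι-suc (suc n)))
      where lem : ∀ a b m n r c → a ≡ 1 + b → a * n ≡ a * n + (a * m) * (a * m) - r - c - a * b * (m * m) + (r - a * (m * m) + c)
            lem _ b m n r c refl = solve (b ∷ m ∷ n ∷ r ∷ c ∷ []) R

-- The distance to {0,1} and to ℤ

φ : ℚ → ℚ
φ y = sq (dist01 y)

Bit : ℚ → Set
Bit r = r ≡ 0ℚ ⊎ r ≡ 1ℚ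

Bit-Int : ∀ {r} → Bit r → Int r
Bit-Int (inj₁ refl) = Int0
Bit-Int (inj₂ refl) = Int1

sq-∣∣ : ∀ y → sq ∣ y ∣ ≡ sq y
sq-∣∣ y with ℚ.∣p∣≡p∨∣p∣≡-p y
... | inj₁ p = cong sq p
... | inj₂ p = trans (cong sq p) (sq-neg y)

sq-mono : ∀ {a b} → 0ℚ ≤ a → a ≤ b → sq a ≤ sq b
sq-mono {a} {b} p q = by (diff q ⊡ (p ⊞ p ⊞ diff q)) (lem a b)
  where lem : ∀ a b → b * b ≡ a * a + (b - a) * (a + a + (b - a))
        lem = solve-∀ R

0≤dist01 : ∀ y → 0ℚ ≤ dist01 y
0≤dist01 y = ℚ.⊓-glb (ℚ.0≤∣p∣ y) (ℚ.0≤∣p∣ (y - 1ℚ))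

Nearest : ℚ → Set
Nearest y = ∃ λ s → Bit s × φ y ≡ sq (y - s)

φ-attained : ∀ y → Nearest y
φ-attained y with ℚ.⊓-sel ∣ y ∣ ∣ y - 1ℚ ∣
... | inj₁ p = 0ℚ , inj₁ refl , trans (cong sq p) (trans (sq-∣∣ y) (cong sq {y} {y - 0ℚ} (solve (y ∷ []) R)))
... | inj₂ p = 1ℚ , inj₂ refl , trans (cong sq p) (sq-∣∣ (y - 1ℚ))

φ-min : ∀ y {r} → Bit r → φ y ≤ sq (y - r)
φ-min y (inj₁ refl) = ≤-trans (sq-mono (0≤dist01 y) (ℚ.p⊓q≤p ∣ y ∣ ∣ y - 1ℚ ∣)) (≡⇒≤ (trans (sq-∣∣ y) (cong sq {y} {y - 0ℚ} (solve (y ∷ []) R))))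
φ-min y (inj₂ refl) = ≤-trans (sq-mono (0≤dist01 y) (ℚ.p⊓q≤q ∣ y ∣ ∣ y - 1ℚ ∣)) (≡⇒≤ (sq-∣∣ (y - 1ℚ)))

0≤φ : ∀ y → 0ℚ ≤ φ y
0≤φ y = 0≤sq (dist01 y)

sq-+-≤ : ∀ x y → sq (x + y) ≤ 2 * sq x + 2 * sq y
sq-+-≤ x y = by (0≤sq (x - y)) (lem x y)
  where lem : ∀ x y → 2 * (x * x) + 2 * (y * y) ≡ (x + y) * (x + y) + (x - y) * (x - y)
        lem = solve-∀ R

φ-perturb : ∀ x y → φ x ≤ 2 * φ y + 2 * sq (x - y)
φ-perturb x y with φ-attained y
... | r , br , eq = ≤-trans (φ-min x br) (subst₂ _≤_ (cong sq {y - r + (x - y)} {x - r} (lem x y r)) (cong (λ z → 2 * z + 2 * sq (x - y)) (sym eq)) (sq-+-≤ (y - r) (x - y)))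
  where lem : ∀ x y r → y - r + (x - y) ≡ x - r
        lem = solve-∀ R

-- The difference of the two nearest bits is an integer.
distℤ²-diff : ∀ x y → distℤ² (x - y) ≤ 2 * φ x + 2 * φ y
distℤ²-diff x y with φ-attained x | φ-attained y
... | r , br , p | s , bs , q rewrite p | q = ≤-trans (distℤ²-min (x - y) (Int-- (Bit-Int br) (Bit-Int bs))) (by (0≤sq (x - r + (y - s))) (lem x y r s))
  where lem : ∀ x y r s → 2 * ((x - r) * (x - r)) + 2 * ((y - s) * (y - s)) ≡ (x - y - (r - s)) * (x - y - (r - s)) + (x - r + (y - s)) * (x - r + (y - s))
        lem = solve-∀ R

0≤distℤ² : ∀ x → 0ℚ ≤ distℤ² x
0≤distℤ² x = 0≤sq (x - rnd x)

-- A quartic minorant of the squared distance to ℤ, whose averages are computable from moments.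
quartic : ℚ → ℚ
quartic x = sq x - 2 * sq (sq x)

-- If 2x² ≥ 1 the left side is at most 0. Otherwise a change of sign leaves k ≥ 1 besides the
-- trivial k = 0: for k = 1 the difference is a sum of squares, and an integer k ≥ 2 is far away
-- since x ≤ 1.
quartic-≤ : ∀ x {k} → Int k → quartic x ≤ sq (x - k)
quartic-≤ x {k} ik with 1ℚ ℚ.≤? 2 * sq x
... | yes p = by (0≤sq x ⊡ diff p ⊞ 0≤sq (x - k)) (lem x k)
  where lem : ∀ x k → (x - k) * (x - k) ≡ x * x - 2 * (x * x * (x * x)) + (x * x * (2 * (x * x) - 1ℚ) + (x - k) * (x - k))
        lem = solve-∀ R
... | no ¬p = small (≰-≥ ¬p)
  where
  below-1 : ∀ y → 2 * sq y ≤ 1ℚ → y ≤ 1ℚ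
  below-1 y q = by (≥0 {½} ⊡ diff q ⊞ 0≤sq (y - ½) ⊞ ≥0 {½ * ½}) (lem y)
    where lem : ∀ y → 1ℚ ≡ y + (½ * (1ℚ - 2 * (y * y)) + (y - ½) * (y - ½) + ½ * ½)
          lem = solve-∀ R
  positive : ∀ x {k} → 2 * sq x ≤ 1ℚ → Int k → 1ℚ ≤ k → quartic x ≤ sq (x - k)
  positive x {k} q ik 1≤k with int-gap-at 1ℚ Int1 ik
  ... | inj₁ k≤1 rewrite ≤-antisym k≤1 1≤k = by (≥0 {2} ⊡ 0≤sq (sq x - ½) ⊞ ≥0 {2} ⊡ 0≤sq (x - ½)) (lem x)
    where lem : ∀ x → (x - 1ℚ) * (x - 1ℚ) ≡ x * x - 2 * (x * x * (x * x)) + (2 * ((x * x - ½) * (x * x - ½)) + 2 * ((x - ½) * (x - ½)))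
          lem = solve-∀ R
  ... | inj₂ 2≤k = by ((diff 2≤k ⊞ ≥0 {2}) ⊡ (diff 2≤k ⊞ ≥0 {2} ⊡ diff (below-1 x q)) ⊞ ≥0 {2} ⊡ 0≤sq (sq x)) (lem x k)
    where lem : ∀ x k → (x - k) * (x - k) ≡ x * x - 2 * (x * x * (x * x)) + ((k - (1ℚ + 1) + 2) * (k - (1ℚ + 1) + 2 * (1ℚ - x)) + 2 * (x * x * (x * x)))
          lem = solve-∀ R
  small : 2 * sq x ≤ 1ℚ → quartic x ≤ sq (x - k)
  small q with int-gap ik
  ... | inj₂ 1≤k = positive x q ik 1≤k
  ... | inj₁ k≤0 with int-gap (Int-neg ik)
  ...   | inj₂ 1≤-k = subst₂ _≤_ (lem₁ x) (lem₂ x k) (positive (- x) (subst (_≤ 1ℚ) (lem₃ x) q) (Int-neg ik) 1≤-k)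
    where lem₁ : ∀ x → (- x) * (- x) - 2 * ((- x) * (- x) * ((- x) * (- x))) ≡ x * x - 2 * (x * x * (x * x))
          lem₁ = solve-∀ R
          lem₂ : ∀ x k → (- x - - k) * (- x - - k) ≡ (x - k) * (x - k)
          lem₂ = solve-∀ R
          lem₃ : ∀ x → 2 * (x * x) ≡ 2 * ((- x) * (- x))
          lem₃ = solve-∀ R
  ...   | inj₁ -k≤0 = subst (λ z → quartic x ≤ sq (x - z)) (sym k≡0) (by (≥0 {2} ⊡ 0≤sq (sq x)) (lem x))
    where k≡0 : k ≡ 0ℚ
          k≡0 = ≤-antisym k≤0 (by (diff -k≤0) (solve (k ∷ []) R))
          lem : ∀ x → (x - 0ℚ) * (x - 0ℚ) ≡ x * x - 2 * (x * x * (x * x)) + 2 * (x * x * (x * x))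
          lem = solve-∀ R

distℤ²-≥quartic : ∀ u {k} → Int k → quartic (u - k) ≤ distℤ² u
distℤ²-≥quartic u {k} ik = subst (λ z → quartic (u - k) ≤ sq z) (lem u k (rnd u)) (quartic-≤ (u - k) (Int-- (Int-rnd u) ik))
  where lem : ∀ u k r → u - k - (r - k) ≡ u - r
        lem = solve-∀ R

-- A lazy random walk

-- Small enough that steps of total square at most 4 give Q ≤ 1/24, where the second moment dominates the quartic loss.
rate : ℚ
rate = ℚ._/_ (ℤ.+ 1) 192

-- The expectation of F at u plus independent steps: each d of the list contributes d or -d with
-- probability `rate` each, and 0 otherwise.
walk : List ℚ → (ℚ → ℚ) → ℚ → ℚ
walk []       F u = F u
walk (d ∷ ds) F u = (1ℚ - 2 * rate) * walk ds F u + rate * (walk ds F (u + d) + walk ds F (u - d))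

-- Q and M are the second and fourth moments of the walk whose steps are the residues of ds modulo ℤ.
Q M : List ℚ → ℚ
Q ds = 2 * rate * S ds distℤ²
M []       = 0ℚ
M (d ∷ ds) = M ds + 2 * rate * sq (distℤ² d) + 12 * rate * Q ds * distℤ² d

-- The mean of `quartic` at x plus a symmetric random variable with second moment q and fourth
-- moment m.
walk-quartic : ℚ → ℚ → ℚ → ℚ
walk-quartic q m x = sq x + q - 2 * (sq (sq x) + 6 * sq x * q + m)

-- The distance to ℤ ignores integer parts, so each step is replaced by its residue while k absorbs
-- the rounded part. Odd moments cancel between d and -d, which makes the inductive step an
-- identity.
walk-lower : ∀ ds u {k} → Int k → walk-quartic (Q ds) (M ds) (u - k) ≤ walk ds distℤ² u
walk-lower [] u {k} ik = subst (_≤ distℤ² u) (lem (u - k)) (distℤ²-≥quartic u ik)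
  where lem : ∀ x → x * x - 2 * (x * x * (x * x)) ≡ x * x + 2 * rate * 0ℚ - 2 * (x * x * (x * x) + 6 * (x * x) * (2 * rate * 0ℚ) + 0ℚ)
        lem = solve-∀ R
walk-lower (d ∷ ds) u {k} ik = ≤-trans (≡⇒≤ (lem (u - k) (d - rnd d) (Q ds) (M ds) (S ds distℤ²) refl))
  (ℚ.+-mono-≤ (*-monoˡ (≥0 {1ℚ - 2 * rate}) (walk-lower ds u ik)) (*-monoˡ (≥0 {rate}) (ℚ.+-mono-≤
    (subst (λ z → walk-quartic (Q ds) (M ds) z ≤ walk ds distℤ² (u + d)) (lem₊ u k d (rnd d)) (walk-lower ds (u + d) (Int-+ ik (Int-rnd d))))
    (subst (λ z → walk-quartic (Q ds) (M ds) z ≤ walk ds distℤ² (u - d)) (lem₋ u k d (rnd d)) (walk-lower ds (u - d) (Int-- ik (Int-rnd d)))))))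
  where
  lem₊ : ∀ u k d s → u + d - (k + s) ≡ u - k + (d - s)
  lem₊ = solve-∀ R
  lem₋ : ∀ u k d s → u - d - (k - s) ≡ u - k - (d - s)
  lem₋ = solve-∀ R
  lem : ∀ x e q m s → q ≡ 2 * rate * s → walk-quartic (2 * rate * (sq e + s)) (m + 2 * rate * sq (sq e) + 12 * rate * q * sq e) x ≡
    (1ℚ - 2 * rate) * walk-quartic q m x + rate * (walk-quartic q m (x + e) + walk-quartic q m (x - e))
  lem x e q m s refl = lem′ x e m s
    where
    lem′ : ∀ x e m s →
      x * x + 2 * rate * (e * e + s) - 2 * (x * x * (x * x) + 6 * (x * x) * (2 * rate * (e * e + s)) + (m + 2 * rate * (e * e * (e * e)) + 12 * rate * (2 * rate * s) * (e * e))) ≡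
      (1ℚ - 2 * rate) * (x * x + 2 * rate * s - 2 * (x * x * (x * x) + 6 * (x * x) * (2 * rate * s) + m)) +
      rate * ((x + e) * (x + e) + 2 * rate * s - 2 * ((x + e) * (x + e) * ((x + e) * (x + e)) + 6 * ((x + e) * (x + e)) * (2 * rate * s) + m) +
           ((x - e) * (x - e) + 2 * rate * s - 2 * ((x - e) * (x - e) * ((x - e) * (x - e)) + 6 * ((x - e) * (x - e)) * (2 * rate * s) + m)))
    lem′ = solve-∀ R

¼ : ℚ
¼ = ½ * ½

-- The squared residues are at most ¼, so their own fourth moments add up to at most ¼Q; the mixed
-- terms account for 3Q².
M-bound : ∀ ds → M ds ≤ ¼ * Q ds + 3 * sq (Q ds)
M-bound [] = ≥0
M-bound (d ∷ ds) = by (diff (M-bound ds) ⊞ ≥0 {2 * rate} ⊡ 0≤distℤ² d ⊡ diff (distℤ²-≤¼ d) ⊞ ≥0 {12 * rate * rate} ⊡ 0≤sq (distℤ² d)) (lem (distℤ² d) (M ds) (S ds distℤ²))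
  where
  lem : ∀ e m s → ¼ * (2 * rate * (e + s)) + 3 * ((2 * rate * (e + s)) * (2 * rate * (e + s))) ≡
    m + 2 * rate * (e * e) + 12 * rate * (2 * rate * s) * e +
    (¼ * (2 * rate * s) + 3 * ((2 * rate * s) * (2 * rate * s)) - m + 2 * rate * e * (¼ - e) + 12 * rate * rate * (e * e))
  lem = solve-∀ R

0≤walk : ∀ ds u → 0ℚ ≤ walk ds distℤ² u
0≤walk [] u = 0≤distℤ² u
0≤walk (d ∷ ds) u = ≥0 {1ℚ - 2 * rate} ⊡ 0≤walk ds u ⊞ ≥0 {rate} ⊡ (0≤walk ds (u + d) ⊞ 0≤walk ds (u - d))

-- At 0 the lower bound is Q - 2M ≥ ½Q - 6Q². Here Q is 1/96 of the sum, hence at most 1/24, and ¼Q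
-- remains.
walk-spread : ∀ ds → S ds distℤ² ≤ 4 → S ds distℤ² ≤ 384 * walk ds distℤ² 0ℚ
walk-spread ds s≤4 = by
  (≥0 {384} ⊡ diff (walk-lower ds 0ℚ Int0) ⊞ ≥0 {768} ⊡ diff (M-bound ds) ⊞ ≥0 {48 * rate} ⊡ S-nonneg ds (λ d → 0≤distℤ² d) ⊡ diff s≤4)
  (lem (walk ds distℤ² 0ℚ) (S ds distℤ²) (M ds))
  where
  lem : ∀ w s m → 384 * w ≡ s + (384 * (w - ((0ℚ - 0ℚ) * (0ℚ - 0ℚ) + 2 * rate * s - 2 * ((0ℚ - 0ℚ) * (0ℚ - 0ℚ) * ((0ℚ - 0ℚ) * (0ℚ - 0ℚ)) + 6 * ((0ℚ - 0ℚ) * (0ℚ - 0ℚ)) * (2 * rate * s) + m)))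
    + 768 * (¼ * (2 * rate * s) + 3 * ((2 * rate * s) * (2 * rate * s)) - m) + 48 * rate * s * (4 - s))
  lem = solve-∀ R

-- Swapping the images of disjoint pairs of rows

open Every using ([]; _∷_)

transpose-fst : ∀ (a b : Fin n) → transpose a b a ≡ b
transpose-fst a b with a ≟F a
... | yes _ = refl
... | no ¬p = contradiction refl ¬p

transpose-snd : ∀ (a b : Fin n) → transpose a b b ≡ a
transpose-snd a b with b ≟F a
... | yes p = p
... | no _ with b ≟F b
...   | yes _ = refl
...   | no ¬p = contradiction refl ¬p

transpose-other : ∀ {a b k : Fin n} → ¬ (k ≡ a) → ¬ (k ≡ b) → transpose a b k ≡ k
transpose-other {a = a} {b} {k} p q with k ≟F a
... | yes r = contradiction r p
... | no _ with k ≟F b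
...   | yes r = contradiction r q
...   | no _ = refl

transpose-involutive : ∀ (a b k : Fin n) → transpose a b (transpose a b k) ≡ k
transpose-involutive a b k with k ≟F a
... | yes refl = transpose-snd k b
... | no p with k ≟F b
...   | yes refl = transpose-fst a k
...   | no q = transpose-other p q

E-transpose : ∀ {h : Sym n → ℚ} → Ext h → ∀ a b → E n (λ π → h (π ∘ transpose a b)) ≡ E n h
E-transpose {n} ext a b = E-reindex ext (transpose a b) (λ i → i) (transpose-involutive a b) (λ _ → refl)

Pair : ℕ → Set
Pair n = Fin n × Fin n

τ : Pair n → Sym n
τ (a , b) = transpose a b

record Apart (s t : Pair n) : Set where
  field
    a≢c : ¬ (proj₁ s ≡ proj₁ t)
    a≢d : ¬ (proj₁ s ≡ proj₂ t)
    b≢c : ¬ (proj₂ s ≡ proj₁ t)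
    b≢d : ¬ (proj₂ s ≡ proj₂ t)

data Matching {n : ℕ} : List (Pair n) → Set where
  []  : Matching []
  add : ∀ {t ts} → ¬ (proj₁ t ≡ proj₂ t) → All (Apart t) ts → Matching ts → Matching (t ∷ ts)

Apart-sym : ∀ {s t : Pair n} → Apart s t → Apart t s
Apart-sym p = record { a≢c = a≢c ∘ sym ; a≢d = b≢c ∘ sym ; b≢c = a≢d ∘ sym ; b≢d = b≢d ∘ sym }
  where open Apart p

module _ {n : ℕ} (c : Matrix n) where

  D : Pair n → Sym n → ℚ
  D (a , b) π = Δ c a b (π a) (π b)

  D-Ext : ∀ t → Ext (D t)
  D-Ext (a , b) p = cong₂ (Δ c a b) (p a) (p b)

  D-flip : ∀ t π → D t (π ∘ τ t) ≡ - D t π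
  D-flip (a , b) π rewrite transpose-fst a b | transpose-snd a b = lem (c a (π a)) (c b (π b)) (c a (π b)) (c b (π a))
    where lem : ∀ x y z w → z + w - x - y ≡ - (x + y - z - w)
          lem = solve-∀ R

  D-apart : ∀ {s t} → Apart s t → ∀ π → D s (π ∘ τ t) ≡ D s π
  D-apart {a , b} p π = cong₂ (λ x y → Δ c a b (π x) (π y)) (transpose-other a≢c a≢d) (transpose-other b≢c b≢d)
    where open Apart p

  L-transpose : ∀ t → ¬ (proj₁ t ≡ proj₂ t) → ∀ π → L c (π ∘ τ t) ≡ L c π - D t π
  L-transpose t@(a , b) a≢b π = begin
    L c (π ∘ τ t) ≡⟨ lem₁ (L c π) (L c (π ∘ τ t)) ⟩
    L c π - (L c π - L c (π ∘ τ t)) ≡⟨ cong (λ z → L c π - z) (sym (∑-- _ _)) ⟩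
    L c π - ∑ X ≡⟨ cong (λ z → L c π - z) (trans (∑-cong split) (∑-+ _ _)) ⟩
    L c π - (∑ (λ i → δ a i * X i) + ∑ (λ i → δ b i * X i)) ≡⟨ cong₂ (λ x y → L c π - (x + y)) (∑-δ a X) (∑-δ b X) ⟩
    L c π - (X a + X b) ≡⟨ cong (λ z → L c π - z) (trans (cong₂ (λ x y → c a (π a) - c a (π x) + (c b (π b) - c b (π y))) (transpose-fst a b) (transpose-snd a b)) (lem₂ (c a (π a)) (c a (π b)) (c b (π b)) (c b (π a)))) ⟩
    L c π - D t π ∎
    where
    open ≡-Reasoning
    X : Fin n → ℚ
    X i = c i (π i) - c i (π (τ t i))
    lem₁ : ∀ x y → y ≡ x - (x - y)
    lem₁ = solve-∀ R
    lem₂ : ∀ x y z w → x - y + (z - w) ≡ x + z - y - w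
    lem₂ = solve-∀ R
    one : ∀ x → x ≡ 1ℚ * x + 0ℚ * x
    one = solve-∀ R
    two : ∀ x → x ≡ 0ℚ * x + 1ℚ * x
    two = solve-∀ R
    none : ∀ x → x - x ≡ 0ℚ * (x - x) + 0ℚ * (x - x)
    none = solve-∀ R
    split : ∀ i → X i ≡ δ a i * X i + δ b i * X i
    split i with δ-cases a i | δ-cases b i
    ... | inj₁ (p , _) | inj₁ (q , _) = contradiction (trans p (sym q)) a≢b
    ... | inj₁ (_ , p) | inj₂ (_ , q) rewrite p | q = one (X i)
    ... | inj₂ (_ , p) | inj₁ (_ , q) rewrite p | q = two (X i)
    ... | inj₂ (p , p′) | inj₂ (q , q′) rewrite p′ | q′ | transpose-other (p ∘ sym) (q ∘ sym) = none (c i (π i))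

  Ds : List (Pair n) → Sym n → List ℚ
  Ds ts π = map (λ t → D t π) ts

  Ds-Ext : ∀ ts {π σ} → (∀ i → π i ≡ σ i) → Ds ts π ≡ Ds ts σ
  Ds-Ext []       p = refl
  Ds-Ext (t ∷ ts) p = cong₂ _∷_ (D-Ext t p) (Ds-Ext ts p)

  Ds-apart : ∀ {t ts} → All (Apart t) ts → ∀ π → Ds ts (π ∘ τ t) ≡ Ds ts π
  Ds-apart []       π = refl
  Ds-apart (p ∷ ps) π = cong₂ _∷_ (D-apart (Apart-sym p) π) (Ds-apart ps π)

  -- The rule by which f itself changes under an exchange. After some exchanges, or after averaging
  -- over them, the new function still obeys it for the remaining pairs.
  Flips : (Sym n → ℚ) → Pair n → Set
  Flips h t = ∀ π → h (π ∘ τ t) ≡ h π - D t π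

  Flips-- : ∀ h {t s} → Apart t s → Flips h s → ∀ k → Flips (λ π → h π - k * D t π) s
  Flips-- h {t} {s} ap fl k π rewrite fl π | D-apart ap π = lem (h π) (D s π) (k * D t π)
    where lem : ∀ x y z → x - y - z ≡ x - z - y
          lem = solve-∀ R

  L-flips : ∀ {ts} → Matching ts → All (Flips (L c)) ts
  L-flips [] = []
  L-flips (add {t} p _ m) = L-transpose t p ∷ L-flips m

  All-map₂ : ∀ {t} {P : Pair n → Set} {Q : Pair n → Set} → (∀ {s} → Apart t s → P s → Q s) → ∀ {ts} → All (Apart t) ts → All P ts → All Q ts
  All-map₂ f [] [] = []
  All-map₂ f (p ∷ ps) (q ∷ qs) = f p q ∷ All-map₂ f ps qs

  module _ {f : Sym n → ℚ} (f-Ext : Ext f) {ε : ℚ} (f-close : E n (φ ∘ f) ≤ ε) where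

    -- h is f after the exchanges decided so far, and f - h is the displacement of the walk. One
    -- more exchange turns h into h - D(t), which has the same law as h; the step -D(t) becomes
    -- +D(t) on substituting `π ∘ τ t` for π.
    E-walk : ∀ {ts} → Matching ts → All (Flips f) ts → ∀ {h} → Ext h → All (Flips h) ts → E n (φ ∘ h) ≤ ε →
      E n (λ π → walk (Ds ts π) distℤ² (f π - h π)) ≤ 4 * ε
    E-walk [] _ {h} _ _ h-close = ≤-trans (E-mono n λ π _ → distℤ²-diff (f π) (h π))
      (≤-trans (≡⇒≤ (trans (E-+ n _ _) (cong₂ _+_ (E-* n 2 (φ ∘ f)) (E-* n 2 (φ ∘ h)))))
        (by (≥0 {2} ⊡ diff f-close ⊞ ≥0 {2} ⊡ diff h-close) (lem ε (E n (φ ∘ f)) (E n (φ ∘ h)))))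
      where lem : ∀ ε x y → 4 * ε ≡ 2 * x + 2 * y + (2 * (ε - x) + 2 * (ε - y))
            lem = solve-∀ R
    E-walk {t ∷ ts} (add p ap m) (ff ∷ ffs) {h} h-Ext (fh ∷ fhs) h-close = subst (_≤ 4 * ε) (sym total-eq)
      (by (≥0 {1ℚ - 2 * rate} ⊡ diff stay ⊞ ≥0 {2 * rate} ⊡ diff move) (lem ε (E n w₀) (E n w₊)))
      where
      w₀ w₊ w₋ : Sym n → ℚ
      w₀ π = walk (Ds ts π) distℤ² (f π - h π)
      w₊ π = walk (Ds ts π) distℤ² (f π - h π + D t π)
      w₋ π = walk (Ds ts π) distℤ² (f π - h π - D t π)
      h′ : Sym n → ℚ
      h′ π = h π - 1ℚ * D t π
      lem : ∀ ε x y → 4 * ε ≡ (1ℚ - 2 * rate) * x + rate * (y + y) + ((1ℚ - 2 * rate) * (4 * ε - x) + 2 * rate * (4 * ε - y))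
      lem = solve-∀ R
      w₊-Ext : Ext w₊
      w₊-Ext p = cong₂ (λ ds u → walk ds distℤ² u) (Ds-Ext ts p) (cong₂ _+_ (cong₂ _-_ (f-Ext p) (h-Ext p)) (D-Ext t p))
      w₋-w₊ : E n w₋ ≡ E n w₊
      w₋-w₊ = trans (E-cong n λ π _ → sym (cong₂ (λ ds u → walk ds distℤ² u) (Ds-apart ap π)
        (trans (cong₂ _+_ (cong₂ _-_ (ff π) (fh π)) (D-flip t π)) (lem′ (f π) (h π) (D t π))))) (E-transpose w₊-Ext (proj₁ t) (proj₂ t))
        where lem′ : ∀ x y d → x - d - (y - d) + - d ≡ x - y - d
              lem′ = solve-∀ R
      total-eq : E n (λ π → walk (Ds (t ∷ ts) π) distℤ² (f π - h π)) ≡ (1ℚ - 2 * rate) * E n w₀ + rate * (E n w₊ + E n w₊)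
      total-eq = trans (E-+ n _ _) (cong₂ _+_ (E-* n (1ℚ - 2 * rate) w₀) (trans (E-* n rate _) (cong (rate *_) (trans (E-+ n w₊ w₋) (cong (E n w₊ +_) w₋-w₊)))))
      stay : E n w₀ ≤ 4 * ε
      stay = E-walk m ffs h-Ext fhs h-close
      h′-close : E n (φ ∘ h′) ≤ ε
      h′-close = subst (_≤ ε) (trans (sym (E-transpose (λ p → cong φ (h-Ext p)) (proj₁ t) (proj₂ t))) (E-cong n λ π _ → cong φ (trans (fh π) (lem′ (h π) (D t π))))) h-close
        where lem′ : ∀ x d → x - d ≡ x - 1ℚ * d
              lem′ = solve-∀ R
      move : E n w₊ ≤ 4 * ε
      move = subst (_≤ 4 * ε) (E-cong n λ π _ → cong (walk (Ds ts π) distℤ²) (lem′ (f π) (h π) (D t π)))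
        (E-walk m ffs {h′} (λ p → cong₂ _-_ (h-Ext p) (cong (1ℚ *_) (D-Ext t p))) (All-map₂ (λ ap fl → Flips-- h ap fl 1ℚ) ap fhs) h′-close)
        where lem′ : ∀ x y d → x - (y - 1ℚ * d) ≡ x - y + d
              lem′ = solve-∀ R

  sumsq : List (Pair n) → Sym n → ℚ
  sumsq ts π = S (Ds ts π) sq

  module _ {w : Sym n → ℚ} (w-Ext : Ext w) (0≤w : ∀ π → 0ℚ ≤ w π) where

    -- k - ½D(t) is the average of k over the exchange t, hence orthogonal to the odd function D(t)
    -- under the invariant weight w. Pythagoras splits off ¼D(t)², one pair at a time, and what is
    -- left at the end is nonnegative.
    E-sumsq : ∀ {ts} → Matching ts → All (λ t → ∀ π → w (π ∘ τ t) ≡ w π) ts → ∀ {k} → Ext k → All (Flips k) ts →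
      E n (λ π → w π * sumsq ts π) ≤ 4 * E n (λ π → w π * sq (k π))
    E-sumsq [] _ {k} _ _ = ≤-trans (≡⇒≤ (trans (E-cong n λ π _ → ℚ.*-zeroʳ (w π)) (E-const n 0ℚ)))
      (≥0 {4} ⊡ E-nonneg n λ π _ → 0≤w π ⊡ 0≤sq (k π))
    E-sumsq {t ∷ ts} (add p ap m) (wt ∷ wts) {k} k-Ext (fk ∷ fks) = begin
      E n (λ π → w π * (sq (D t π) + sumsq ts π)) ≡⟨ trans (E-cong n λ π _ → ℚ.*-distribˡ-+ (w π) (sq (D t π)) (sumsq ts π)) (E-+ n _ _) ⟩
      E n (λ π → w π * sq (D t π)) + E n (λ π → w π * sumsq ts π) ≤⟨ ℚ.+-monoʳ-≤ (E n (λ π → w π * sq (D t π))) (E-sumsq m wts k′-Ext (All-map₂ (λ ap fl → Flips-- k ap fl ½) ap fks)) ⟩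
      E n (λ π → w π * sq (D t π)) + 4 * E n (λ π → w π * sq (k′ π)) ≡⟨ sym expand ⟩
      4 * E n (λ π → w π * sq (k π)) ∎
      where
      open ℚ.≤-Reasoning
      k′ g : Sym n → ℚ
      k′ π = k π - ½ * D t π
      g π = w π * (k′ π * D t π)
      k′-Ext : Ext k′
      k′-Ext p = cong₂ _-_ (k-Ext p) (cong (½ *_) (D-Ext t p))
      g-odd : ∀ π → g (π ∘ τ t) ≡ - 1ℚ * g π
      g-odd π rewrite wt π | fk π | D-flip t π = lem (w π) (k π) (D t π)
        where lem : ∀ w k d → w * ((k - d - ½ * - d) * - d) ≡ - 1ℚ * (w * ((k - ½ * d) * d))
              lem = solve-∀ R
      g-mean : E n g ≡ 0ℚ
      g-mean = half (E n g) (trans (sym (E-transpose {h = g} (λ p → cong₂ _*_ (w-Ext p) (cong₂ _*_ (k′-Ext p) (D-Ext t p))) (proj₁ t) (proj₂ t))) (trans (E-cong n λ π _ → g-odd π) (E-* n (- 1ℚ) g)))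
        where
        half : ∀ x → x ≡ - 1ℚ * x → x ≡ 0ℚ
        half x p = trans (lem x) (trans (cong (λ z → ½ * (x + z)) p) (lem′ x))
          where lem : ∀ x → x ≡ ½ * (x + x)
                lem = solve-∀ R
                lem′ : ∀ x → ½ * (x + - 1ℚ * x) ≡ 0ℚ
                lem′ = solve-∀ R
      expand : 4 * E n (λ π → w π * sq (k π)) ≡ E n (λ π → w π * sq (D t π)) + 4 * E n (λ π → w π * sq (k′ π))
      expand = trans (cong (4 *_) (trans (E-cong n λ π _ → lem (w π) (k π) (D t π))
        (trans (E-+ n _ _) (cong₂ _+_ (E-+ n _ _) (E-* n ¼ _)))))
        (trans (cong (λ z → 4 * (E n (λ π → w π * sq (k′ π)) + z + ¼ * E n (λ π → w π * sq (D t π)))) g-mean) (lem′ (E n (λ π → w π * sq (k′ π))) (E n (λ π → w π * sq (D t π)))))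
        where lem : ∀ w k d → w * (k * k) ≡ w * ((k - ½ * d) * (k - ½ * d)) + w * ((k - ½ * d) * d) + ¼ * (w * (d * d))
              lem = solve-∀ R
              lem′ : ∀ x y → 4 * (x + 0ℚ + ¼ * y) ≡ y + 4 * x
              lem′ = solve-∀ R

-- Truncation and the bound for one matching

E-*-≤ : ∀ n k {g : Sym n → ℚ} {b} → 0ℚ ≤ k → E n g ≤ b → E n (λ π → k * g π) ≤ k * b
E-*-≤ n k {g} 0≤k p = ≤-trans (≡⇒≤ (E-* n k g)) (*-monoˡ 0≤k p)

E-+-≤ : ∀ n {g h : Sym n → ℚ} {a b} → E n g ≤ a → E n h ≤ b → E n (λ π → g π + h π) ≤ a + b
E-+-≤ n {g} {h} p q = ≤-trans (≡⇒≤ (E-+ n g h)) (ℚ.+-mono-≤ p q)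

-- The centre ½ is equally far from both bits, which makes the constant term as small as possible.
sq-½-≤ : ∀ y → sq (y - ½) ≤ 2 * φ y + ½
sq-½-≤ y with φ-attained y
... | s , bs , p = subst₂ _≤_ (cong sq {y - s + (s - ½)} {y - ½} (lem y s)) (cong₂ _+_ (cong (2 *_) (sym p)) (half bs)) (sq-+-≤ (y - s) (s - ½))
  where lem : ∀ y s → y - s + (s - ½) ≡ y - ½
        lem = solve-∀ R
        half : ∀ {s} → Bit s → 2 * sq (s - ½) ≡ ½
        half (inj₁ refl) = refl
        half (inj₂ refl) = refl

opaque
  large : ℚ → ℚ
  large v = ⟦ ⌊ 4 ℚ.≤? v ⌋ ⟧

opaque
  unfolding large

  large-cases : ∀ v → (4 ≤ v × large v ≡ 1ℚ) ⊎ (v ≤ 4 × large v ≡ 0ℚ)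
  large-cases v with 4 ℚ.≤? v
  ... | yes p = inj₁ (p , refl)
  ... | no p = inj₂ (≰-≥ p , refl)

0≤large : ∀ v → 0ℚ ≤ large v
0≤large v with large-cases v
... | inj₁ (_ , p) = subst (0ℚ ≤_) (sym p) ≥0
... | inj₂ (_ , p) = subst (0ℚ ≤_) (sym p) ≥0

-- To be read with s the sum of squared distances to ℤ, u the bound from the walk, v the sum of
-- squares and w the indicator of v ≥ 4. Where the walk gives nothing, v itself bounds s.
truncation : ∀ {s v w u} → s ≤ v → 0ℚ ≤ u → (v ≤ 4 → s ≤ u) → (4 ≤ v × w ≡ 1ℚ) ⊎ (v ≤ 4 × w ≡ 0ℚ) → s ≤ u + w * v
truncation {s} {v} {_} {u} s≤v 0≤u _ (inj₁ (_ , refl)) = by (diff s≤v ⊞ 0≤u) (lem s v u)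
  where lem : ∀ s v u → u + 1ℚ * v ≡ s + (v - s + u)
        lem = solve-∀ R
truncation {s} {v} {_} {u} _ _ s≤u (inj₂ (v≤4 , refl)) = ≤-trans (s≤u v≤4) (≡⇒≤ (lem u v))
  where lem : ∀ u v → u ≡ u + 0ℚ * v
        lem = solve-∀ R

-- The threshold 4 is chosen for this step: where w = 1 the constant ½ is at most v/8, so that after
-- the factor 4 of `E-sumsq` only half of the quantity to be bounded comes back.
truncated-energy : ∀ {y x v w} → y ≤ 2 * x + ½ → 0ℚ ≤ x → (4 ≤ v × w ≡ 1ℚ) ⊎ (v ≤ 4 × w ≡ 0ℚ) → w * y ≤ 2 * x + ½ * ¼ * (w * v)
truncated-energy {y} {x} {v} p 0≤x (inj₁ (4≤v , refl)) = by (diff p ⊞ ≥0 {½ * ¼} ⊡ diff 4≤v) (lem x v y)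
  where lem : ∀ x v y → 2 * x + ½ * ¼ * (1ℚ * v) ≡ 1ℚ * y + (2 * x + ½ - y + ½ * ¼ * (v - 4))
        lem = solve-∀ R
truncated-energy {y} {x} {v} p 0≤x (inj₂ (_ , refl)) = by (≥0 {2} ⊡ 0≤x) (lem x v y)
  where lem : ∀ x v y → 2 * x + ½ * ¼ * (0ℚ * v) ≡ 0ℚ * y + 2 * x
        lem = solve-∀ R

distℤ²≤sq : ∀ d → distℤ² d ≤ sq d
distℤ²≤sq d = ≤-trans (distℤ²-min d Int0) (≡⇒≤ (cong sq {d - 0ℚ} {d} (minus-0 d)))

module _ {n : ℕ} (c : Matrix n) where

  sumsq-Ext : ∀ ts → Ext (sumsq c ts)
  sumsq-Ext ts p = cong (λ ds → S ds sq) (Ds-Ext c ts p)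

  sumsq-invariant : ∀ {ts} → Matching ts → All (λ t → ∀ π → sumsq c ts (π ∘ τ t) ≡ sumsq c ts π) ts
  sumsq-invariant [] = []
  sumsq-invariant {t ∷ ts} (add p ap m) =
    (λ π → cong₂ _+_ (trans (cong sq (D-flip c t π)) (sq-neg (D c t π))) (cong (λ ds → S ds sq) (Ds-apart c ap π))) ∷
    All-map₂ c (λ ap q π → cong₂ _+_ (cong sq (D-apart c ap π)) (q π)) ap (sumsq-invariant m)

  -- 1552 = 384 · 4 + 16, from the walk and from the permutations with a large sum of squares.
  E-matching : ∀ {ts} → Matching ts → E n (λ π → S (Ds c ts π) distℤ²) ≤ 1552 * E n (φ ∘ L c)
  E-matching {ts} m = ≤-trans (E-mono n λ π _ → pointwise π)
    (≤-trans (E-+-≤ n (E-*-≤ n 384 ≥0 walks) large-part) (≡⇒≤ (lem₀ ε)))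
    where
    f : Sym n → ℚ
    f = L c
    ε : ℚ
    ε = E n (φ ∘ f)
    v w : Sym n → ℚ
    v = sumsq c ts
    w π = large (v π)
    lem₀ : ∀ ε → 384 * (4 * ε) + 16 * ε ≡ 1552 * ε
    lem₀ = solve-∀ R
    self : ∀ x → x - x ≡ 0ℚ
    self = solve-∀ R
    pointwise : ∀ π → S (Ds c ts π) distℤ² ≤ 384 * walk (Ds c ts π) distℤ² (f π - f π) + w π * v π
    pointwise π = truncation (S-mono (Ds c ts π) distℤ²≤sq) (≥0 {384} ⊡ 0≤walk (Ds c ts π) (f π - f π))
      (λ v≤4 → subst (λ z → S (Ds c ts π) distℤ² ≤ 384 * walk (Ds c ts π) distℤ² z) (sym (self (f π)))
        (walk-spread (Ds c ts π) (≤-trans (S-mono (Ds c ts π) distℤ²≤sq) v≤4)))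
      (large-cases (v π))
    walks : E n (λ π → walk (Ds c ts π) distℤ² (f π - f π)) ≤ 4 * ε
    walks = E-walk c (L-Ext c) ≤-refl m (L-flips c m) (L-Ext c) (L-flips c m) ≤-refl
    w-bound : ∀ π → w π * sq (f π - ½) ≤ 2 * φ (f π) + ½ * ¼ * (w π * v π)
    w-bound π = truncated-energy (sq-½-≤ (f π)) (0≤φ (f π)) (large-cases (v π))
    k-flips : ∀ {us} → All (Flips c f) us → All (Flips c (λ π → f π - ½)) us
    k-flips = Every.map λ {t} fl π → trans (cong (_- ½) (fl π)) (lem (f π) (D c t π))
      where lem : ∀ x d → x - d - ½ ≡ x - ½ - d
            lem = solve-∀ R
    large-part : E n (λ π → w π * v π) ≤ 16 * ε
    -- For x = E[w v], `step` and `bound` give x ≤ 8ε + ½x.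
    large-part = by (≥0 {2} ⊡ diff (≤-trans step (*-monoˡ (≥0 {4}) bound))) (lem (E n (λ π → w π * v π)) ε)
      where
      w-Ext : Ext w
      w-Ext p = cong large (sumsq-Ext ts p)
      step : E n (λ π → w π * v π) ≤ 4 * E n (λ π → w π * sq (f π - ½))
      step = E-sumsq c w-Ext (λ π → 0≤large (v π)) m (Every.map (λ inv π → cong large (inv π)) (sumsq-invariant m))
        (λ p → cong (_- ½) (L-Ext c p)) (k-flips (L-flips c m))
      bound : E n (λ π → w π * sq (f π - ½)) ≤ 2 * ε + ½ * ¼ * E n (λ π → w π * v π)
      bound = ≤-trans (E-mono n λ π _ → w-bound π) (E-+-≤ n (E-*-≤ n 2 ≥0 ≤-refl) (E-*-≤ n (½ * ¼) ≥0 ≤-refl))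
      lem : ∀ x ε → 16 * ε ≡ x + 2 * (4 * (2 * ε + ½ * ¼ * x) - x)
      lem = solve-∀ R

-- The matching {0,1}, {2,3}, … of the rows

next : Pair n → Pair (suc (suc n))
next t = suc (suc (proj₁ t)) , suc (suc (proj₂ t))

pairs : ∀ n → List (Pair n)
pairs (suc (suc n)) = (zero , suc zero) ∷ map next (pairs n)
pairs _ = []

record Embeds {m n : ℕ} (ρ : Fin m → Fin n) : Set where
  constructor embeds
  field inj : ∀ {i j} → ρ i ≡ ρ j → i ≡ j

push : ∀ {m n} → (Fin m → Fin n) → Pair m → Pair n
push ρ t = ρ (proj₁ t) , ρ (proj₂ t)

pairs-matching : ∀ m {n} (ρ : Fin m → Fin n) → Embeds ρ → Matching (map (push ρ) (pairs m))
pairs-matching zero ρ _ = []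
pairs-matching (suc zero) ρ _ = []
pairs-matching (suc (suc m)) {n} ρ (embeds inj) = add (λ p → 0≢1 (inj p)) (apart (pairs m)) (subst Matching (map-∘ (pairs m)) (pairs-matching m (λ i → ρ (suc (suc i))) (embeds λ p → suc-inj (inj p))))
  where
  0≢1 : ¬ (Fin.zero {suc m} ≡ suc zero)
  0≢1 ()
  suc-inj : ∀ {i j : Fin m} → Fin.suc (suc i) ≡ suc (suc j) → i ≡ j
  suc-inj refl = refl
  low : ∀ {i} {j : Fin m} → (i ≡ zero ⊎ i ≡ suc zero) → ¬ (ρ i ≡ ρ (suc (suc j)))
  low (inj₁ refl) p with inj p
  ... | ()
  low (inj₂ refl) p with inj p
  ... | ()
  apart : ∀ ts → All (Apart (ρ zero , ρ (suc zero))) (map (push ρ) (map next ts))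
  apart [] = []
  apart (t ∷ ts) = record { a≢c = low (inj₁ refl) ; a≢d = low (inj₁ refl) ; b≢c = low (inj₂ refl) ; b≢d = low (inj₂ refl) } ∷ apart ts

count : List A → ℚ
count xs = S xs (λ _ → 1ℚ)

-- The factor 3 is attained by three rows, where the only pair leaves one row unmatched.
pairs-count : ∀ n → ι (suc (suc n)) ≤ 3 * count (pairs (suc (suc n)))
pairs-count n = ≤-trans (lem (suc (suc n))) (bound n)
  where
  lem : ∀ n → ι n ≤ 2 * count (pairs n) + 1ℚ
  lem zero = subst (_≤ 1ℚ) (sym ι-0) ≥0
  lem (suc zero) = ≡⇒≤ (trans (ι-suc 0) (cong (1 +_) ι-0))
  lem (suc (suc n)) = by (diff (lem n)) (trans (cong (λ z → 2 * (1ℚ + z) + 1ℚ) (S-map (pairs n) next (λ _ → 1ℚ))) (trans (alg (count (pairs n)) (ι n)) (cong (λ z → z + (2 * count (pairs n) + 1ℚ - ι n)) (sym (trans (ι-suc (suc n)) (cong (1 +_) (ι-suc n)))))))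
    where alg : ∀ c n → 2 * (1ℚ + c) + 1ℚ ≡ 1 + (1 + n) + (2 * c + 1ℚ - n)
          alg = solve-∀ R
  bound : ∀ n → 2 * count (pairs (suc (suc n))) + 1ℚ ≤ 3 * count (pairs (suc (suc n)))
  bound n = by (S-nonneg (map next (pairs n)) (λ _ → ≥0 {1ℚ})) (alg (count (map next (pairs n))))
    where alg : ∀ c → 3 * (1ℚ + c) ≡ 2 * (1ℚ + c) + 1ℚ + c
          alg = solve-∀ R

Δ-row : ∀ (c : Matrix n) i j l → Δ c i i j l ≡ 0ℚ
Δ-row c i j l = lem (c i j) (c i l)
  where lem : ∀ x y → x + y - y - x ≡ 0ℚ
        lem = solve-∀ R

Δ-col : ∀ (c : Matrix n) i k j → Δ c i k j j ≡ 0ℚ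
Δ-col c i k j = lem (c i j) (c k j)
  where lem : ∀ x y → x + y - x - y ≡ 0ℚ
        lem = solve-∀ R

S-distrib : ∀ (xs : List A) k → S xs (λ _ → k) ≡ count xs * k
S-distrib xs k = trans (S-cong xs λ _ → sym (ℚ.*-identityˡ k)) (S-*ʳ xs k (λ _ → 1ℚ))

E-S : ∀ n (xs : List A) (g : A → Sym n → ℚ) → E n (λ π → S xs (λ a → g a π)) ≡ S xs (λ a → E n (g a))
E-S n []       g = E-const n 0ℚ
E-S n (a ∷ xs) g = trans (E-+ n (g a) _) (cong (E n (g a) +_) (E-S n xs g))

pairs-distinct : ∀ m → All (λ t → ¬ (proj₁ t ≡ proj₂ t)) (pairs m)
pairs-distinct zero = []
pairs-distinct (suc zero) = []
pairs-distinct (suc (suc m)) = (λ ()) ∷ go (pairs-distinct m)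
  where
  go : ∀ {ts} → All (λ t → ¬ (proj₁ t ≡ proj₂ t)) ts → All (λ t → ¬ (proj₁ t ≡ proj₂ t)) (map next ts)
  go [] = []
  go (p ∷ ps) = (λ { q → p (eq q) }) ∷ go ps
    where eq : ∀ {i j : Fin m} → Fin.suc (suc i) ≡ suc (suc j) → i ≡ j
          eq refl = refl

module _ {n : ℕ} (c : Matrix (suc (suc n))) where
  private
    N : ℕ
    N = suc (suc n)
    a b : ℚ
    a = ι N
    b = ι (suc n)

  at₂-zero-diagonal : ∀ {i k} → ¬ (i ≡ k) → (g : Fin N → Fin N → ℚ) → (∀ j → g j j ≡ 0ℚ) → a * b * E N (λ π → g (π i) (π k)) ≡ ∑ (λ j → ∑ (g j))
  at₂-zero-diagonal {i} {k} i≢k g z with view i k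
  ... | at = contradiction refl i≢k
  ... | in′ k = trans (E-at₂ i k g) (trans (cong (λ z → ∑ (λ j → ∑ (g j)) - z) (trans (∑-cong z) (∑-0 N))) (minus-0 _))

  private
    G : Fin N → Fin N → ℚ
    G i k = E N (λ π → distℤ² (Δ c i k (π i) (π k)))
    Y : ℚ
    Y = ∑⁴ (λ i k j l → distℤ² (Δ c i k j l))

    G-diag : ∀ i → G i i ≡ 0ℚ
    G-diag i = trans (E-cong N λ π _ → cong distℤ² (Δ-row c i (π i) (π i))) (E-const N 0ℚ)

    G-sum : ∀ i k → a * b * G i k ≡ ∑ (λ j → ∑ (λ l → distℤ² (Δ c i k j l)))
    G-sum i k with i ≟F k
    ... | no i≢k = at₂-zero-diagonal i≢k (λ j l → distℤ² (Δ c i k j l)) (λ j → cong distℤ² (Δ-col c i k j))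
    ... | yes refl = trans (cong (a * b *_) (G-diag i)) (trans (ℚ.*-zeroʳ (a * b)) (sym (trans (∑-cong λ j → trans (∑-cong λ l → cong distℤ² (Δ-row c i j l)) (∑-0 N)) (∑-0 N))))

    pair-mean : ∀ t → ¬ (proj₁ t ≡ proj₂ t) → a * b * (a * b * E N (λ ρ → G (ρ (proj₁ t)) (ρ (proj₂ t)))) ≡ Y
    pair-mean t p = trans (cong (a * b *_) (at₂-zero-diagonal p G G-diag)) (trans (sym (∑-* (a * b) _)) (∑-cong λ i → trans (sym (∑-* (a * b) _)) (∑-cong λ k → G-sum i k)))

  -- A second random permutation ρ relabels the rows of one fixed matching, so each of its pairs
  -- becomes a uniformly random pair of distinct rows, which π sends to a random pair of distinct
  -- columns. Each pair thus sees the whole average over quadruples; those with i = k or j = l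
  -- contribute 0.
  ∑⁴-distℤ² : ∑⁴ (λ i k j l → distℤ² (Δ c i k j l)) ≤ 4656 * (a * sq b) * E N (φ ∘ L c)
  ∑⁴-distℤ² = *-cancelˡ-≤ a (0<ι (suc n)) (begin
    a * Y ≤⟨ ℚ.*-monoʳ-≤-nonNeg Y {{ℚ.nonNegative 0≤Y}} (pairs-count n) ⟩
    3 * count (pairs N) * Y ≡⟨ ℚ.*-assoc 3 (count (pairs N)) Y ⟩
    3 * (count (pairs N) * Y) ≡⟨ cong (3 *_) (sym (S-distrib (pairs N) Y)) ⟩
    3 * S (pairs N) (λ _ → Y) ≡⟨ cong (3 *_) (sym (S-pairs (pairs-distinct N))) ⟩
    3 * S (pairs N) (λ t → a * b * (a * b * H t)) ≡⟨ cong (3 *_) (trans (S-* (pairs N) (a * b) _) (cong (a * b *_) (S-* (pairs N) (a * b) H))) ⟩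
    3 * (a * b * (a * b * S (pairs N) H)) ≡⟨ cong (λ z → 3 * (a * b * (a * b * z))) (sym (E-S N (pairs N) _)) ⟩
    3 * (a * b * (a * b * E N (λ ρ → S (pairs N) (λ t → G (ρ (proj₁ t)) (ρ (proj₂ t)))))) ≤⟨ *-monoˡ (≥0 {3}) (*-monoˡ 0≤ab (*-monoˡ 0≤ab each)) ⟩
    3 * (a * b * (a * b * (1552 * E N (φ ∘ L c)))) ≡⟨ lem a b (E N (φ ∘ L c)) ⟩
    a * (4656 * (a * sq b) * E N (φ ∘ L c)) ∎)
    where
    open ℚ.≤-Reasoning
    H : Pair N → ℚ
    H t = E N (λ ρ → G (ρ (proj₁ t)) (ρ (proj₂ t)))
    lem : ∀ a b x → 3 * (a * b * (a * b * (1552 * x))) ≡ a * (4656 * (a * (b * b)) * x)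
    lem = solve-∀ R
    0≤Y : 0ℚ ≤ Y
    0≤Y = ∑∑-nonneg λ i k → ∑∑-nonneg λ j l → 0≤distℤ² (Δ c i k j l)
    0≤ab : 0ℚ ≤ a * b
    0≤ab = 0≤ι N ⊡ 0≤ι (suc n)
    S-pairs : ∀ {ts} → All (λ t → ¬ (proj₁ t ≡ proj₂ t)) ts → S ts (λ t → a * b * (a * b * H t)) ≡ S ts (λ _ → Y)
    S-pairs [] = refl
    S-pairs (p ∷ ps) = cong₂ _+_ (pair-mean _ p) (S-pairs ps)
    each : E N (λ ρ → S (pairs N) (λ t → G (ρ (proj₁ t)) (ρ (proj₂ t)))) ≤ 1552 * E N (φ ∘ L c)
    each = ≤-trans (E-mono N λ ρ inj → ≤-trans (≡⇒≤ (trans (sym (E-S N (pairs N) _)) (E-cong N λ π _ → trans (sym (S-map (pairs N) (push ρ) (λ t → distℤ² (D c t π)))) (sym (S-map (map (push ρ) (pairs N)) (λ t → D c t π) distℤ²)))))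
      (E-matching c (pairs-matching N ρ (embeds inj)))) (≡⇒≤ (E-const N _))

-- Choice of a base coset

∑-≥-term : ∀ (g : Fin n → ℚ) → (∀ i → 0ℚ ≤ g i) → ∀ i → g i ≤ ∑ g
∑-≥-term {suc n} g nn i = by (∑-nonneg λ k → nn (punchIn i k)) (∑-punch i g)

below-average : ∀ (g : Fin (suc n) → ℚ) k → ∑ g ≤ ι (suc n) * k → ∃ λ i → g i ≤ k
below-average {n} g k p with any? (λ i → g i ℚ.≤? k)
... | yes r = r
... | no ¬r = ⊥-elim (<⇒≱ strict p)
  where
  k<g : ∀ i → k < g i
  k<g i = ℚ.≰⇒> λ q → ¬r (i , q)
  strict : ι (suc n) * k < ∑ g
  strict = subst₂ _<_ (trans (sym (∑-suc {n} (λ _ → k))) (∑-const (suc n) k)) (sym (∑-suc g)) (ℚ.+-mono-<-≤ (k<g zero) (∑-mono λ i → ℚ.<⇒≤ (k<g (suc i))))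

below-average₂ : ∀ (g : Fin (suc n) → Fin (suc n) → ℚ) k → ∑ (λ i → ∑ (g i)) ≤ sq (ι (suc n)) * k → ∃ λ i → ∃ λ j → g i j ≤ k
below-average₂ {n} g k p with below-average (λ i → ∑ (g i)) (ι (suc n) * k) (subst (_ ≤_) (ℚ.*-assoc (ι (suc n)) (ι (suc n)) k) p)
... | i , q = i , below-average (g i) k q

module _ {n : ℕ} (X Y : Fin (suc n) → Fin (suc n) → ℚ) (0≤X : ∀ i j → 0ℚ ≤ X i j) (0≤Y : ∀ i j → 0ℚ ≤ Y i j)
  {x y θ : ℚ} (0<θ : 0ℚ < θ) (X-avg : ∑ (λ i → ∑ (X i)) ≤ sq (ι (suc n)) * x) (Y-avg : ∑ (λ i → ∑ (Y i)) ≤ sq (ι (suc n)) * y) where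
  private
    a² : ℚ
    a² = sq (ι (suc n))

    Good : Set
    Good = ∃ λ i → ∃ λ j → X i j ≤ x + θ × θ * Y i j ≤ (x + θ) * y

    good-zero : y ≡ 0ℚ → Good
    good-zero y≡0 = i , j , by (diff found ⊞ ℚ.<⇒≤ 0<θ) (lem (X i j) x θ) , subst (θ * Y i j ≤_) zeros (*-monoˡ (ℚ.<⇒≤ 0<θ) Y≤0)
      where
      chosen : ∃ λ i → ∃ λ j → X i j ≤ x
      chosen = below-average₂ X x X-avg
      i j : Fin (suc n)
      i = proj₁ chosen
      j = proj₁ (proj₂ chosen)
      found : X i j ≤ x
      found = proj₂ (proj₂ chosen)
      lem : ∀ u x θ → x + θ ≡ u + (x - u + θ)
      lem = solve-∀ R
      zeros : θ * 0ℚ ≡ (x + θ) * y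
      zeros = trans (ℚ.*-zeroʳ θ) (sym (trans (cong ((x + θ) *_) y≡0) (ℚ.*-zeroʳ (x + θ))))
      Y≤0 : Y i j ≤ 0ℚ
      Y≤0 = ≤-trans (∑-≥-term (Y i) (0≤Y i) j) (≤-trans (∑-≥-term (λ i → ∑ (Y i)) (λ i → ∑-nonneg (0≤Y i)) i)
        (≤-trans Y-avg (≡⇒≤ (trans (cong (a² *_) y≡0) (ℚ.*-zeroʳ a²)))))

    good-positive : 0ℚ < y → Good
    good-positive 0<y = i , j ,
      *-cancelˡ-≤ y 0<y (≤-trans (by {y * X i j} {Z i j} {θ * Y i j} (ℚ.<⇒≤ 0<θ ⊡ 0≤Y i j) refl) found) ,
      ≤-trans (by {θ * Y i j} {Z i j} {y * X i j} (ℚ.<⇒≤ 0<y ⊡ 0≤X i j) (ℚ.+-comm (y * X i j) (θ * Y i j))) (≤-trans found (≡⇒≤ (ℚ.*-comm y (x + θ))))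
      where
      Z : Fin (suc n) → Fin (suc n) → ℚ
      Z i j = y * X i j + θ * Y i j
      lem : ∀ a² x y θ u v → a² * (y * (x + θ)) ≡ y * u + θ * v + (y * (a² * x - u) + θ * (a² * y - v))
      lem = solve-∀ R
      Z-avg : ∑ (λ i → ∑ (Z i)) ≤ a² * (y * (x + θ))
      Z-avg = subst (_≤ a² * (y * (x + θ)))
        (sym (trans (∑-cong λ i → trans (∑-+ _ _) (cong₂ _+_ (∑-* y (X i)) (∑-* θ (Y i)))) (trans (∑-+ _ _) (cong₂ _+_ (∑-* y _) (∑-* θ _)))))
        (by (ℚ.<⇒≤ 0<y ⊡ diff X-avg ⊞ ℚ.<⇒≤ 0<θ ⊡ diff Y-avg) (lem a² x y θ (∑ (λ i → ∑ (X i))) (∑ (λ i → ∑ (Y i)))))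
      chosen : ∃ λ i → ∃ λ j → Z i j ≤ y * (x + θ)
      chosen = below-average₂ Z (y * (x + θ)) Z-avg
      i j : Fin (suc n)
      i = proj₁ chosen
      j = proj₁ (proj₂ chosen)
      found : Z i j ≤ y * (x + θ)
      found = proj₂ (proj₂ chosen)

    dispatch : 0ℚ ≤ y → Dec (y ≤ 0ℚ) → Good
    dispatch 0≤y (yes y≤0) = good-zero (≤-antisym y≤0 0≤y)
    dispatch 0≤y (no y≰0) = good-positive (ℚ.≰⇒> y≰0)

  -- The sum yX + θY has average at most y(x + θ). At a point not above this average X exceeds x by
  -- at most θ, while Y may lose the factor (x + θ)/θ. For y = 0 the sum no longer sees X, but then
  -- Y vanishes everywhere and X alone decides.
  two-averages : 0ℚ ≤ y → Good
  two-averages 0≤y = dispatch 0≤y (y ℚ.≤? 0ℚ)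

-- AM-GM: 1000 |d| ≤ 1 + 250000 d².
sq-minus-self : ∀ y → 1000 * (sq y - y) ≤ 1 + 251000 * φ y
sq-minus-self y = cases (φ-attained y)
  where
  lem₀ : ∀ y → 1 + 251000 * ((y - 0ℚ) * (y - 0ℚ)) ≡ 1000 * (y * y - y) + (500 * y + 1) * (500 * y + 1)
  lem₀ = solve-∀ R
  lem₁ : ∀ y → 1 + 251000 * ((y - 1ℚ) * (y - 1ℚ)) ≡ 1000 * (y * y - y) + (500 * (y - 1ℚ) - 1) * (500 * (y - 1ℚ) - 1)
  lem₁ = solve-∀ R
  cases : Nearest y → 1000 * (sq y - y) ≤ 1 + 251000 * φ y
  cases (_ , inj₁ refl , p) = by (0≤sq (500 * y + 1)) (trans (cong (λ z → 1 + 251000 * z) p) (lem₀ y))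
  cases (_ , inj₂ refl , p) = by (0≤sq (500 * (y - 1ℚ) - 1)) (trans (cong (λ z → 1 + 251000 * z) p) (lem₁ y))

-- 3000 · 4657, where 4657 = 3 · 1552 + 1 bounds the error averaged over all bases; slack 1/1000 in the energy costs the factor 3000.
K₂ : ℚ
K₂ = 13971000

module _ {m : ℕ} (c : Matrix (suc (suc (suc m)))) where
  private
    N-1 N : ℕ
    N-1 = suc (suc m)
    N = suc N-1
    a b : ℚ
    a = ι N
    b = ι N-1
    0<b : 0ℚ < b
    0<b = 0<ι (suc m)
    p ε : ℚ
    p = E N (L c)
    ε = E N (φ ∘ L c)

  -- `energy` is in units of 1/1000. Since f² is close to f in mean, 4000 p(1 - p) + 8 bounds 4000
  -- times the variance; the remaining 1 is the slack θ = b in the choice of the base.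
  record Base : Set where
    field
      i₀ j₀ : Fin N
      energy : 1000 * ∑ (λ k → ∑ (λ l → sq (Δ c i₀ k j₀ l))) ≤ b * (4000 * (p * (1ℚ - p)) + 9)
      rounding : ∑ (λ k → ∑ (λ l → distℤ² (Δ c i₀ k j₀ l))) ≤ b * (K₂ * ε)
      conditional : E N-1 (λ σ → φ (L c (ins i₀ j₀ σ))) ≤ K₂ * ε

  private
    V : ℚ
    V = E N (sq ∘ L c) - sq p
    0≤ε : 0ℚ ≤ ε
    0≤ε = E-nonneg N λ π _ → 0≤φ (L c π)
    X Y Y₁ Y₂ : Fin N → Fin N → ℚ
    X i j = ∑ (λ k → ∑ (λ l → sq (Δ c i k j l)))
    Y₁ i j = ∑ (λ k → ∑ (λ l → distℤ² (Δ c i k j l)))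
    Y₂ i j = E N-1 (λ σ → φ (L c (ins i j σ)))
    -- The rounding error has order εn and the conditional error order ε; the weight b brings them
    -- to one scale, so a single average controls both.
    Y i j = Y₁ i j + b * Y₂ i j
    0≤X : ∀ i j → 0ℚ ≤ X i j
    0≤X i j = ∑∑-nonneg λ k l → 0≤sq (Δ c i k j l)
    0≤Y : ∀ i j → 0ℚ ≤ Y i j
    0≤Y i j = (∑∑-nonneg λ k l → 0≤distℤ² (Δ c i k j l)) ⊞ ℚ.<⇒≤ 0<b ⊡ (E-nonneg N-1 λ σ _ → 0≤φ (L c (ins i j σ)))
    X-total : ∑ (λ i → ∑ (λ j → 1000 * X i j)) ≤ sq a * (4000 * b * V)
    X-total = ≡⇒≤ (trans (trans (∑-cong λ i → ∑-* 1000 (X i)) (∑-* 1000 (λ i → ∑ (X i)))) (trans (cong (1000 *_) (trans (∑-cong λ i → ∑-swap _) (∑⁴-Δ²-variance c))) (lem a b V)))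
      where lem : ∀ a b v → 1000 * (a * a * (4 * b * v)) ≡ a * a * (4000 * b * v)
            lem = solve-∀ R
    Y₂-total : ∑ (λ i → ∑ (Y₂ i)) ≡ a * (a * ε)
    Y₂-total = trans (∑-cong λ i → sym (E-ins i {φ ∘ L c} (λ q → cong φ (L-Ext c q)))) (∑-const N (a * ε))
    Y-total : ∑ (λ i → ∑ (Y i)) ≤ sq a * (b * (4657 * ε))
    Y-total = subst (_≤ sq a * (b * (4657 * ε)))
      (sym (trans (∑-cong λ i → trans (∑-+ _ _) (cong (∑ (Y₁ i) +_) (∑-* b (Y₂ i)))) (trans (∑-+ _ _) (cong₂ _+_ (∑-cong λ i → ∑-swap _) (trans (∑-* b _) (cong (b *_) Y₂-total))))))
      (by (diff (∑⁴-distℤ² c) ⊞ ≥0 {4656} ⊡ 0≤ι N ⊡ ℚ.<⇒≤ 0<b ⊡ 0≤ε) (lem a b ε (∑⁴ (λ i k j l → distℤ² (Δ c i k j l))) (ι-suc N-1)))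
      where lem : ∀ a b ε y → a ≡ 1 + b → a * a * (b * (4657 * ε)) ≡ y + b * (a * (a * ε)) + (4656 * (a * (b * b)) * ε - y + 4656 * a * b * ε)
            lem _ b ε y refl = lem′ b ε y
              where lem′ : ∀ b ε y → (1 + b) * (1 + b) * (b * (4657 * ε)) ≡ y + b * ((1 + b) * ((1 + b) * ε)) + (4656 * ((1 + b) * (b * b)) * ε - y + 4656 * (1 + b) * b * ε)
                    lem′ = solve-∀ R

  package : 251000 * ε ≤ 1 → ∀ i j → 1000 * X i j ≤ 4000 * b * V + b → b * Y i j ≤ (4000 * b * V + b) * (b * (4657 * ε)) → Base
  package small i j x-bound y-bound = record
    { i₀ = i ; j₀ = j
    ; energy = ≤-trans x-bound (by (ℚ.<⇒≤ 0<b ⊡ (≥0 {4} ⊡ diff f²-bound)) (lem₁ b (E N (sq ∘ L c)) p))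
    ; rounding = ≤-trans (by (ℚ.<⇒≤ 0<b ⊡ nn₂) refl) Y-bound
    ; conditional = *-cancelˡ-≤ b 0<b (≤-trans (by nn₁ (ℚ.+-comm (Y₁ i j) (b * Y₂ i j))) Y-bound)
    }
    where
    nn₁ : 0ℚ ≤ Y₁ i j
    nn₁ = ∑∑-nonneg λ k l → 0≤distℤ² (Δ c i k j l)
    nn₂ : 0ℚ ≤ Y₂ i j
    nn₂ = E-nonneg N-1 λ σ _ → 0≤φ (L c (ins i j σ))
    f²-bound : 1000 * E N (sq ∘ L c) ≤ 1000 * p + 2
    f²-bound = by (diff (≤-trans (≡⇒≤ (trans (cong (1000 *_) (sym (E-- N (sq ∘ L c) (L c)))) (sym (E-* N 1000 _))))
        (≤-trans (E-mono N λ π _ → sq-minus-self (L c π)) (E-+-≤ N (≡⇒≤ (E-const N 1)) (E-*-≤ N 251000 ≥0 ≤-refl)))) ⊞ diff small)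
      (lem (E N (sq ∘ L c)) p ε)
      where lem : ∀ x p ε → 1000 * p + 2 ≡ 1000 * x + (1 + 251000 * ε - 1000 * (x - p) + (1 - 251000 * ε))
            lem = solve-∀ R
    lem₁ : ∀ b x p → b * (4000 * (p * (1ℚ - p)) + 9) ≡ 4000 * b * (x - p * p) + b + b * (4 * (1000 * p + 2 - 1000 * x))
    lem₁ = solve-∀ R
    Y-bound : Y i j ≤ b * (K₂ * ε)
    Y-bound = *-cancelˡ-≤ b 0<b (≤-trans y-bound
      (by (ℚ.<⇒≤ 0<b ⊡ ℚ.<⇒≤ 0<b ⊡ (≥0 {4657} ⊡ 0≤ε) ⊡ (≥0 {4} ⊡ diff f²-bound ⊞ ≥0 {1000} ⊡ 0≤sq (2 * p - 1ℚ) ⊞ ≥0 {1991})) (lem b (E N (sq ∘ L c)) p ε)))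
      where lem : ∀ b x p ε → b * (b * (13971000 * ε)) ≡ (4000 * b * (x - p * p) + b) * (b * (4657 * ε)) +
                      b * b * (4657 * ε) * (4 * (1000 * p + 2 - 1000 * x) + 1000 * ((2 * p - 1ℚ) * (2 * p - 1ℚ)) + 1991)
            lem = solve-∀ R

  good-base : 251000 * ε ≤ 1 → Base
  good-base small = package small (proj₁ base) (proj₁ (proj₂ base)) (proj₁ (proj₂ (proj₂ base))) (proj₂ (proj₂ (proj₂ base)))
    where
    base : ∃ λ i → ∃ λ j → 1000 * X i j ≤ 4000 * b * V + b × b * Y i j ≤ (4000 * b * V + b) * (b * (4657 * ε))
    base = two-averages (λ i j → 1000 * X i j) Y (λ i j → ≥0 {1000} ⊡ 0≤X i j) 0≤Y 0<b X-total Y-total (ℚ.<⇒≤ 0<b ⊡ (≥0 {4657} ⊡ 0≤ε))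

-- Rounding to an integer-valued linear function

-- Induction strikes out row 0 and its image. This is where injective self-maps are seen to take
-- every value once.
∑-permute : ∀ (π : Sym n) → Inj π → ∀ g → ∑ (g ∘ π) ≡ ∑ g
∑-permute {zero} π inj g = trans (∑-empty _) (sym (∑-empty g))
∑-permute {suc n} π inj g = begin
  ∑ (g ∘ π) ≡⟨ ∑-suc (g ∘ π) ⟩
  g (π zero) + ∑ (λ k → g (π (suc k))) ≡⟨ cong (g (π zero) +_) (∑-cong λ k → cong g (sym (punchIn-punchOut (π0≢ k)))) ⟩
  g (π zero) + ∑ (g ∘ punchIn (π zero) ∘ rem) ≡⟨ cong (g (π zero) +_) (∑-permute rem rem-inj (g ∘ punchIn (π zero))) ⟩
  g (π zero) + ∑ (g ∘ punchIn (π zero)) ≡⟨ sym (∑-punch (π zero) g) ⟩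
  ∑ g ∎
  where
  open ≡-Reasoning
  π0≢ : ∀ k → ¬ (π zero ≡ π (suc k))
  π0≢ k p with inj p
  ... | ()
  rem : Sym n
  rem k = punchOut (π0≢ k)
  suc-inj : ∀ {k l : Fin n} → Fin.suc k ≡ suc l → k ≡ l
  suc-inj refl = refl
  rem-inj : Inj rem
  rem-inj {k} {l} p = suc-inj (inj (punchOut-injective (π0≢ k) (π0≢ l) p))

∑-Int : ∀ {g : Fin n → ℚ} → (∀ i → Int (g i)) → Int (∑ g)
∑-Int {zero} {g} q = subst Int (sym (∑-empty g)) Int0
∑-Int {suc n} {g} q = subst Int (sym (∑-suc g)) (Int-+ (q zero) (∑-Int (q ∘ suc)))

quotient : ∀ n T → ∃ λ q → ι (suc n) * q ≡ T
quotient n T = ℚ._/_ (ℤ.+ 1) (suc n) * T ,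
  trans (sym (ℚ.*-assoc (ι (suc n)) (ℚ._/_ (ℤ.+ 1) (suc n)) T)) (trans (cong (_* T) (ι-inverse (suc n))) (ℚ.*-identityˡ T))

L-+ : ∀ (c d : Matrix n) π → L (λ i j → c i j + d i j) π ≡ L c π + L d π
L-+ c d π = ∑-+ _ _

minor : Fin (suc n) → Fin (suc n) → Matrix (suc n) → Matrix n
minor i j c k l = c (punchIn i k) (punchIn j l)

-- The shape of the Δ-matrix of a fixed base: on permutations with i₀ ↦ j₀ its linear function is
-- that of the minor.
record Vanishes {n : ℕ} (i₀ j₀ : Fin (suc n)) (c : Matrix (suc n)) : Set where
  field
    row₀ : ∀ l → c i₀ l ≡ 0ℚ
    col₀ : ∀ k → c k j₀ ≡ 0ℚ

module _ {n : ℕ} {i₀ j₀ : Fin (suc n)} {c : Matrix (suc n)} (v : Vanishes i₀ j₀ c) where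
  open Vanishes v

  L-ins : ∀ σ → L c (ins i₀ j₀ σ) ≡ L (minor i₀ j₀ c) σ
  L-ins σ = trans (∑-punch i₀ _) (trans (cong₂ _+_ (row₀ _) (∑-cong λ k → cong (c (punchIn i₀ k)) (ins-in i₀ j₀ σ k))) (ℚ.+-identityˡ _))

  total-minor : total (minor i₀ j₀ c) ≡ total c
  total-minor = sym (trans (∑-punch i₀ (row c)) (trans (cong₂ _+_ (trans (∑-cong row₀) (∑-0 (suc n)))
    (∑-cong λ k → trans (∑-punch j₀ (c (punchIn i₀ k))) (trans (cong (_+ ∑ (λ l → minor i₀ j₀ c k l)) (col₀ (punchIn i₀ k))) (ℚ.+-identityˡ _)))) (ℚ.+-identityˡ _)))

  Vanishes-map : ∀ (g : ℚ → ℚ) → g 0ℚ ≡ 0ℚ → Vanishes i₀ j₀ (λ k l → g (c k l))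
  Vanishes-map g p = record { row₀ = λ l → trans (cong g (row₀ l)) p ; col₀ = λ k → trans (cong g (col₀ k)) p }

Δ-Vanishes : ∀ (c : Matrix (suc n)) i₀ j₀ → Vanishes i₀ j₀ (λ k l → Δ c i₀ k j₀ l)
Δ-Vanishes c i₀ j₀ = record { row₀ = λ l → Δ-row c i₀ j₀ l ; col₀ = λ k → Δ-col c i₀ k j₀ }

-- The terms c i₀ (π k) add up to a row sum because π takes every column once, so only a constant
-- separates f from the linear function of Δ.
L-Δ : ∀ (c : Matrix n) i₀ j₀ π → Inj π → L c π ≡ row c i₀ + col c j₀ - ι n * c i₀ j₀ + L (λ k l → Δ c i₀ k j₀ l) π
L-Δ {n} c i₀ j₀ π inj = sym (begin
  A₀ + ∑ (λ k → c i₀ j₀ + c k (π k) - c i₀ (π k) - c k j₀)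
    ≡⟨ cong (A₀ +_) (trans (∑-- _ _) (cong (_- col c j₀) (trans (∑-- _ _) (cong₂ _-_ (trans (∑-+ _ _) (cong (_+ L c π) (∑-const n (c i₀ j₀)))) (∑-permute π inj (c i₀)))))) ⟩
  A₀ + (ι n * c i₀ j₀ + L c π - row c i₀ - col c j₀)
    ≡⟨ lem (row c i₀) (col c j₀) (ι n * c i₀ j₀) (L c π) ⟩
  L c π ∎)
  where
  open ≡-Reasoning
  A₀ : ℚ
  A₀ = row c i₀ + col c j₀ - ι n * c i₀ j₀
  lem : ∀ r c x l → r + c - x + (x + l - r - c) ≡ l
  lem = solve-∀ R

sq-total-≤ : ∀ (c : Matrix n) → sq (total c) ≤ sq (ι n) * N₂ c
sq-total-≤ {n} c = ≤-trans (cs (row c)) (≤-trans (*-monoˡ (0≤ι n) (∑-mono λ i → cs (c i)))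
  (≡⇒≤ (trans (cong (ι n *_) (∑-* (ι n) (λ i → ∑ (λ j → sq (c i j))))) (sym (ℚ.*-assoc (ι n) (ι n) (N₂ c))))))
  where
  cs : ∀ (u : Fin n → ℚ) → sq (∑ u) ≤ ι n * ∑ (sq ∘ u)
  cs u = *-cancelˡ-≤ 2 (>0 {2}) (by (subst (0ℚ ≤_) (∑∑-sq-diff u) (∑∑-nonneg λ i k → 0≤sq (u i - u k))) (lem (ι n * ∑ (sq ∘ u)) (sq (∑ u))))
    where lem : ∀ x y → 2 * x ≡ 2 * y + 2 * (x - y)
          lem = solve-∀ R

-- `near` averages over all permutations, `conditional` only over those with i₀ ↦ j₀, among which
-- the permutations that hit no nonzero entry are sought.
record Approx (m : ℕ) (f : Sym (suc (suc (suc m))) → ℚ) (p t : ℚ) : Set where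
  field
    i₀ j₀ : Fin (suc (suc (suc m)))
    z : Matrix (suc (suc (suc m)))
    z-Int : ∀ k l → Int (z k l)
    z-Vanishes : Vanishes i₀ j₀ z
    a₀ : ℚ
    a₀-Int : Int a₀
    near : E (suc (suc (suc m))) (λ π → sq (f π - (a₀ + L z π))) ≤ 15 * t
    conditional : E (suc (suc m)) (λ σ → φ (a₀ + L z (ins i₀ j₀ σ))) ≤ 18 * t
    size : 1000 * N₂ z ≤ ι (suc (suc m)) * (4000 * (p * (1ℚ - p)) + 20)

module _ {m : ℕ} (c : Matrix (suc (suc (suc m)))) where
  private
    N-1 N : ℕ
    N-1 = suc (suc m)
    N = suc N-1
    a b b′ : ℚ
    a = ι N
    b = ι N-1
    b′ = ι (suc m)
    0<b : 0ℚ < b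
    0<b = 0<ι (suc m)
    0≤b : 0ℚ ≤ b
    0≤b = 0≤ι N-1
    p ε t : ℚ
    p = E N (L c)
    ε = E N (φ ∘ L c)
    t = K₂ * ε
    0≤ε : 0ℚ ≤ ε
    0≤ε = E-nonneg N λ π _ → 0≤φ (L c π)
    0≤t : 0ℚ ≤ t
    0≤t = ≥0 {K₂} ⊡ 0≤ε

  round-linear : 1000000000 * t ≤ 1 → Base c → Approx m (L c) p t
  round-linear small base = record
    { i₀ = i₀ ; j₀ = j₀ ; z = z ; z-Int = λ k l → Int-rnd (d k l) ; z-Vanishes = z-Van
    ; a₀ = a₀ ; a₀-Int = Int-rnd β ; near = near ; conditional = cond ; size = size }
    where
    open Base base
    d z er : Matrix N
    d k l = Δ c i₀ k j₀ l
    z k l = rnd (d k l)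
    er k l = d k l - z k l
    d-Van : Vanishes i₀ j₀ d
    d-Van = Δ-Vanishes c i₀ j₀
    z-Van : Vanishes i₀ j₀ z
    z-Van = Vanishes-map d-Van rnd refl
    er-Van : Vanishes i₀ j₀ er
    er-Van = Vanishes-map d-Van (λ x → x - rnd x) refl
    er² : Matrix N-1
    er² = minor i₀ j₀ er
    α Tₑ : ℚ
    α = row c i₀ + col c j₀ - a * c i₀ j₀
    Tₑ = total er
    decompose : ∀ π → Inj π → L c π ≡ α + (L z π + L er π)
    decompose π inj = trans (L-Δ c i₀ j₀ π inj) (cong (α +_) (trans (∑-cong λ k → split-at (d k (π k)) (z k (π k))) (L-+ z er π)))
    N₂-er : N₂ er ≤ b * t
    N₂-er = rounding
    N₂-er² : N₂ er² ≤ b * t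
    N₂-er² = ≤-trans (≡⇒≤ (total-minor (Vanishes-map er-Van sq refl))) N₂-er
    -- The means of the linear function of `er`: μ over the permutations with i₀ ↦ j₀, ν over all
    -- permutations.
    μ ν : ℚ
    μ = proj₁ (quotient (suc m) Tₑ)
    ν = proj₁ (quotient N-1 Tₑ)
    bμ : b * μ ≡ Tₑ
    bμ = proj₂ (quotient (suc m) Tₑ)
    aν : a * ν ≡ Tₑ
    aν = proj₂ (quotient N-1 Tₑ)
    bμ′ : b * μ ≡ total er²
    bμ′ = trans bμ (sym (total-minor er-Van))
    variance₁ : E N-1 (λ σ → sq (L er² σ - μ)) ≤ 2 * t
    variance₁ = *-cancelˡ-≤ b′ (0<ι m) (≤-trans (variance-bound er² bμ′) (≤-trans N₂-er² (by (0≤ι m ⊡ 0≤t) (lem b b′ t (ι-suc (suc m)) (ι-suc m)))))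
      where lem′ : ∀ i t → (1 + i) * (2 * t) ≡ (1 + (1 + i)) * t + i * t
            lem′ = solve-∀ R
            lem : ∀ b b′ t → b ≡ 1 + b′ → b′ ≡ 1 + ι m → b′ * (2 * t) ≡ b * t + ι m * t
            lem _ _ t refl refl = lem′ (ι m) t
    variance₂ : E N (λ π → sq (L er π - ν)) ≤ t
    variance₂ = *-cancelˡ-≤ b 0<b (≤-trans (variance-bound er aν) N₂-er)
    -- Given i₀ ↦ j₀, f is α plus an integer plus an error of mean μ, and it is close to a bit;
    -- hence α + μ is close to an integer.
    β a₀ : ℚ
    β = α + μ
    a₀ = rnd β
    ins-decompose : ∀ σ → Inj σ → L c (ins i₀ j₀ σ) ≡ α + (L z (ins i₀ j₀ σ) + L er² σ)
    ins-decompose σ inj = trans (decompose (ins i₀ j₀ σ) (ins-Inj i₀ j₀ inj)) (cong (λ x → α + (L z (ins i₀ j₀ σ) + x)) (L-ins er-Van σ))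
    Lz-Int : ∀ π → Int (L z π)
    Lz-Int π = ∑-Int λ k → Int-rnd (d k (π k))
    β-pointwise : ∀ σ → Inj σ → distℤ² β ≤ 2 * φ (L c (ins i₀ j₀ σ)) + 2 * sq (L er² σ - μ)
    β-pointwise σ inj = go (φ-attained (L c (ins i₀ j₀ σ)))
      where
      lem : ∀ α μ z e s → α + (z + e) - s + - (e - μ) ≡ α + μ - (s - z)
      lem = solve-∀ R
      go : Nearest (L c (ins i₀ j₀ σ)) → distℤ² β ≤ 2 * φ (L c (ins i₀ j₀ σ)) + 2 * sq (L er² σ - μ)
      go (s , bs , q) = ≤-trans (distℤ²-min β (Int-- (Bit-Int bs) (Lz-Int (ins i₀ j₀ σ))))
        (subst₂ _≤_ (cong sq (trans (cong (λ x → x - s + - (L er² σ - μ)) (ins-decompose σ inj)) (lem α μ (L z (ins i₀ j₀ σ)) (L er² σ) s)))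
          (cong₂ (λ x y → 2 * x + 2 * y) (sym q) (sq-neg (L er² σ - μ))) (sq-+-≤ (L c (ins i₀ j₀ σ) - s) (- (L er² σ - μ))))
    β-near : distℤ² β ≤ 6 * t
    β-near = ≤-trans (≡⇒≤ (sym (E-const N-1 (distℤ² β)))) (≤-trans (E-mono N-1 β-pointwise)
      (≤-trans (E-+-≤ N-1 (E-*-≤ N-1 2 ≥0 conditional) (E-*-≤ N-1 2 ≥0 variance₁)) (≡⇒≤ (lem t))))
      where lem : ∀ t → 2 * t + 2 * (2 * t) ≡ 6 * t
            lem = solve-∀ R
    cond-near : E N-1 (λ σ → sq (a₀ + L z (ins i₀ j₀ σ) - L c (ins i₀ j₀ σ))) ≤ 8 * t
    cond-near = ≤-trans (≡⇒≤ (trans (E-cong N-1 λ σ inj → trans (cong (λ x → sq (a₀ + L z (ins i₀ j₀ σ) - x)) (ins-decompose σ inj)) (lem a₀ (L z (ins i₀ j₀ σ)) α (L er² σ) μ))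
        (E-shift (L er²) (mean-L er² bμ′) (β - a₀))))
      (≤-trans (ℚ.+-mono-≤ β-near variance₁) (≡⇒≤ (lem′ t)))
      where lem : ∀ a z α e μ → (a + z - (α + (z + e))) * (a + z - (α + (z + e))) ≡ (α + μ - a + (e - μ)) * (α + μ - a + (e - μ))
            lem = solve-∀ R
            lem′ : ∀ t → 6 * t + 2 * t ≡ 8 * t
            lem′ = solve-∀ R
    cond : E N-1 (λ σ → φ (a₀ + L z (ins i₀ j₀ σ))) ≤ 18 * t
    cond = ≤-trans (E-mono N-1 λ σ _ → φ-perturb (a₀ + L z (ins i₀ j₀ σ)) (L c (ins i₀ j₀ σ)))
      (≤-trans (E-+-≤ N-1 (E-*-≤ N-1 2 ≥0 conditional) (E-*-≤ N-1 2 ≥0 cond-near)) (≡⇒≤ (lem t)))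
      where lem : ∀ t → 2 * t + 2 * (8 * t) ≡ 18 * t
            lem = solve-∀ R
    -- The means are Tₑ/b and Tₑ/(b + 1), so their gap is Tₑ/(ab) in absolute value, which
    -- Cauchy-Schwarz controls.
    mean-gap : sq (ν - μ) ≤ t
    mean-gap = *-cancelˡ-≤ (sq a * sq b) ((0<ι N-1 ⊡< 0<ι N-1) ⊡< (0<b ⊡< 0<b)) (≤-trans (≡⇒≤ gap)
      (≤-trans (sq-total-≤ er) (by (0≤sq a ⊡ (diff N₂-er ⊞ 0≤b ⊡ 0≤ι (suc m) ⊡ 0≤t)) (lem₂ a b (ι (suc m)) (N₂ er) t (ι-suc (suc m))))))
      where
      lem₂′ : ∀ a i n t → a * a * ((1 + i) * (1 + i)) * t ≡ a * a * n + a * a * ((1 + i) * t - n + (1 + i) * i * t)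
      lem₂′ = solve-∀ R
      lem₂ : ∀ a b i n t → b ≡ 1 + i → a * a * (b * b) * t ≡ a * a * n + a * a * (b * t - n + b * i * t)
      lem₂ a _ i n t refl = lem₂′ a i n t
      lem₁ : ∀ a b μ ν T → a ≡ 1 + b → b * μ ≡ T → a * ν ≡ T → a * a * (b * b) * ((ν - μ) * (ν - μ)) ≡ T * T
      lem₁ _ b μ ν _ refl refl q = trans (alg₁ b μ ν) (trans (cong (λ x → (b * x - (1 + b) * (b * μ)) * (b * x - (1 + b) * (b * μ))) q) (alg₂ b μ))
        where alg₁ : ∀ b μ ν → (1 + b) * (1 + b) * (b * b) * ((ν - μ) * (ν - μ)) ≡ (b * ((1 + b) * ν) - (1 + b) * (b * μ)) * (b * ((1 + b) * ν) - (1 + b) * (b * μ))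
              alg₁ = solve-∀ R
              alg₂ : ∀ b μ → (b * (b * μ) - (1 + b) * (b * μ)) * (b * (b * μ) - (1 + b) * (b * μ)) ≡ b * μ * (b * μ)
              alg₂ = solve-∀ R
      gap : sq a * sq b * sq (ν - μ) ≡ sq Tₑ
      gap = lem₁ a b μ ν Tₑ (ι-suc N-1) bμ aν
    near : E N (λ π → sq (L c π - (a₀ + L z π))) ≤ 15 * t
    near = ≤-trans (≡⇒≤ (trans (E-cong N λ π inj → trans (cong (λ x → sq (x - (a₀ + L z π))) (decompose π inj)) (lem a₀ (L z π) α (L er π) ν))
        (E-shift (L er) (mean-L er aν) (α + ν - a₀))))
      (≤-trans (ℚ.+-mono-≤ (≤-trans (≡⇒≤ (cong sq (lem₃ α ν μ a₀))) (sq-+-≤ (β - a₀) (ν - μ))) variance₂)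
        (by (≥0 {2} ⊡ diff β-near ⊞ ≥0 {2} ⊡ diff mean-gap) (lem₄ t (distℤ² β) (sq (ν - μ)))))
      where lem : ∀ a z α e ν → (α + (z + e) - (a + z)) * (α + (z + e) - (a + z)) ≡ (α + ν - a + (e - ν)) * (α + ν - a + (e - ν))
            lem = solve-∀ R
            lem₃ : ∀ α ν μ a → α + ν - a ≡ α + μ - a + (ν - μ)
            lem₃ = solve-∀ R
            lem₄ : ∀ t x y → 15 * t ≡ 2 * x + 2 * y + t + (2 * (6 * t - x) + 2 * (t - y))
            lem₄ = solve-∀ R
    -- The weighted inequality z² ≤ 1.001 d² + 1001 (d - z)² is used: only the first coefficient
    -- must be near 1, since `small` makes the contribution of the second tiny.
    size : 1000 * N₂ z ≤ b * (4000 * (p * (1ℚ - p)) + 20)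
    size = *-cancelˡ-≤ 1000 (>0 {1000}) (≤-trans (*-monoˡ (≥0 {1000}) N₂-z)
      (by (≥0 {1001} ⊡ diff energy ⊞ ≥0 {1001000000} ⊡ diff N₂-er ⊞ 0≤b ⊡ (≥0 {1000} ⊡ 0≤sq (2 * p - 1ℚ) ⊞ ≥0 {2} ⊡ diff small ⊞ ≥0 {9989} ⊞ ≥0 {998999999} ⊡ 0≤t ⊞ 0≤t))
        (lem b p t (N₂ d) (N₂ er))))
      where
      lem : ∀ b p t D e → 1000 * (b * (4000 * (p * (1ℚ - p)) + 20)) ≡ 1000 * (1001 * D + 1001000 * e) +
        (1001 * (b * (4000 * (p * (1ℚ - p)) + 9) - 1000 * D) + 1001000000 * (b * t - e) +
         b * (1000 * ((2 * p - 1ℚ) * (2 * p - 1ℚ)) + 2 * (1 - 1000000000 * t) + 9989 + 998999999 * t + t))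
      lem = solve-∀ R
      point : ∀ x r → 1000 * (r * r) + ((x + 1000 * (x - r)) * (x + 1000 * (x - r))) ≡ 1001 * (x * x) + 1001000 * ((x - r) * (x - r))
      point = solve-∀ R
      N₂-z : 1000 * N₂ z ≤ 1001 * N₂ d + 1001000 * N₂ er
      N₂-z = subst₂ _≤_ (∑∑-* 1000 _)
        (trans (∑-cong λ i → trans (∑-+ _ _) (cong₂ _+_ (∑-* 1001 _) (∑-* 1001000 _))) (trans (∑-+ _ _) (cong₂ _+_ (∑-* 1001 _) (∑-* 1001000 _))))
        (∑∑-mono λ i j → by (0≤sq (d i j + 1000 * (d i j - z i j))) (sym (point (d i j) (z i j))))

-- The integer constant is 0 or 1

Int-≤sq : ∀ {x} → Int x → x ≤ sq x
Int-≤sq {x} ix with int-gap ix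
... | inj₁ x≤0 = by (0≤sq x ⊞ neg-≤ x≤0) (lem x)
  where lem : ∀ x → x * x ≡ x + (x * x + - x)
        lem = solve-∀ R
... | inj₂ 1≤x = by ((diff 1≤x ⊞ ≥0 {1}) ⊡ diff 1≤x) (lem x)
  where lem : ∀ x → x * x ≡ x + (x - 1ℚ + 1) * (x - 1ℚ)
        lem = solve-∀ R

total≤N₂ : ∀ (z : Matrix n) → (∀ k l → Int (z k l)) → total z ≤ N₂ z
total≤N₂ z iz = ∑∑-mono λ k l → Int-≤sq (iz k l)

-total≤N₂ : ∀ (z : Matrix n) → (∀ k l → Int (z k l)) → - total z ≤ N₂ z
-total≤N₂ z iz = subst (_≤ N₂ z) (trans (∑-cong λ k → ∑-neg (z k)) (∑-neg (row z)))
  (∑∑-mono λ k l → subst (- z k l ≤_) (sq-neg (z k l)) (Int-≤sq (Int-neg (iz k l))))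

E-sq-≤ : ∀ n (g : Sym n → ℚ) → sq (E n g) ≤ E n (sq ∘ g)
E-sq-≤ n g = by (E-nonneg n λ π _ → 0≤sq (g π - E n g)) (trans (split-at (E n (sq ∘ g)) (sq (E n g))) (cong (sq (E n g) +_) (sym (variance g refl))))

positive-≰0 : ∀ q {C : Set} → {True (0ℚ ℚ.<? q)} → q ≤ 0ℚ → C
positive-≰0 q {_} {w} p = contradiction p (<⇒≱ (toWitness w))

module _ {m : ℕ} {f : Sym (suc (suc (suc m))) → ℚ} {p t : ℚ} (mean : E (suc (suc (suc m))) f ≡ p)
  (small : 1000000000 * t ≤ 1) (0≤t : 0ℚ ≤ t) (A : Approx m f p t) where
  open Approx A
  private
    N-1 N : ℕ
    N-1 = suc (suc m)
    N = suc N-1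
    a b X y q : ℚ
    a = ι N
    b = ι N-1
    X = 4000 * (p * (1ℚ - p)) + 20
    y = proj₁ (quotient N-1 (total z))
    q = a₀ + y
    ay : a * y ≡ total z
    ay = proj₂ (quotient N-1 (total z))
    0<b : 0ℚ < b
    0<b = 0<ι (suc m)
    0≤X : 0ℚ ≤ X
    0≤X = *-cancelˡ-≤ b 0<b (≤-trans (≡⇒≤ (ℚ.*-zeroʳ b)) (≤-trans (≥0 {1000} ⊡ (∑∑-nonneg λ k l → 0≤sq (z k l))) size))
    gap² : sq (p - q) ≤ 15 * t
    gap² = subst (λ x → sq x ≤ 15 * t) gap-mean (≤-trans (E-sq-≤ N (λ π → f π - (a₀ + L z π))) near)
      where
      gap-mean : E N (λ π → f π - (a₀ + L z π)) ≡ p - q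
      gap-mean = trans (E-- N f _) (cong₂ _-_ mean (trans (E-+ N (λ _ → a₀) (L z)) (cong₂ _+_ (E-const N a₀) (mean-L z ay))))
    scaled : ∀ x → sq x ≤ 15 * t → 100 * x ≤ 1
    scaled x h = sq≤1⇒≤1 1 ≥0 (by (≥0 {10000} ⊡ diff h ⊞ ≥0 {150000} ⊡ 0≤t ⊞ diff small ⊞ ≥0 {999700000} ⊡ 0≤t) (lem x t))
      where lem : ∀ x t → 1 * 1 ≡ (100 * x) * (100 * x) + (10000 * (15 * t - x * x) + 150000 * t + (1 - 1000000000 * t) + 999700000 * t)
            lem = solve-∀ R
    size-a : 1000 * N₂ z ≤ a * X
    size-a = ≤-trans size (by 0≤X (trans (cong (_* X) (ι-suc N-1)) (lem b X)))
      where lem : ∀ b x → (1 + b) * x ≡ b * x + x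
            lem = solve-∀ R
    1000y≤X : 1000 * y ≤ X
    1000y≤X = *-cancelˡ-≤ a (0<ι N-1) (≤-trans (≡⇒≤ (trans (lem a y) (cong (1000 *_) ay))) (≤-trans (*-monoˡ (≥0 {1000}) (total≤N₂ z z-Int)) size-a))
      where lem : ∀ a y → a * (1000 * y) ≡ 1000 * (a * y)
            lem = solve-∀ R
    -1000y≤X : - (1000 * y) ≤ X
    -1000y≤X = *-cancelˡ-≤ a (0<ι N-1) (≤-trans (≡⇒≤ (trans (lem a y) (cong (λ z → 1000 * - z) ay))) (≤-trans (*-monoˡ (≥0 {1000}) (-total≤N₂ z z-Int)) size-a))
      where lem : ∀ a y → a * - (1000 * y) ≡ 1000 * - (a * y)
            lem = solve-∀ R

  mean-above : 100 * (p - q) ≤ 1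
  mean-above = scaled (p - q) gap²

  mean-below : 100 * (q - p) ≤ 1
  mean-below = scaled (q - p) (subst (_≤ 15 * t) (sq-swap p q) gap²)

  -- p is within 1/100 of a₀ + y, and |y| ≤ 4p(1 - p) + 1/50. For a₀ ≥ 2 this forces 5p - 4p² ≥
  -- 1.97, although the maximum is 25/16, at p = 5/8. The case a₀ ≤ -1 is its mirror image under p ↦
  -- 1 - p.
  a₀-Bit : Bit a₀
  a₀-Bit = upper (int-gap-at 1ℚ Int1 a₀-Int)
    where
    too-big : ∀ p a₀ y → 0ℚ ≡ 815 + (2 * (4000 * (p * (1ℚ - p)) + 20 - - (1000 * y)) + 2000 * (a₀ - (1ℚ + 1)) + 20 * (1 - 100 * (a₀ + y - p)) + 125 * ((8 * p - 5) * (8 * p - 5)))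
    too-big = solve-∀ R
    too-small : ∀ p a₀ y → 0ℚ ≡ 815 + (2 * (4000 * (p * (1ℚ - p)) + 20 - 1000 * y) + 2000 * (- 1ℚ - a₀) + 20 * (1 - 100 * (p - (a₀ + y))) + 125 * ((8 * p - 3) * (8 * p - 3)))
    too-small = solve-∀ R
    lower : a₀ ≤ 1ℚ → a₀ ≤ - 1ℚ ⊎ - 1ℚ + 1 ≤ a₀ → Bit a₀
    lower _ (inj₁ a₀≤-1) = positive-≰0 815 (by (≥0 {2} ⊡ diff 1000y≤X ⊞ ≥0 {2000} ⊡ diff a₀≤-1 ⊞ ≥0 {20} ⊡ diff mean-above ⊞ ≥0 {125} ⊡ 0≤sq (8 * p - 3)) (too-small p a₀ y))
    lower a₀≤1 (inj₂ 0≤a₀) = between (int-gap a₀-Int)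
      where
      between : a₀ ≤ 0ℚ ⊎ 1ℚ ≤ a₀ → Bit a₀
      between (inj₁ a₀≤0) = inj₁ (≤-antisym a₀≤0 0≤a₀)
      between (inj₂ 1≤a₀) = inj₂ (≤-antisym a₀≤1 1≤a₀)
    upper : a₀ ≤ 1ℚ ⊎ 1ℚ + 1 ≤ a₀ → Bit a₀
    upper (inj₁ a₀≤1) = lower a₀≤1 (int-gap-at (- 1ℚ) (Int-neg Int1) a₀-Int)
    upper (inj₂ 2≤a₀) = positive-≰0 815 (by (≥0 {2} ⊡ diff -1000y≤X ⊞ ≥0 {2000} ⊡ diff 2≤a₀ ⊞ ≥0 {20} ⊡ diff mean-below ⊞ ≥0 {125} ⊡ 0≤sq (8 * p - 5)) (too-big p a₀ y))

  total-above : a₀ ≡ 0ℚ → 1000 * total z ≤ a * (1000 * p + 10)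
  total-above e = subst (_≤ a * (1000 * p + 10)) (trans (lem a y) (cong (1000 *_) ay))
    (*-monoˡ (0≤ι N) (by (≥0 {10} ⊡ diff mean-below) (trans (lem′ p y) (cong (λ x → 1000 * y + 10 * (1 - 100 * (x + y - p))) (sym e)))))
    where lem : ∀ a y → a * (1000 * y) ≡ 1000 * (a * y)
          lem = solve-∀ R
          lem′ : ∀ p y → 1000 * p + 10 ≡ 1000 * y + 10 * (1 - 100 * (0ℚ + y - p))
          lem′ = solve-∀ R

φ-complement : ∀ y → φ (1ℚ - y) ≡ φ y
φ-complement y = ≤-antisym (half y) (subst (λ z → φ z ≤ φ (1ℚ - y)) (lem y) (half (1ℚ - y)))
  where
  lem : ∀ y → 1ℚ - (1ℚ - y) ≡ y
  lem = solve-∀ R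
  half : ∀ y → φ (1ℚ - y) ≤ φ y
  half y = go (φ-attained y)
    where
    lem₀ : ∀ y → (1ℚ - y - 1ℚ) * (1ℚ - y - 1ℚ) ≡ (y - 0ℚ) * (y - 0ℚ)
    lem₀ = solve-∀ R
    lem₁ : ∀ y → (1ℚ - y - 0ℚ) * (1ℚ - y - 0ℚ) ≡ (y - 1ℚ) * (y - 1ℚ)
    lem₁ = solve-∀ R
    go : Nearest y → φ (1ℚ - y) ≤ φ y
    go (_ , inj₁ refl , q) = ≤-trans (φ-min (1ℚ - y) (inj₂ refl)) (≡⇒≤ (trans (lem₀ y) (sym q)))
    go (_ , inj₂ refl , q) = ≤-trans (φ-min (1ℚ - y) (inj₁ refl)) (≡⇒≤ (trans (lem₁ y) (sym q)))

L-neg : ∀ (c : Matrix n) π → L (λ k l → - c k l) π ≡ - L c π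
L-neg c π = ∑-neg (λ k → c k (π k))

complement : ∀ {m} {f : Sym (suc (suc (suc m))) → ℚ} {p t} → (A : Approx m f p t) → Approx m (λ π → 1ℚ - f π) (1ℚ - p) t
complement {m} {f} {p} {t} A = record
  { i₀ = i₀ ; j₀ = j₀ ; z = λ k l → - z k l ; z-Int = λ k l → Int-neg (z-Int k l)
  ; z-Vanishes = Vanishes-map z-Vanishes (-_) refl
  ; a₀ = 1ℚ - a₀ ; a₀-Int = Int-- Int1 a₀-Int
  ; near = subst (_≤ 15 * t) (E-cong N λ π _ → trans (lem₁ (f π) a₀ (L z π)) (cong (λ x → sq (1ℚ - f π - (1ℚ - a₀ + x))) (sym (L-neg z π)))) near
  ; conditional = subst (_≤ 18 * t) (E-cong (suc (suc m)) λ σ _ → trans (sym (φ-complement (a₀ + L z (ins i₀ j₀ σ)))) (cong φ (trans (lem₂ a₀ (L z (ins i₀ j₀ σ))) (cong (1ℚ - a₀ +_) (sym (L-neg z (ins i₀ j₀ σ))))))) conditional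
  ; size = subst₂ _≤_ (cong (1000 *_) (∑-cong λ k → ∑-cong λ l → sym (sq-neg (z k l)))) (cong (λ x → ι (suc (suc m)) * (4000 * x + 20)) (lem₄ p)) size
  }
  where
  open Approx A
  N : ℕ
  N = suc (suc (suc m))
  lem₁ : ∀ f a l → (f - (a + l)) * (f - (a + l)) ≡ (1ℚ - f - (1ℚ - a + - l)) * (1ℚ - f - (1ℚ - a + - l))
  lem₁ = solve-∀ R
  lem₂ : ∀ a l → 1ℚ - (a + l) ≡ 1ℚ - a + - l
  lem₂ = solve-∀ R
  lem₄ : ∀ p → p * (1ℚ - p) ≡ (1ℚ - p) * (1ℚ - (1ℚ - p))
  lem₄ = solve-∀ R

-- Permutations hitting no or exactly one nonzero entry

opaque
  isZero : ℚ → ℚ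
  isZero x = ⟦ ⌊ x ℚ.≤? 0ℚ ⌋ ⟧

ZeroTest : ℚ → Set
ZeroTest x = (x ≤ 0ℚ × isZero x ≡ 1ℚ) ⊎ (0ℚ < x × isZero x ≡ 0ℚ)

opaque
  unfolding isZero

  isZero-cases : ∀ x → ZeroTest x
  isZero-cases x with x ℚ.≤? 0ℚ
  ... | yes p = inj₁ (p , refl)
  ... | no p = inj₂ (ℚ.≰⇒> p , refl)

isZero-yes : ∀ {x} → x ≤ 0ℚ → isZero x ≡ 1ℚ
isZero-yes {x} p = go (isZero-cases x)
  where go : ZeroTest x → isZero x ≡ 1ℚ
        go (inj₁ (_ , q)) = q
        go (inj₂ (q , _)) = contradiction p (<⇒≱ q)

0≤isZero : ∀ x → 0ℚ ≤ isZero x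
0≤isZero x = go (isZero-cases x)
  where go : ZeroTest x → 0ℚ ≤ isZero x
        go (inj₁ (_ , q)) = subst (0ℚ ≤_) (sym q) ≥0
        go (inj₂ (_ , q)) = subst (0ℚ ≤_) (sym q) ≥0

0≤δ : ∀ (i j : Fin n) → 0ℚ ≤ δ i j
0≤δ i j = go (δ-cases i j)
  where go : (i ≡ j × δ i j ≡ 1ℚ) ⊎ (¬ (i ≡ j) × δ i j ≡ 0ℚ) → 0ℚ ≤ δ i j
        go (inj₁ (_ , q)) = subst (0ℚ ≤_) (sym q) ≥0
        go (inj₂ (_ , q)) = subst (0ℚ ≤_) (sym q) ≥0

sq≤0⇒≡0 : ∀ x → sq x ≤ 0ℚ → x ≡ 0ℚ
sq≤0⇒≡0 x p = ≤-antisym (sq≤1⇒≤1 0ℚ ≥0 p) (by (diff (sq≤1⇒≤1 0ℚ {a = - x} ≥0 (subst (_≤ 0ℚ) (sym (sq-neg x)) p))) (lem′ x))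
  where lem′ : ∀ x → x ≡ 0ℚ + (0ℚ - - x)
        lem′ = solve-∀ R

-- Encodes that x² and x have the same parity. For x ≥ 0 these are the triangular numbers; a change
-- of sign shifts the value by an integer.
half-triangular : ∀ {x} → Int x → Int (½ * (sq x + x))
half-triangular (ℤ.+ k , refl) = subst (λ q → Int (½ * (q * q + q))) (trans (sym (ι-def k)) (ℕtoℚ≡ k)) (go k)
  where
  lem : ∀ q → ½ * ((1 + q) * (1 + q) + (1 + q)) ≡ ½ * (q * q + q) + (1 + q)
  lem = solve-∀ R
  ι-Int : ∀ k → Int (ι k)
  ι-Int k = ℤ.+ k , trans (sym (ι-def k)) (ℕtoℚ≡ k)
  go : ∀ k → Int (½ * (ι k * ι k + ι k))
  go zero = subst (λ q → Int (½ * (q * q + q))) (sym ι-0) Int0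
  go (suc k) = subst Int (trans (sym (lem (ι k))) (cong (λ q → ½ * (q * q + q)) (sym (ι-suc k)))) (Int-+ (go k) (Int-+ Int1 (ι-Int k)))
half-triangular {x} (ℤ.-[1+ k ] , refl) = subst Int (trans (lem (Lit.fromℤ (ℤ.+ suc k))) (cong (λ q → ½ * (q * q + q)) (sym (fromℤ-neg (ℤ.+ suc k)))))
  (Int-- (half-triangular (ℤ.+ suc k , refl)) (ℤ.+ suc k , refl))
  where
  lem : ∀ q → ½ * (q * q + q) - q ≡ ½ * ((- q) * (- q) + - q)
  lem = solve-∀ R

φ≥1 : ∀ {g} → g ≤ - 1ℚ → 1ℚ ≤ φ g
φ≥1 {g} p = go (φ-attained g)
  where
  lem₀ : ∀ g → (g - 0ℚ) * (g - 0ℚ) ≡ 1ℚ + ((- 1ℚ - g) * (- 1ℚ - g + 2))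
  lem₀ = solve-∀ R
  lem₁ : ∀ g → (g - 1ℚ) * (g - 1ℚ) ≡ 1ℚ + ((- 1ℚ - g) * (- 1ℚ - g + 2) + (2 * (- 1ℚ - g) + 3))
  lem₁ = solve-∀ R
  go : Nearest g → 1ℚ ≤ φ g
  go (_ , inj₁ refl , q) = by (diff p ⊡ (diff p ⊞ ≥0 {2})) (trans q (lem₀ g))
  go (_ , inj₂ refl , q) = by (diff p ⊡ (diff p ⊞ ≥0 {2}) ⊞ (≥0 {2} ⊡ diff p ⊞ ≥0 {3})) (trans q (lem₁ g))

-- W = Σ yᵢ² and g = Σ yᵢ have the same parity and |g| ≤ W, so W + g ≤ 1 leaves only W = 0 or g = - W < 0.
no-hit-bound : ∀ (y : Fin n → ℚ) → (∀ k → Int (y k)) →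
  2 ≤ 2 * isZero (∑ (sq ∘ y)) + ∑ (sq ∘ y) + ∑ y + 2 * φ (∑ y)
no-hit-bound {n} y iy = go (isZero-cases W)
  where
  W g : ℚ
  W = ∑ (sq ∘ y)
  g = ∑ y
  half-Int : Int (½ * (W + g))
  half-Int = subst Int (trans (∑-* ½ _) (cong (½ *_) (∑-+ (sq ∘ y) y))) (∑-Int λ k → half-triangular (iy k))
  0≤W+g : 0ℚ ≤ W + g
  0≤W+g = subst (0ℚ ≤_) (∑-+ (sq ∘ y) y) (∑-nonneg λ k → subst (0ℚ ≤_) (lem (y k)) (diff (Int-≤sq (Int-neg (iy k)))))
    where lem : ∀ y → (- y) * (- y) - - y ≡ y * y + y
          lem = solve-∀ R
  W-Int : Int W
  W-Int = ∑-Int λ k → Int-* (iy k) (iy k)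
  lem₀ : ∀ W g x → 2 * 1ℚ + W + g + 2 * x ≡ 2 + (W + g + 2 * x)
  lem₀ = solve-∀ R
  lem₁ : ∀ W g x → 2 * 0ℚ + W + g + 2 * x ≡ 2 + (2 * (½ * (W + g) - 1ℚ) + 2 * x)
  lem₁ = solve-∀ R
  lem₂ : ∀ W g x → 2 * 0ℚ + W + g + 2 * x ≡ 2 + (W + g + 2 * (x - 1ℚ))
  lem₂ = solve-∀ R
  lem₃ : ∀ W g → - 1ℚ ≡ g + (2 * (0ℚ - ½ * (W + g)) + (W - 1ℚ))
  lem₃ = solve-∀ R
  W≥1 : 0ℚ < W → W ≤ 0ℚ ⊎ 1ℚ ≤ W → 1ℚ ≤ W
  W≥1 0<W (inj₁ q) = contradiction q (<⇒≱ 0<W)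
  W≥1 0<W (inj₂ q) = q
  hit : 1ℚ ≤ W → ½ * (W + g) ≤ 0ℚ ⊎ 1ℚ ≤ ½ * (W + g) → 2 ≤ 2 * 0ℚ + W + g + 2 * φ g
  hit _ (inj₂ q) = by (≥0 {2} ⊡ diff q ⊞ ≥0 {2} ⊡ 0≤φ g) (lem₁ W g (φ g))
  hit 1≤W (inj₁ q) = by (0≤W+g ⊞ ≥0 {2} ⊡ diff (φ≥1 {g} (by (≥0 {2} ⊡ diff q ⊞ diff 1≤W) (lem₃ W g)))) (lem₂ W g (φ g))
  go : ZeroTest W → 2 ≤ 2 * isZero W + W + g + 2 * φ g
  go (inj₁ (_ , q)) = by (0≤W+g ⊞ ≥0 {2} ⊡ 0≤φ g) (trans (cong (λ x → 2 * x + W + g + 2 * φ g) q) (lem₀ W g (φ g)))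
  go (inj₂ (0<W , q)) = subst (λ x → 2 ≤ 2 * x + W + g + 2 * φ g) (sym q) (hit (W≥1 0<W (int-gap W-Int)) (int-gap half-Int))

φ-0 : φ 0ℚ ≡ 0ℚ
φ-0 = refl

-- A term survives only if y vanishes off k, and then the sum of y is y k. If y vanishes altogether,
-- several k qualify, but each contributes φ 0 = 0.
single-hit-bound : ∀ (y : Fin n → ℚ) → ∑ (λ k → φ (y k) * isZero (∑ (sq ∘ y) - sq (y k))) ≤ φ (∑ y)
single-hit-bound {zero} y = ≤-trans (≡⇒≤ (∑-empty _)) (0≤φ (∑ y))
single-hit-bound {suc n} y = go (any? λ k → W - sq (y k) ℚ.≤? 0ℚ)
  where
  W : ℚ
  W = ∑ (sq ∘ y)
  term : Fin (suc n) → ℚ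
  term k = φ (y k) * isZero (W - sq (y k))
  cases : ∀ k → ¬ (W - sq (y k) ≤ 0ℚ) → ZeroTest (W - sq (y k)) → term k ≡ 0ℚ
  cases k ¬p (inj₁ (p , _)) = contradiction p ¬p
  cases k _ (inj₂ (_ , q)) = trans (cong (φ (y k) *_) q) (ℚ.*-zeroʳ (φ (y k)))
  go : Dec (∃ λ k → W - sq (y k) ≤ 0ℚ) → ∑ term ≤ φ (∑ y)
  go (no none) = ≤-trans (≡⇒≤ (trans (∑-cong λ k → cases k (λ p → none (k , p)) (isZero-cases (W - sq (y k)))) (∑-0 (suc n)))) (0≤φ (∑ y))
  go (yes (k , p)) = ≡⇒≤ (begin
    ∑ term ≡⟨ ∑-punch k term ⟩
    term k + ∑ (term ∘ punchIn k) ≡⟨ cong₂ _+_ (trans (cong (φ (y k) *_) (isZero-yes p)) (ℚ.*-identityʳ (φ (y k)))) (trans (∑-cong λ i → *-zero (trans (cong φ (others i)) φ-0) (isZero (W - sq (y (punchIn k i))))) (∑-0 n)) ⟩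
    φ (y k) + 0ℚ ≡⟨ ℚ.+-identityʳ (φ (y k)) ⟩
    φ (y k) ≡⟨ cong φ (sym (trans (∑-punch k y) (trans (cong (y k +_) (trans (∑-cong others) (∑-0 n))) (ℚ.+-identityʳ (y k))))) ⟩
    φ (∑ y) ∎)
    where
    open ≡-Reasoning
    lem : ∀ x s → x + s - x ≡ s
    lem = solve-∀ R
    rest≤0 : ∑ (λ i → sq (y (punchIn k i))) ≤ 0ℚ
    rest≤0 = subst (_≤ 0ℚ) (trans (cong (_- sq (y k)) (∑-punch k (sq ∘ y))) (lem (sq (y k)) (∑ (λ i → sq (y (punchIn k i)))))) p
    others : ∀ i → y (punchIn k i) ≡ 0ℚ
    others i = sq≤0⇒≡0 (y (punchIn k i)) (≤-trans (∑-≥-term (λ i → sq (y (punchIn k i))) (λ i → 0≤sq (y (punchIn k i))) i) rest≤0)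

module _ {n : ℕ} {i₀ j₀ : Fin (suc n)} {z : Matrix (suc n)} (van : Vanishes i₀ j₀ z) where
  open Vanishes van
  private
    N : ℕ
    N = suc n
    a : ℚ
    a = ι N
    W : Sym N → ℚ
    W = L (λ k l → sq (z k l))
    W-Ext : Ext W
    W-Ext = L-Ext (λ k l → sq (z k l))

  -- The probability, given i₀ ↦ j₀, of meeting no nonzero entry of z, detected by the vanishing of
  -- a sum of squares.
  no-hit : ℚ
  no-hit = E n (λ σ → isZero (W (ins i₀ j₀ σ)))

  private
    base-hit : Sym N → ℚ
    base-hit π = δ j₀ (π i₀) * isZero (W π)

    single-hit : Fin N → Fin N → Sym N → ℚ
    single-hit k l π = δ (π k) l * isZero (W π - sq (z k l))

    base-mean : a * E N base-hit ≡ no-hit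
    base-mean = begin
      a * E N base-hit ≡⟨ E-ins i₀ {base-hit} (λ p → cong₂ _*_ (cong (δ j₀) (p i₀)) (cong isZero (W-Ext p))) ⟩
      ∑ (λ j → E n (base-hit ∘ ins i₀ j)) ≡⟨ ∑-cong (λ j → trans (E-cong n λ σ _ → cong (λ x → δ j₀ x * isZero (W (ins i₀ j σ))) (ins-at i₀ j σ)) (E-* n (δ j₀ j) (λ σ → isZero (W (ins i₀ j σ))))) ⟩
      ∑ (λ j → δ j₀ j * E n (λ σ → isZero (W (ins i₀ j σ)))) ≡⟨ ∑-δ j₀ (λ j → E n (λ σ → isZero (W (ins i₀ j σ)))) ⟩
      no-hit ∎
      where open ≡-Reasoning

    -- Starting from i₀ ↦ j₀, k ↦ b, r ↦ l, the modified permutation has k ↦ l, i₀ ↦ b, r ↦ j₀: the only entry it can hit is (k , l).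
    redirect : Fin N → Fin N → Sym N → Sym N
    redirect k l π = transpose j₀ l ∘ π ∘ transpose i₀ k

    redirect-hits : ∀ k l → ¬ (z k l ≡ 0ℚ) → ∀ π → Inj π → base-hit π ≤ single-hit k l (redirect k l π)
    redirect-hits k l z≢0 π inj = go (δ-cases j₀ (π i₀)) (isZero-cases (W π))
      where
      nonneg : 0ℚ ≤ single-hit k l (redirect k l π)
      nonneg = 0≤δ (redirect k l π k) l ⊡ 0≤isZero (W (redirect k l π) - sq (z k l))
      go : (j₀ ≡ π i₀ × δ j₀ (π i₀) ≡ 1ℚ) ⊎ (¬ (j₀ ≡ π i₀) × δ j₀ (π i₀) ≡ 0ℚ) → ZeroTest (W π) →
        base-hit π ≤ single-hit k l (redirect k l π)
      go (inj₂ (_ , q)) _ = ≤-trans (≡⇒≤ (*-zero q (isZero (W π)))) nonneg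
      go (inj₁ _) (inj₂ (_ , q)) = ≤-trans (≡⇒≤ (trans (cong (δ j₀ (π i₀) *_) q) (ℚ.*-zeroʳ (δ j₀ (π i₀))))) nonneg
      go (inj₁ (j₀≡ , q)) (inj₁ (W≤0 , s)) = ≡⇒≤ (trans (cong₂ _*_ q s) (sym (cong₂ _*_ (δ-yes at-k) (isZero-yes (≡⇒≤ W-diff)))))
        where
        missed : ∀ i → z i (π i) ≡ 0ℚ
        missed i = sq≤0⇒≡0 (z i (π i)) (≤-trans (∑-≥-term (λ i → sq (z i (π i))) (λ i → 0≤sq (z i (π i))) i) W≤0)
        at-k : redirect k l π k ≡ l
        at-k = trans (cong (transpose j₀ l ∘ π) (transpose-snd i₀ k)) (trans (cong (transpose j₀ l) (sym j₀≡)) (transpose-fst j₀ l))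
        elsewhere : ∀ i → ¬ (i ≡ k) → z i (redirect k l π i) ≡ 0ℚ
        elsewhere i i≢k = by-row (i ≟F i₀)
          where
          image : ¬ (i ≡ i₀) → Dec (π i ≡ j₀) → Dec (π i ≡ l) → z i (transpose j₀ l (π i)) ≡ 0ℚ
          image i≢i₀ (yes p) _ = contradiction (inj (trans p j₀≡)) i≢i₀
          image _ (no _) (yes p) = trans (cong (λ x → z i x) (trans (cong (transpose j₀ l) p) (transpose-snd j₀ l))) (col₀ i)
          image _ (no p) (no p′) = trans (cong (z i) (transpose-other p p′)) (missed i)
          by-row : Dec (i ≡ i₀) → z i (redirect k l π i) ≡ 0ℚ
          by-row (yes p) = trans (cong (λ x → z x (redirect k l π i)) p) (row₀ (redirect k l π i))
          by-row (no i≢i₀) = trans (cong (λ x → z i (transpose j₀ l (π x))) (transpose-other i≢i₀ i≢k)) (image i≢i₀ (π i ≟F j₀) (π i ≟F l))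
        terms : ∀ i → sq (z i (redirect k l π i)) ≡ δ k i * sq (z k l)
        terms i = split (δ-cases k i)
          where
          split : (k ≡ i × δ k i ≡ 1ℚ) ⊎ (¬ (k ≡ i) × δ k i ≡ 0ℚ) → sq (z i (redirect k l π i)) ≡ δ k i * sq (z k l)
          split (inj₁ (refl , p)) = trans (cong (λ x → sq (z k x)) at-k) (sym (trans (cong (_* sq (z k l)) p) (ℚ.*-identityˡ (sq (z k l)))))
          split (inj₂ (k≢i , p)) = trans (cong sq (elsewhere i (k≢i ∘ sym))) (sym (*-zero p (sq (z k l))))
        W-diff : W (redirect k l π) - sq (z k l) ≡ 0ℚ
        W-diff = trans (cong (_- sq (z k l)) (trans (∑-cong terms) (∑-δ k (λ _ → sq (z k l))))) (ℚ.+-inverseʳ (sq (z k l)))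

    single-mean : ∀ k l → ¬ (z k l ≡ 0ℚ) → no-hit ≤ a * E N (single-hit k l)
    single-mean k l z≢0 = ≤-trans (≡⇒≤ (sym base-mean)) (*-monoˡ (0≤ι N) (≤-trans (E-mono N (redirect-hits k l z≢0))
      (≡⇒≤ (E-reindex {h = single-hit k l} (λ p → cong₂ _*_ (cong (λ x → δ x l) (p k)) (cong (λ x → isZero (x - sq (z k l))) (W-Ext p)))
        (transpose i₀ k) (transpose j₀ l) (transpose-involutive i₀ k) (transpose-involutive j₀ l)))))

    hits-pointwise : ∀ π → ∑ (λ k → ∑ (λ l → φ (z k l) * single-hit k l π)) ≤ φ (L z π)
    hits-pointwise π = ≤-trans (≡⇒≤ (∑-cong λ k → trans (∑-cong λ l → *-exchange (φ (z k l)) (δ (π k) l) (isZero (W π - sq (z k l)))) (∑-δ (π k) (λ l → φ (z k l) * isZero (W π - sq (z k l))))))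
      (single-hit-bound (λ k → z k (π k)))

  -- The events of hitting (k , l) and no other nonzero entry are disjoint for different nonzero
  -- entries. By redirection each has probability at least `no-hit` / a, and on it the linear
  -- function equals z k l.
  ∑-φ-bound : no-hit * ∑ (λ k → ∑ (λ l → φ (z k l))) ≤ a * E N (φ ∘ L z)
  ∑-φ-bound = begin
    no-hit * ∑ (λ k → ∑ (λ l → φ (z k l))) ≡⟨ sym (∑∑-* no-hit _) ⟩
    ∑ (λ k → ∑ (λ l → no-hit * φ (z k l))) ≤⟨ ∑-mono (λ k → ∑-mono λ l → entry k l (z k l ℚ.≟ 0ℚ)) ⟩
    ∑ (λ k → ∑ (λ l → a * E N (λ π → φ (z k l) * single-hit k l π))) ≡⟨ ∑∑-* a _ ⟩
    a * ∑ (λ k → ∑ (λ l → E N (λ π → φ (z k l) * single-hit k l π))) ≡⟨ cong (a *_) (sym (trans (E-∑ N _) (∑-cong λ k → E-∑ N _))) ⟩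
    a * E N (λ π → ∑ (λ k → ∑ (λ l → φ (z k l) * single-hit k l π))) ≤⟨ *-monoˡ (0≤ι N) (E-mono N λ π _ → hits-pointwise π) ⟩
    a * E N (φ ∘ L z) ∎
    where
    open ℚ.≤-Reasoning
    entry : ∀ k l → Dec (z k l ≡ 0ℚ) → no-hit * φ (z k l) ≤ a * E N (λ π → φ (z k l) * single-hit k l π)
    entry k l (yes p) = ≤-trans (≡⇒≤ (trans (cong (λ x → no-hit * φ x) p) (ℚ.*-zeroʳ no-hit)))
      (0≤ι N ⊡ E-nonneg N λ π _ → 0≤φ (z k l) ⊡ (0≤δ (π k) l ⊡ 0≤isZero (W π - sq (z k l))))
    entry k l (no p) = ≤-trans (≡⇒≤ (ℚ.*-comm no-hit (φ (z k l)))) (≤-trans (*-monoˡ (0≤φ (z k l)) (single-mean k l p))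
      (≡⇒≤ (trans (*-exchange (φ (z k l)) a (E N (single-hit k l))) (cong (a *_) (sym (E-* N (φ (z k l)) (single-hit k l)))))))

-- Cosets from an integer approximant with constant 0

isOne : ℚ → Bool
isOne x = ⌊ x ℚ.≟ 1ℚ ⌋

indicator : CosetSet n → Matrix n
indicator C k l = ⟦ C k l ⟧

record Cosets (n : ℕ) (f : Sym n → ℚ) (t : ℚ) : Set where
  field
    C : CosetSet n
    close : E n (λ π → sq (f π - L (indicator C) π)) ≤ 20510 * t
    few : total (indicator C) ≤ 2 * ι n

-- Here u is the indicator of z = 1. The factor 4 is attained at z = 2; `above` and `below` will
-- bound the mean of the correction by its squared norm.
record Entry (z u : ℚ) : Set where
  field
    error : sq (z - u) ≤ 4 * φ z
    above : z - u ≤ sq (z - u)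
    below : - (z - u) ≤ sq (z - u)
    weight : u ≤ sq z

entry : ∀ {z} → Int z → Entry z ⟦ isOne z ⟧
entry {z} iz = go (z ℚ.≟ 1ℚ)
  where
  self : ∀ x → (x - x) * (x - x) ≡ 0ℚ
  self = solve-∀ R
  lem₁ : ∀ z → 4 * ((z - 1ℚ) * (z - 1ℚ)) ≡ z * z + ((0ℚ - z) * (3 * (0ℚ - z) + 8) + 4)
  lem₁ = solve-∀ R
  lem₂ : ∀ z → 4 * ((z - 1ℚ) * (z - 1ℚ)) ≡ z * z + ((z - (1ℚ + 1)) * (3 * (z - (1ℚ + 1)) + 4))
  lem₂ = solve-∀ R
  lem₃ : ∀ z → 4 * ((z - 0ℚ) * (z - 0ℚ)) ≡ z * z + 3 * (z * z)
  lem₃ = solve-∀ R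
  far : ¬ (z ≡ 1ℚ) → Nearest z → z ≤ 0ℚ ⊎ 1ℚ ≤ z → z ≤ 1ℚ ⊎ 1ℚ + 1 ≤ z → sq z ≤ 4 * φ z
  far _ (_ , inj₁ refl , q) _ _ = by (≥0 {3} ⊡ 0≤sq z) (trans (cong (4 *_) q) (lem₃ z))
  far _ (_ , inj₂ refl , q) (inj₁ z≤0) _ = by (diff z≤0 ⊡ (≥0 {3} ⊡ diff z≤0 ⊞ ≥0 {8}) ⊞ ≥0 {4}) (trans (cong (4 *_) q) (lem₁ z))
  far _ (_ , inj₂ refl , q) _ (inj₂ 2≤z) = by (diff 2≤z ⊡ (≥0 {3} ⊡ diff 2≤z ⊞ ≥0 {4})) (trans (cong (4 *_) q) (lem₂ z))
  far z≢1 (_ , inj₂ refl , q) (inj₂ 1≤z) (inj₁ z≤1) = contradiction (≤-antisym z≤1 1≤z) z≢1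
  go : (d : Dec (z ≡ 1ℚ)) → Entry z ⟦ ⌊ d ⌋ ⟧
  go (yes refl) = record { error = ≥0 ; above = ≥0 ; below = ≥0 ; weight = ≥0-diff }
    where ≥0-diff : 1ℚ ≤ sq 1ℚ
          ≥0-diff = ≤-refl
  go (no z≢1) = record
    { error = subst (λ x → sq x ≤ 4 * φ z) (sym (minus-0 z)) (far z≢1 (φ-attained z) (int-gap iz) (int-gap-at 1ℚ Int1 iz))
    ; above = subst (λ x → x ≤ sq x) (sym (minus-0 z)) (Int-≤sq iz)
    ; below = subst (λ x → - x ≤ sq x) (sym (minus-0 z)) (subst (- z ≤_) (sq-neg z) (Int-≤sq (Int-neg iz)))
    ; weight = 0≤sq z }

module _ {m : ℕ} {f : Sym (suc (suc (suc m))) → ℚ} {p t : ℚ} (mean : E (suc (suc (suc m))) f ≡ p)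
  (small : 1000000000 * t ≤ 1) (0≤t : 0ℚ ≤ t) (f-close : E (suc (suc (suc m))) (φ ∘ f) ≤ t) (A : Approx m f p t) (a₀≡0 : Approx.a₀ A ≡ 0ℚ) where
  open Approx A
  private
    N-1 N : ℕ
    N-1 = suc (suc m)
    N = suc N-1
    a b Z X nh : ℚ
    a = ι N
    b = ι N-1
    Z = total z
    X = 4000 * (p * (1ℚ - p)) + 20
    0<b : 0ℚ < b
    0<b = 0<ι (suc m)
    0≤b : 0ℚ ≤ b
    0≤b = 0≤ι N-1
    nh = no-hit z-Vanishes

    drop-a₀ : ∀ x → a₀ + x ≡ x
    drop-a₀ x = trans (cong (_+ x) a₀≡0) (ℚ.+-identityˡ x)

    cond-mean : ∀ (w : Matrix N) → Vanishes i₀ j₀ w → b * E N-1 (λ σ → L w (ins i₀ j₀ σ)) ≡ total w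
    cond-mean w v = trans (cong (b *_) (E-cong N-1 λ σ _ → L-ins v σ)) (trans (E-L (minor i₀ j₀ w)) (total-minor v))

    g W : Sym N-1 → ℚ
    g σ = L z (ins i₀ j₀ σ)
    W σ = L (λ k l → sq (z k l)) (ins i₀ j₀ σ)

    -- `no-hit-bound` is integrated over the permutations with i₀ ↦ j₀ and multiplied by b.
    averaged : 2 * b ≤ 2 * (b * nh) + N₂ z + Z + 36 * (b * t)
    averaged = ≤-trans (≤-trans (≡⇒≤ (ℚ.*-comm 2 b)) (*-monoˡ 0≤b integrated)) (≡⇒≤ (trans (lem b nh (E N-1 W) (E N-1 g) t)
        (cong₂ (λ x y → 2 * (b * nh) + x + y + 36 * (b * t)) (cond-mean (λ k l → sq (z k l)) (Vanishes-map z-Vanishes sq refl)) (cond-mean z z-Vanishes))))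
      where
      lem : ∀ b h x y t → b * (2 * h + x + y + 2 * (18 * t)) ≡ 2 * (b * h) + b * x + b * y + 36 * (b * t)
      lem = solve-∀ R
      φ-bound : E N-1 (φ ∘ g) ≤ 18 * t
      φ-bound = subst (_≤ 18 * t) (E-cong N-1 λ σ _ → cong φ (drop-a₀ (g σ))) conditional
      integrated : 2 ≤ 2 * nh + E N-1 W + E N-1 g + 2 * (18 * t)
      integrated = ≤-trans (≡⇒≤ (sym (E-const N-1 2))) (≤-trans (E-mono N-1 λ σ _ → no-hit-bound (λ k → z k (ins i₀ j₀ σ k)) (λ k → z-Int k (ins i₀ j₀ σ k)))
        (E-+-≤ N-1 (E-+-≤ N-1 (E-+-≤ N-1 (E-*-≤ N-1 2 ≥0 ≤-refl) ≤-refl) ≤-refl) (E-*-≤ N-1 2 ≥0 φ-bound)))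

    T-bound : 1000 * Z ≤ a * (1000 * p + 10)
    T-bound = total-above mean small 0≤t A a₀≡0

    -- Dividing `averaged` by b gives 2·nh ≥ 2 - 4p(1 - p) - (a/b)p up to small terms. With a/b ≤
    -- 3/2 the subtracted part is at most 121/64, at p = 11/16. Replacing a/b by 3/2 requires the
    -- upper bound on Z to be nonnegative, hence the split on the sign of Z.
    1≤32nh : 1 ≤ 32 * nh
    1≤32nh = *-cancelˡ-≤ (2000 * b) (>0 {2000} ⊡< 0<b) (go (ℚ.≤-total 0ℚ Z))
      where
      lem₋ : ∀ b h n Z p t → 2000 * b * (32 * h) ≡ 2000 * b * 1 + (32000 * (2 * (b * h) + n + Z + 36 * (b * t) - 2 * b) + 32 * (b * (4000 * (p * (1ℚ - p)) + 20) - 1000 * n) + 32000 * (0ℚ - Z)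
        + b * (32000 * ((2 * p - 1ℚ) * (2 * p - 1ℚ)) + (1 - 1000000000 * t) + 29359 + 998848000 * t))
      lem₋ = solve-∀ R
      lem₊ : ∀ i h n Z p t → 2000 * (2 + i) * (32 * h) ≡ 2000 * (2 + i) * 1 + (32000 * (2 * ((2 + i) * h) + n + Z + 36 * ((2 + i) * t) - 2 * (2 + i)) + 32 * ((2 + i) * (4000 * (p * (1ℚ - p)) + 20) - 1000 * n)
        + 32 * ((3 + i) * (1000 * p + 10) - 1000 * Z) + 16 * i * (1000 * p + 10 - 0ℚ)
        + (2 + i) * (500 * ((16 * p - 11) * (16 * p - 11)) + (1 - 1000000000 * t) + 379 + 998848000 * t))
      lem₊ = solve-∀ R
      lem₊′ : ∀ a b h n Z p t → b ≡ 2 + ι m → a ≡ 3 + ι m → 2000 * b * (32 * h) ≡ 2000 * b * 1 + (32000 * (2 * (b * h) + n + Z + 36 * (b * t) - 2 * b) + 32 * (b * (4000 * (p * (1ℚ - p)) + 20) - 1000 * n)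
        + 32 * (a * (1000 * p + 10) - 1000 * Z) + 16 * ι m * (1000 * p + 10 - 0ℚ)
        + b * (500 * ((16 * p - 11) * (16 * p - 11)) + (1 - 1000000000 * t) + 379 + 998848000 * t))
      lem₊′ _ _ h n Z p t refl refl = lem₊ (ι m) h n Z p t
      go : 0ℚ ≤ Z ⊎ Z ≤ 0ℚ → 2000 * b * 1 ≤ 2000 * b * (32 * nh)
      go (inj₂ T≤0) = by (≥0 {32000} ⊡ diff averaged ⊞ ≥0 {32} ⊡ diff size ⊞ ≥0 {32000} ⊡ diff T≤0 ⊞ 0≤b ⊡ (≥0 {32000} ⊡ 0≤sq (2 * p - 1ℚ) ⊞ diff small ⊞ ≥0 {29359} ⊞ ≥0 {998848000} ⊡ 0≤t))
        (lem₋ b nh (N₂ z) Z p t)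
      go (inj₁ 0≤T) = by (≥0 {32000} ⊡ diff averaged ⊞ ≥0 {32} ⊡ diff size ⊞ ≥0 {32} ⊡ diff T-bound ⊞ ≥0 {16} ⊡ 0≤ι m ⊡ diff p-nonneg
          ⊞ 0≤b ⊡ (≥0 {500} ⊡ 0≤sq (16 * p - 11) ⊞ diff small ⊞ ≥0 {379} ⊞ ≥0 {998848000} ⊡ 0≤t))
        (lem₊′ a b nh (N₂ z) Z p t (ι-2+ m) (ι-3+ m))
        where
        p-nonneg : 0ℚ ≤ 1000 * p + 10
        p-nonneg = *-cancelˡ-≤ a (0<ι N-1) (≤-trans (≡⇒≤ (ℚ.*-zeroʳ a)) (≤-trans (≥0 {1000} ⊡ 0≤T) T-bound))

    Φ : ℚ
    Φ = ∑ (λ k → ∑ (λ l → φ (z k l)))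
    0≤Φ : 0ℚ ≤ Φ
    0≤Φ = ∑∑-nonneg λ k l → 0≤φ (z k l)

    near′ : E N (λ π → sq (L z π - f π)) ≤ 15 * t
    near′ = subst (_≤ 15 * t) (E-cong N λ π _ → trans (cong (λ x → sq (f π - x)) (drop-a₀ (L z π))) (sq-swap (f π) (L z π))) near

    φ-Lz : E N (φ ∘ L z) ≤ 32 * t
    φ-Lz = ≤-trans (E-mono N λ π _ → φ-perturb (L z π) (f π)) (≤-trans (E-+-≤ N (E-*-≤ N 2 ≥0 f-close) (E-*-≤ N 2 ≥0 near′)) (≡⇒≤ (lem t)))
      where lem : ∀ t → 2 * t + 2 * (15 * t) ≡ 32 * t
            lem = solve-∀ R

    Φ-bound : Φ ≤ 1024 * (a * t)
    Φ-bound = by (≥0 {32} ⊡ diff (∑-φ-bound z-Vanishes) ⊞ ≥0 {32} ⊡ 0≤ι N ⊡ diff φ-Lz ⊞ diff 1≤32nh ⊡ 0≤Φ) (lem nh Φ a t (E N (φ ∘ L z)))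
      where lem : ∀ h Φ a t x → 1024 * (a * t) ≡ Φ + (32 * (a * x - h * Φ) + 32 * a * (32 * t - x) + (32 * h - 1) * Φ)
            lem = solve-∀ R

    C : CosetSet N
    C k l = isOne (z k l)
    bad : Matrix N
    bad k l = z k l - indicator C k l
    entries : ∀ k l → Entry (z k l) (indicator C k l)
    entries k l = entry (z-Int k l)
    y : ℚ
    y = proj₁ (quotient N-1 (total bad))
    ay : a * y ≡ total bad
    ay = proj₂ (quotient N-1 (total bad))

    N₂-bad : N₂ bad ≤ 4096 * (a * t)
    N₂-bad = ≤-trans (∑∑-mono λ k l → Entry.error (entries k l)) (≤-trans (≡⇒≤ (∑∑-* 4 _))
      (by (≥0 {4} ⊡ diff Φ-bound) (lem Φ (a * t))))
      where lem : ∀ x y → 4096 * y ≡ 4 * x + 4 * (1024 * y - x)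
            lem = solve-∀ R

    y-above : y ≤ 4096 * t
    y-above = *-cancelˡ-≤ a (0<ι N-1) (≤-trans (≡⇒≤ ay) (≤-trans (∑∑-mono λ k l → Entry.above (entries k l)) (≤-trans N₂-bad (≡⇒≤ (lem a t)))))
      where lem : ∀ a t → 4096 * (a * t) ≡ a * (4096 * t)
            lem = solve-∀ R

    y-below : - y ≤ 4096 * t
    y-below = *-cancelˡ-≤ a (0<ι N-1) (≤-trans (≡⇒≤ (trans (lem₁ a y) (cong -_ ay))) (≤-trans
      (subst (_≤ N₂ bad) (trans (∑-cong λ k → ∑-neg (bad k)) (∑-neg (row bad))) (∑∑-mono λ k l → Entry.below (entries k l))) (≤-trans N₂-bad (≡⇒≤ (lem a t)))))
      where lem : ∀ a t → 4096 * (a * t) ≡ a * (4096 * t)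
            lem = solve-∀ R
            lem₁ : ∀ a y → a * - y ≡ - (a * y)
            lem₁ = solve-∀ R

    -- Integer entries give |y| ≤ 4096t, and one factor 4096t of the square is below 1.
    y² : sq y ≤ 4096 * t
    y² = by (diff y-above ⊡ diff y-below ⊞ ≥0 {4096} ⊡ 0≤t ⊡ (diff small ⊞ ≥0 {999995904} ⊡ 0≤t)) (lem y t)
      where lem : ∀ y t → 4096 * t ≡ y * y + ((4096 * t - y) * (4096 * t - - y) + 4096 * t * (1 - 1000000000 * t + 999995904 * t))
            lem = solve-∀ R

    bad-small : E N (sq ∘ L bad) ≤ 10240 * t
    bad-small = ≤-trans (≡⇒≤ (trans (E-cong N λ π _ → cong sq (split-at (L bad π) y)) (E-shift (L bad) (mean-L bad ay) y)))
      (≤-trans (ℚ.+-mono-≤ y² spread) (≡⇒≤ (lem₁ t)))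
      where
      lem₁ : ∀ t → 4096 * t + 6144 * t ≡ 10240 * t
      lem₁ = solve-∀ R
      lem₂ : ∀ a b t → a ≡ 3 + ι m → b ≡ 2 + ι m → b * (6144 * t) ≡ 4096 * (a * t) + 2048 * ι m * t
      lem₂ _ _ t refl refl = alg (ι m) t
        where alg : ∀ i t → (2 + i) * (6144 * t) ≡ 4096 * ((3 + i) * t) + 2048 * i * t
              alg = solve-∀ R
      -- 6144 is 4096 · 3/2, because a ≤ (3/2)b from three rows on.
      spread : E N (λ π → sq (L bad π - y)) ≤ 6144 * t
      spread = *-cancelˡ-≤ b 0<b (≤-trans (variance-bound bad ay) (≤-trans N₂-bad (by (≥0 {2048} ⊡ 0≤ι m ⊡ 0≤t) (lem₂ a b t (ι-3+ m) (ι-2+ m)))))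

  cosets : Cosets N f t
  cosets = record { C = C ; close = close ; few = few }
    where
    close : E N (λ π → sq (f π - L (indicator C) π)) ≤ 20510 * t
    close = ≤-trans (E-mono N λ π _ → point π) (≤-trans (E-+-≤ N (E-*-≤ N 2 ≥0 near′) (E-*-≤ N 2 ≥0 bad-small)) (≡⇒≤ (lem t)))
      where
      lem : ∀ t → 2 * (15 * t) + 2 * (10240 * t) ≡ 20510 * t
      lem = solve-∀ R
      lem₁ : ∀ f z u → 2 * ((z - f) * (z - f)) + 2 * ((z - u) * (z - u)) ≡ (f - u) * (f - u) + (z - f + (z - u)) * (z - f + (z - u))
      lem₁ = solve-∀ R
      L-bad : ∀ π → L bad π ≡ L z π - L (indicator C) π
      L-bad π = ∑-- (λ k → z k (π k)) (λ k → indicator C k (π k))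
      point : ∀ π → sq (f π - L (indicator C) π) ≤ 2 * sq (L z π - f π) + 2 * sq (L bad π)
      point π = by (0≤sq (L z π - f π + (L z π - L (indicator C) π))) (trans (cong (λ x → 2 * sq (L z π - f π) + 2 * sq x) (L-bad π)) (lem₁ (f π) (L z π) (L (indicator C) π)))
    few : total (indicator C) ≤ 2 * a
    few = *-cancelˡ-≤ 1000 (>0 {1000}) (≤-trans (*-monoˡ (≥0 {1000}) (∑∑-mono λ k l → Entry.weight (entries k l)))
      (≤-trans size (by (0≤b ⊡ (≥0 {1000} ⊡ 0≤sq (2 * p - 1ℚ) ⊞ ≥0 {980}) ⊞ ≥0 {2000}) (lem a b p (ι-suc N-1)))))
      where
      alg : ∀ b p → 1000 * (2 * (1 + b)) ≡ b * (4000 * (p * (1ℚ - p)) + 20) + (b * (1000 * ((2 * p - 1ℚ) * (2 * p - 1ℚ)) + 980) + 2000)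
      alg = solve-∀ R
      lem : ∀ a b p → a ≡ 1 + b → 1000 * (2 * a) ≡ b * (4000 * (p * (1ℚ - p)) + 20) + (b * (1000 * ((2 * p - 1ℚ) * (2 * p - 1ℚ)) + 980) + 2000)
      lem _ b p refl = alg b p

-- Counting cosets and non-disjoint pairs

ι-foldr : ∀ (xs : List A) (f : A → ℕ) → ι (Data.List.foldr ℕ._+_ 0 (map f xs)) ≡ S xs (ι ∘ f)
ι-foldr []       f = ι-0
ι-foldr (x ∷ xs) f = trans (ι-+ (f x) _) (cong (ι (f x) +_) (ι-foldr xs f))

ι-foldr-Fin : ∀ (f : Fin n → ℕ) → ι (Data.List.foldr ℕ._+_ 0 (map f (allFin n))) ≡ ∑ (ι ∘ f)
ι-foldr-Fin {n} f = trans (ι-foldr (allFin n) f) (∑-def (ι ∘ f))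

ι-countᵇ : ∀ (p : A → Bool) xs → ι (countᵇ p xs) ≡ S xs (λ a → ⟦ p a ⟧)
ι-countᵇ p [] = ι-0
ι-countᵇ p (x ∷ xs) with p x
... | true  = trans (ι-suc _) (cong (1 +_) (ι-countᵇ p xs))
... | false = trans (ι-countᵇ p xs) (sym (ℚ.+-identityˡ _))

⟦∧⟧ : ∀ p q → ⟦ p ∧ q ⟧ ≡ ⟦ p ⟧ * ⟦ q ⟧
⟦∧⟧ true  q = sym (ℚ.*-identityˡ ⟦ q ⟧)
⟦∧⟧ false q = sym (ℚ.*-zeroˡ ⟦ q ⟧)

⟦not⟧ : ∀ p → ⟦ not p ⟧ ≡ 1ℚ - ⟦ p ⟧
⟦not⟧ true  = refl
⟦not⟧ false = refl

⟦⟧-idem : ∀ p → ⟦ p ⟧ * ⟦ p ⟧ ≡ ⟦ p ⟧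
⟦⟧-idem true  = refl
⟦⟧-idem false = refl

0≤⟦⟧ : ∀ p → 0ℚ ≤ ⟦ p ⟧
0≤⟦⟧ true  = ≥0
0≤⟦⟧ false = ≥0

⟦⟧≤1 : ∀ p → ⟦ p ⟧ ≤ 1ℚ
⟦⟧≤1 true  = ≤-refl
⟦⟧≤1 false = ≥0

⟦⟧-Int : ∀ p → Int ⟦ p ⟧
⟦⟧-Int true  = Int1
⟦⟧-Int false = Int0

card-total : ∀ (C : CosetSet n) → ι (card n C) ≡ total (indicator C)
card-total {n} C = trans (ι-foldr-Fin _) (∑-cong λ i → trans (ι-countᵇ (λ j → C i j) (allFin n)) (∑-def _))

before : Fin n → Fin n → ℚ
before i k = ⟦ ⌊ i Fin.<? k ⌋ ⟧

trichotomy : ∀ (i k : Fin n) → before i k + before k i ≡ 1ℚ - δ i k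
trichotomy i k = go (i Fin.<? k) (k Fin.<? i) (i ≟F k)
  where
  go : (p : Dec (i Fin.< k)) (q : Dec (k Fin.< i)) (s : Dec (i ≡ k)) → ⟦ ⌊ p ⌋ ⟧ + ⟦ ⌊ q ⌋ ⟧ ≡ 1ℚ - ⟦ ⌊ s ⌋ ⟧
  go (yes p) (yes q) _ = contradiction q (ℕ.<-asym p)
  go (yes p) (no _) (yes refl) = contradiction p (ℕ.<-irrefl refl)
  go (yes _) (no _) (no _) = refl
  go (no _) (yes q) (yes refl) = contradiction q (ℕ.<-irrefl refl)
  go (no _) (yes _) (no _) = refl
  go (no _) (no _) (yes _) = refl
  go (no p) (no q) (no s) = contradiction (toℕ-injective (ℕ.≤-antisym (ℕ.≮⇒≥ q) (ℕ.≮⇒≥ p))) s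

module _ {n : ℕ} (C : CosetSet n) where
  private
    u : Matrix n
    u = indicator C

  -- Twice the number of non-disjoint pairs.
  P : ℚ
  P = sq (total u) - R₂ u - C₂ u + total u

  -- For i ≠ k, the number of non-disjoint pairs with one coset in row i and the other in row k.
  meets : Fin n → Fin n → ℚ
  meets i k = row u i * row u k - ∑ (λ j → u i j * u k j)

  private
    meets-sym : ∀ i k → meets i k ≡ meets k i
    meets-sym i k = cong₂ _-_ (ℚ.*-comm (row u i) (row u k)) (∑-cong λ j → ℚ.*-comm (u i j) (u k j))

    meets-diag : ∀ i → meets i i ≡ sq (row u i) - row u i
    meets-diag i = cong (λ x → sq (row u i) - x) (∑-cong λ j → ⟦⟧-idem (C i j))

  P-meets : P ≡ ∑ (λ i → ∑ (λ k → meets i k)) - ∑ (λ i → meets i i)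
  P-meets = begin
    sq (total u) - R₂ u - C₂ u + total u
      ≡⟨ lem (sq (total u)) (R₂ u) (C₂ u) (total u) ⟩
    sq (total u) - C₂ u - (R₂ u - total u)
      ≡⟨ cong₂ _-_ (sym all) (sym (trans (∑-cong meets-diag) (∑-- (λ i → sq (row u i)) (row u)))) ⟩
    ∑ (λ i → ∑ (λ k → meets i k)) - ∑ (λ i → meets i i) ∎
    where
    open ≡-Reasoning
    lem : ∀ t r c x → t - r - c + x ≡ t - c - (r - x)
    lem = solve-∀ R
    swapped : ∑ (λ i → ∑ (λ k → ∑ (λ j → u i j * u k j))) ≡ C₂ u
    swapped = trans (∑-cong λ i → ∑-swap (λ k j → u i j * u k j))
      (trans (∑-swap (λ i j → ∑ (λ k → u i j * u k j))) (∑-cong λ j → sym (∑-prod (λ i → u i j) (λ k → u k j))))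
    all : ∑ (λ i → ∑ (λ k → meets i k)) ≡ sq (total u) - C₂ u
    all = trans (∑-cong λ i → ∑-- (λ k → row u i * row u k) (λ k → ∑ (λ j → u i j * u k j)))
      (trans (∑-- _ _) (cong₂ _-_ (sym (∑-prod (row u) (row u))) swapped))

  private
    pairs-sum : ι (nonDisjointPairs n C) ≡ ∑ (λ i → ∑ (λ k → before i k * meets i k))
    pairs-sum = trans (ι-foldr-Fin _) (∑-cong λ i → trans (ι-foldr-Fin _) (trans (∑-cong λ j → trans (ι-foldr-Fin _)
        (∑-cong λ k → trans (ι-countᵇ (λ l → C i j ∧ C k l ∧ ⌊ i Fin.<? k ⌋ ∧ not ⌊ j ≟F l ⌋) (allFin n)) (trans (∑-def _) (inner i j k))))
      (trans (∑-swap _) (∑-cong λ k → outer i k))))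
      where
      open ≡-Reasoning
      lem : ∀ x y b d → x * (y * (b * (1ℚ - d))) ≡ b * (x * y) - b * (x * (d * y))
      lem = solve-∀ R
      cell : ∀ i j k l → ⟦ C i j ∧ C k l ∧ ⌊ i Fin.<? k ⌋ ∧ not ⌊ j ≟F l ⌋ ⟧ ≡ before i k * (u i j * u k l) - before i k * (u i j * (δ j l * u k l))
      cell i j k l = trans (trans (⟦∧⟧ (C i j) _) (cong (u i j *_) (trans (⟦∧⟧ (C k l) _) (cong (u k l *_) (trans (⟦∧⟧ ⌊ i Fin.<? k ⌋ _) (cong (before i k *_) (⟦not⟧ ⌊ j ≟F l ⌋)))))))
        (lem (u i j) (u k l) (before i k) (δ j l))
      inner : ∀ i j k → ∑ (λ l → ⟦ C i j ∧ C k l ∧ ⌊ i Fin.<? k ⌋ ∧ not ⌊ j ≟F l ⌋ ⟧) ≡ before i k * (u i j * row u k - u i j * u k j)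
      inner i j k = trans (∑-cong λ l → cell i j k l) (trans (∑-- _ _) (trans (cong₂ _-_
          (trans (∑-* (before i k) _) (cong (before i k *_) (∑-* (u i j) (u k))))
          (trans (∑-* (before i k) _) (cong (before i k *_) (trans (∑-* (u i j) _) (cong (u i j *_) (∑-δ j (u k)))))))
        (lem′ (before i k) (u i j * row u k) (u i j * u k j))))
        where lem′ : ∀ b x y → b * x - b * y ≡ b * (x - y)
              lem′ = solve-∀ R
      outer : ∀ i k → ∑ (λ j → before i k * (u i j * row u k - u i j * u k j)) ≡ before i k * meets i k
      outer i k = trans (∑-* (before i k) _) (cong (before i k *_) (trans (∑-- _ _) (cong (_- ∑ (λ j → u i j * u k j)) (∑-*ʳ (row u k) (u i)))))

  -- Adding the sum to its mirror image replaces `before` by the condition i ≠ k, so every unordered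
  -- pair is counted in both orders.
  pairs-P : 2 * ι (nonDisjointPairs n C) ≡ P
  pairs-P = begin
    2 * ι (nonDisjointPairs n C)
      ≡⟨ trans (cong (2 *_) pairs-sum) (two (∑ (λ i → ∑ (λ k → before i k * meets i k)))) ⟩
    ∑ (λ i → ∑ (λ k → before i k * meets i k)) + ∑ (λ i → ∑ (λ k → before i k * meets i k))
      ≡⟨ cong (∑ (λ i → ∑ (λ k → before i k * meets i k)) +_) (trans (∑-swap _) (∑-cong λ k → ∑-cong λ i → cong (before i k *_) (meets-sym i k))) ⟩
    ∑ (λ i → ∑ (λ k → before i k * meets i k)) + ∑ (λ i → ∑ (λ k → before k i * meets i k))
      ≡⟨ sym (trans (∑-cong λ i → ∑-+ _ _) (∑-+ _ _)) ⟩
    ∑ (λ i → ∑ (λ k → before i k * meets i k + before k i * meets i k))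
      ≡⟨ ∑-cong (λ i → trans (∑-cong λ k → cell i k) (trans (∑-- _ _) (cong (λ x → ∑ (meets i) - x) (∑-δ i (meets i))))) ⟩
    ∑ (λ i → ∑ (λ k → meets i k) - meets i i)
      ≡⟨ trans (∑-- _ _) (sym P-meets) ⟩
    P ∎
    where
    open ≡-Reasoning
    two : ∀ x → 2 * x ≡ x + x
    two = solve-∀ R
    lem : ∀ x y t → x * t + y * t ≡ (x + y) * t
    lem = solve-∀ R
    lem′ : ∀ d t → (1ℚ - d) * t ≡ t - d * t
    lem′ = solve-∀ R
    cell : ∀ i k → before i k * meets i k + before k i * meets i k ≡ meets i k - δ i k * meets i k
    cell i k = trans (lem (before i k) (before k i) (meets i k)) (trans (cong (_* meets i k) (trichotomy i k)) (lem′ (δ i k) (meets i k)))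

indicator-idem : ∀ (C : CosetSet n) → N₂ (indicator C) ≡ total (indicator C)
indicator-idem C = ∑-cong λ i → ∑-cong λ j → ⟦⟧-idem (C i j)

indicator-Int : ∀ (C : CosetSet n) π → Int (L (indicator C) π)
indicator-Int C π = ∑-Int λ i → ⟦⟧-Int (C i (π i))

-- h² - h counts the ordered pairs of distinct cosets of C that contain π. Distinct cosets share a
-- permutation exactly when they are non-disjoint, and then with probability 1/(ab).
E-pairs : ∀ (C : CosetSet (suc (suc n))) → ι (suc (suc n)) * ι (suc n) * E (suc (suc n)) (λ π → sq (L (indicator C) π) - L (indicator C) π) ≡ P C
E-pairs {n} C = begin
  a * b * E N (λ π → sq (L u π) - L u π) ≡⟨ cong (a * b *_) (E-- N (sq ∘ L u) (L u)) ⟩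
  a * b * (E N (sq ∘ L u) - E N (L u)) ≡⟨ lem₁ a b (E N (sq ∘ L u)) (E N (L u)) ⟩
  a * b * E N (sq ∘ L u) - b * (a * E N (L u)) ≡⟨ cong₂ (λ x y → x - b * y) (trans (E-L² u) (cong (λ x → a * x + sq (total u) - R₂ u - C₂ u) (indicator-idem C))) (E-L u) ⟩
  a * total u + sq (total u) - R₂ u - C₂ u - b * total u ≡⟨ lem₂ a b (total u) (R₂ u) (C₂ u) (ι-suc (suc n)) ⟩
  P C ∎
  where
  open ≡-Reasoning
  N : ℕ
  N = suc (suc n)
  u : Matrix N
  u = indicator C
  a b : ℚ
  a = ι N
  b = ι (suc n)
  lem₁ : ∀ a b x y → a * b * (x - y) ≡ a * b * x - b * (a * y)
  lem₁ = solve-∀ R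
  alg : ∀ b t r c → (1 + b) * t + t * t - r - c - b * t ≡ t * t - r - c + t
  alg = solve-∀ R
  lem₂ : ∀ a b t r c → a ≡ 1 + b → a * t + t * t - r - c - b * t ≡ t * t - r - c + t
  lem₂ _ b t r c refl = alg b t r c

φ≤pairs : ∀ {h} → Int h → φ h ≤ sq h - h
φ≤pairs {h} ih = go (int-gap ih)
  where
  lem₀ : ∀ h → h * h - h ≡ (h - 0ℚ) * (h - 0ℚ) + (0ℚ - h)
  lem₀ = solve-∀ R
  lem₁ : ∀ h → h * h - h ≡ (h - 1ℚ) * (h - 1ℚ) + (h - 1ℚ)
  lem₁ = solve-∀ R
  go : h ≤ 0ℚ ⊎ 1ℚ ≤ h → φ h ≤ sq h - h
  go (inj₁ p) = ≤-trans (φ-min h (inj₁ refl)) (by (diff p) (lem₀ h))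
  go (inj₂ p) = ≤-trans (φ-min h (inj₂ refl)) (by (diff p) (lem₁ h))

pairs≤φ : ∀ {h} → Int h → sq h - h ≤ 2 * φ h
pairs≤φ {h} ih = go (φ-attained h)
  where
  lem₀ : ∀ h → 2 * ((h - 0ℚ) * (h - 0ℚ)) ≡ h * h - h + ((- h) * (- h) - - h)
  lem₀ = solve-∀ R
  lem₁ : ∀ h → 2 * ((h - 1ℚ) * (h - 1ℚ)) ≡ h * h - h + ((h - 1ℚ) * (h - 1ℚ) - (h - 1ℚ) )
  lem₁ = solve-∀ R
  go : Nearest h → sq h - h ≤ 2 * φ h
  go (_ , inj₁ refl , q) = by (diff (Int-≤sq (Int-neg ih))) (trans (cong (2 *_) q) (lem₀ h))
  go (_ , inj₂ refl , q) = by (diff (Int-≤sq (Int-- ih Int1))) (trans (cong (2 *_) q) (lem₁ h))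

module _ {n : ℕ} (C : CosetSet (suc n)) where
  private
    u : Matrix (suc n)
    u = indicator C

  0≤meets : ∀ i k → 0ℚ ≤ meets C i k
  0≤meets i k = subst (0ℚ ≤_) (trans (∑-cong λ j → lem (u i j) (u k j) (row u k)) (trans (∑-- _ _) (cong (_- ∑ (λ j → u i j * u k j)) (∑-*ʳ (row u k) (u i)))))
    (∑-nonneg λ j → 0≤⟦⟧ (C i j) ⊡ diff (∑-≥-term (u k) (λ l → 0≤⟦⟧ (C k l)) j))
    where lem : ∀ x y r → x * (r - y) ≡ x * r - x * y
          lem = solve-∀ R

  meets-≥ : ∀ i k → (row u i - 1ℚ) * row u k ≤ meets C i k
  meets-≥ i k = subst₂ _≤_ (∑-* (row u i - 1ℚ) (u k)) (trans (∑-cong λ l → lem (row u i) (u i l) (u k l)) (trans (∑-- _ _) (cong (_- ∑ (λ j → u i j * u k j)) (∑-* (row u i) (u k)))))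
    (∑-mono λ l → by (0≤⟦⟧ (C k l) ⊡ diff (⟦⟧≤1 (C i l))) (lem′ (row u i) (u i l) (u k l)))
    where lem : ∀ r x y → y * (r - x) ≡ r * y - x * y
          lem = solve-∀ R
          lem′ : ∀ r x y → y * (r - x) ≡ (r - 1ℚ) * y + y * (1ℚ - x)
          lem′ = solve-∀ R

  -- Each coset outside row i is disjoint from at most one coset of that row.
  line-bound : ∀ i → (row u i - 1ℚ) * (total u - row u i) ≤ P C
  line-bound i = begin
    (row u i - 1ℚ) * (total u - row u i) ≡⟨ cong ((row u i - 1ℚ) *_) (trans (cong (_- row u i) (∑-punch i (row u))) (lem (row u i) (∑ (row u ∘ punchIn i)))) ⟩
    (row u i - 1ℚ) * ∑ (row u ∘ punchIn i) ≡⟨ sym (∑-* (row u i - 1ℚ) _) ⟩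
    ∑ (λ k → (row u i - 1ℚ) * row u (punchIn i k)) ≤⟨ ∑-mono (λ k → meets-≥ i (punchIn i k)) ⟩
    ∑ (λ k → meets C i (punchIn i k)) ≤⟨ ∑-≥-term (λ i → ∑ (λ k → meets C i (punchIn i k))) (λ i → ∑-nonneg λ k → 0≤meets i (punchIn i k)) i ⟩
    ∑ (λ i → ∑ (λ k → meets C i (punchIn i k))) ≡⟨ ∑-cong (λ i → trans (lem′ (meets C i i) _) (cong (_- meets C i i) (sym (∑-punch i (meets C i))))) ⟩
    ∑ (λ i → ∑ (meets C i) - meets C i i) ≡⟨ trans (∑-- _ _) (sym (P-meets C)) ⟩
    P C ∎
    where
    open ℚ.≤-Reasoning
    lem : ∀ x y → x + y - x ≡ y
    lem = solve-∀ R
    lem′ : ∀ x y → y ≡ x + y - x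
    lem′ = solve-∀ R

argmax : ∀ (g : Fin (suc n) → ℚ) → ∃ λ m → ∀ i → g i ≤ g m
argmax {zero} g = zero , λ { zero → ≤-refl }
argmax {suc n} g = choose (argmax (g ∘ suc))
  where
  choose : (∃ λ m → ∀ i → g (suc i) ≤ g (suc m)) → ∃ λ m → ∀ i → g i ≤ g m
  choose (m , mx) = pick-larger (ℚ.≤-total (g zero) (g (suc m)))
    where
    pick-larger : g zero ≤ g (suc m) ⊎ g (suc m) ≤ g zero → ∃ λ m → ∀ i → g i ≤ g m
    pick-larger (inj₁ p) = suc m , λ { zero → p ; (suc i) → mx i }
    pick-larger (inj₂ p) = zero , λ { zero → ≤-refl ; (suc i) → ≤-trans (mx i) p }

∑-sq-≤-max : ∀ (g : Fin n → ℚ) → (∀ i → 0ℚ ≤ g i) → ∀ M → (∀ i → g i ≤ M) → ∑ (sq ∘ g) ≤ M * ∑ g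
∑-sq-≤-max g nn M mx = ≤-trans (∑-mono λ i → ℚ.*-monoʳ-≤-nonNeg (g i) {{ℚ.nonNegative (nn i)}} (mx i)) (≡⇒≤ (∑-* M g))

-- Transposition carries the bound for a row over to a column.
flip-set : CosetSet n → CosetSet n
flip-set C i j = C j i

P-flip : ∀ (C : CosetSet n) → P (flip-set C) ≡ P C
P-flip C = trans (cong (λ x → sq x - C₂ u - R₂ u + x) (∑-swap (λ j i → u i j))) (lem (total u) (R₂ u) (C₂ u))
  where
  u : Matrix _
  u = indicator C
  lem : ∀ t r c → t * t - c - r + t ≡ t * t - r - c + t
  lem = solve-∀ R

-- Passing to the complement of a line

record Outcome (n : ℕ) (f : Sym n → ℚ) (t : ℚ) : Set where
  field
    C : CosetSet n
    few : total (indicator C) ≤ 2 * ι n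
    pairs-few : P C ≤ 82044 * t * (ι n * ι n)
    close : E n (λ π → sq (f π - L (indicator C) π)) ≤ 6604540 * t

module _ {m : ℕ} where
  private
    N-1 N : ℕ
    N-1 = suc (suc m)
    N = suc N-1
    a b : ℚ
    a = ι N
    b = ι N-1
    0<b : 0ℚ < b
    0<b = 0<ι (suc m)
    0<a : 0ℚ < a
    0<a = 0<ι N-1

  cosets-pairs : ∀ {f t} → E N (φ ∘ f) ≤ t → (K : Cosets N f t) → P (Cosets.C K) ≤ 82044 * t * (a * b)
  cosets-pairs {f} {t} f-close K = ≤-trans (≡⇒≤ (sym (E-pairs C))) (≤-trans (*-monoˡ (0≤ι N ⊡ 0≤ι N-1) energy) (≡⇒≤ (lem₂ a b t)))
    where
    open Cosets K
    h : Sym N → ℚ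
    h = L (indicator C)
    lem₁ : ∀ t → 2 * (2 * t + 2 * (20510 * t)) ≡ 82044 * t
    lem₁ = solve-∀ R
    lem₂ : ∀ a b t → a * b * (82044 * t) ≡ 82044 * t * (a * b)
    lem₂ = solve-∀ R
    energy : E N (λ π → sq (h π) - h π) ≤ 82044 * t
    energy = ≤-trans (E-mono N λ π _ → pairs≤φ (indicator-Int C π)) (≤-trans (E-*-≤ N 2 ≥0 (≤-trans (E-mono N λ π _ → φ-perturb (h π) (f π))
      (E-+-≤ N (E-*-≤ N 2 ≥0 f-close) (E-*-≤ N 2 ≥0 (subst (_≤ 20510 * t) (E-cong N λ π _ → sq-swap (f π) (h π)) close))))) (≡⇒≤ (lem₁ t)))

  direct : ∀ {f t} → 0ℚ ≤ t → E N (φ ∘ f) ≤ t → Cosets N f t → Outcome N f t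
  direct {f} {t} 0≤t f-close K = record
    { C = C ; few = few
    ; pairs-few = ≤-trans (cosets-pairs f-close K) (by (≥0 {82044} ⊡ 0≤t ⊡ 0≤ι N) (trans (cong (λ x → 82044 * t * (a * x)) (ι-suc N-1)) (lem a b t)))
    ; close = ≤-trans close (by (≥0 {6584030} ⊡ 0≤t) (lem′ t)) }
    where
    open Cosets K
    lem : ∀ a b t → 82044 * t * (a * (1 + b)) ≡ 82044 * t * (a * b) + 82044 * t * a
    lem = solve-∀ R
    lem′ : ∀ t → 6604540 * t ≡ 20510 * t + 6584030 * t
    lem′ = solve-∀ R

  module _ {f : Sym N → ℚ} {t : ℚ} (small : 1000000000 * t ≤ 1) (0≤t : 0ℚ ≤ t) (f-close : E N (φ ∘ f) ≤ t) (half : E N f ≤ ½)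
    (K : Cosets N (λ π → 1ℚ - f π) t) where
    open Cosets K
    private
      u : Matrix N
      u = indicator C
      U κ : ℚ
      U = total u
      κ = 82044 * t
      0≤κ : 0ℚ ≤ κ
      0≤κ = ≥0 {82044} ⊡ 0≤t
      P≤ : P C ≤ κ * (a * b)
      P≤ = cosets-pairs (subst (_≤ t) (E-cong N λ π _ → sym (φ-complement (f π))) f-close) K
      y : ℚ
      y = proj₁ (quotient N-1 U)
      ay : a * y ≡ U
      ay = proj₂ (quotient N-1 U)
      -- The hypothesis E[f] ≤ ½ enters here: the mean y of the cosets falls short of 1 - E[f] by at
      -- most 1/100.
      many : 49 * a ≤ 100 * U
      many = subst (49 * a ≤_) (trans (lem a y) (cong (100 *_) ay)) (by (0≤ι N ⊡ (diff y-large)) (lem′ a y))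
        where
        lem : ∀ a y → a * (100 * y) ≡ 100 * (a * y)
        lem = solve-∀ R
        lem′ : ∀ a y → a * (100 * y) ≡ 49 * a + a * (100 * y - 49)
        lem′ = solve-∀ R
        lem₁ : ∀ x t → 1 * 1 ≡ (100 * x) * (100 * x) + (10000 * (20510 * t - x * x) + (1 - 1000000000 * t) + 794900000 * t)
        lem₁ = solve-∀ R
        lem₂ : ∀ p y → 100 * y ≡ 49 + (1 - 100 * (1ℚ - p - y) + 100 * (½ - p))
        lem₂ = solve-∀ R
        gap : 100 * (1ℚ - E N f - y) ≤ 1
        gap = sq≤1⇒≤1 1 ≥0 (by (≥0 {10000} ⊡ diff (subst (λ x → sq x ≤ 20510 * t) gap-mean (≤-trans (E-sq-≤ N (λ π → 1ℚ - f π - L u π)) close)) ⊞ diff small ⊞ ≥0 {794900000} ⊡ 0≤t) (lem₁ (1ℚ - E N f - y) t))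
          where
          gap-mean : E N (λ π → 1ℚ - f π - L u π) ≡ 1ℚ - E N f - y
          gap-mean = trans (E-- N _ (L u)) (cong₂ _-_ (trans (E-- N (λ _ → 1ℚ) f) (cong (_- E N f) (E-const N 1ℚ))) (mean-L u ay))
        y-large : 49 ≤ 100 * y
        y-large = by (diff gap ⊞ ≥0 {100} ⊡ diff half) (lem₂ (E N f) y)
      0<U : 0ℚ < U
      0<U = ℚ.≰⇒> λ U≤0 → contradiction (≤-trans many (*-monoˡ (≥0 {100}) U≤0)) (<⇒≱ (>0 {49} ⊡< 0<a))

    -- Λ will be a full row or a full column; both enter only through being met exactly once by
    -- every permutation. C′ is the rest of the line after removing C, and O is the part of C off
    -- the line.
    module _ (Λ : CosetSet N) (Λ-one : ∀ π → Inj π → L (indicator Λ) π ≡ 1ℚ) (outside : total (indicator (λ i j → C i j ∧ not (Λ i j))) ≤ 20 * κ * b) where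
      private
        C′ O : CosetSet N
        C′ i j = Λ i j ∧ not (C i j)
        O i j = C i j ∧ not (Λ i j)
        o c′ λ′ : Matrix N
        o = indicator O
        c′ = indicator C′
        λ′ = indicator Λ
        w : ℚ
        w = proj₁ (quotient N-1 (total o))
        aw : a * w ≡ total o
        aw = proj₂ (quotient N-1 (total o))
        0≤total-o : 0ℚ ≤ total o
        0≤total-o = ∑∑-nonneg λ i j → 0≤⟦⟧ (O i j)
        0≤w : 0ℚ ≤ w
        0≤w = *-cancelˡ-≤ a 0<a (≤-trans (≡⇒≤ (ℚ.*-zeroʳ a)) (≤-trans 0≤total-o (≡⇒≤ (sym aw))))
        w≤ : w ≤ 20 * κ
        w≤ = *-cancelˡ-≤ a 0<a (≤-trans (≡⇒≤ aw) (≤-trans outside (by (≥0 {20} ⊡ 0≤κ) (trans (cong (_* (20 * κ)) (ι-suc N-1)) (lem b κ)))))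
          where lem : ∀ b κ → (1 + b) * (20 * κ) ≡ 20 * κ * b + 20 * κ
                lem = solve-∀ R
        outside-small : E N (sq ∘ L o) ≤ 40 * κ
        outside-small = ≤-trans (≡⇒≤ (trans (E-cong N λ π _ → cong sq (split-at (L o π) w)) (E-shift (L o) (mean-L o aw) w)))
          (≤-trans (ℚ.+-mono-≤ w² spread) (≡⇒≤ (lem₁ κ)))
          where
          lem₁ : ∀ κ → 20 * κ + 20 * κ ≡ 40 * κ
          lem₁ = solve-∀ R
          lem₂ : ∀ w t → 20 * (82044 * t) ≡ w * w + (20 * (82044 * t) - w + w * (20 * (82044 * t) - w + (1 - 1000000000 * t + 998359120 * t)))
          lem₂ = solve-∀ R
          w² : sq w ≤ 20 * κ
          w² = by (diff w≤ ⊞ 0≤w ⊡ (diff w≤ ⊞ (diff small ⊞ ≥0 {998359120} ⊡ 0≤t))) (lem₂ w t)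
          spread : E N (λ π → sq (L o π - w)) ≤ 20 * κ
          spread = *-cancelˡ-≤ b 0<b (≤-trans (variance-bound o aw) (≤-trans (≡⇒≤ (indicator-idem O)) (≤-trans outside (≡⇒≤ (ℚ.*-comm (20 * κ) b)))))

        cells : ∀ p q → ⟦ p ∧ not q ⟧ + ⟦ q ⟧ ≡ ⟦ p ⟧ + ⟦ q ∧ not p ⟧
        cells true  true  = refl
        cells true  false = refl
        cells false true  = refl
        cells false false = refl

        L-split : ∀ π → L c′ π + L u π ≡ L λ′ π + L o π
        L-split π = trans (sym (∑-+ _ _)) (trans (∑-cong λ i → cells (Λ i (π i)) (C i (π i))) (∑-+ _ _))

        subset : ∀ p q → ⟦ p ∧ not q ⟧ ≤ ⟦ p ⟧
        subset true  q = ⟦⟧≤1 (not q)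
        subset false q = ≤-refl

        total-λ : total λ′ ≡ a
        total-λ = trans (sym (E-L λ′)) (trans (cong (a *_) (trans (E-cong N Λ-one) (E-const N 1ℚ))) (ℚ.*-identityʳ a))

      line-outcome : Outcome N f t
      line-outcome = record { C = C′ ; few = few′ ; pairs-few = pairs′ ; close = close′ }
        where
        few′ : total c′ ≤ 2 * a
        few′ = ≤-trans (∑∑-mono λ i j → subset (Λ i j) (C i j)) (≤-trans (≡⇒≤ total-λ) (by (0≤ι N) (lem a)))
          where lem : ∀ a → 2 * a ≡ a + a
                lem = solve-∀ R
        pairs′ : P C′ ≤ 82044 * t * (a * a)
        pairs′ = ≤-trans (≡⇒≤ (sym (E-pairs C′))) (≤-trans (*-monoˡ (0≤ι N ⊡ 0≤ι N-1) (≤-trans (E-mono N point) (≡⇒≤ (E-const N 0ℚ))))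
          (≤-trans (≡⇒≤ (ℚ.*-zeroʳ (a * b))) (≥0 {82044} ⊡ 0≤t ⊡ (0≤ι N ⊡ 0≤ι N))))
          where
          lem : ∀ h → 0ℚ ≡ h * h - h + h * (1ℚ - h)
          lem = solve-∀ R
          -- A permutation meets the line once, so h = `L c′ π` lies between 0 and 1, where h² ≤ h.
          point : ∀ π → Inj π → sq (L c′ π) - L c′ π ≤ 0ℚ
          point π inj = by ((∑-nonneg λ i → 0≤⟦⟧ (C′ i (π i))) ⊡ diff (≤-trans (∑-mono λ i → subset (Λ i (π i)) (C i (π i))) (≡⇒≤ (Λ-one π inj)))) (lem (L c′ π))
        close′ : E N (λ π → sq (f π - L c′ π)) ≤ 6604540 * t
        close′ = ≤-trans (E-mono N point) (≤-trans (E-+-≤ N (E-*-≤ N 2 ≥0 close) (E-*-≤ N 2 ≥0 outside-small)) (≡⇒≤ (lem t)))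
          where
          lem : ∀ t → 2 * (20510 * t) + 2 * (40 * (82044 * t)) ≡ 6604540 * t
          lem = solve-∀ R
          lem₁ : ∀ f u o → 2 * ((1ℚ - f - u) * (1ℚ - f - u)) + 2 * (o * o) ≡ (f - (1ℚ + o - u)) * (f - (1ℚ + o - u)) + ((1ℚ - f - u) - o) * ((1ℚ - f - u) - o)
          lem₁ = solve-∀ R
          lem₂ : ∀ x y → x ≡ x + y - y
          lem₂ = solve-∀ R
          -- Since c′ + u = λ′ + o along π and λ′ sums to 1, f - L c′ is -(1 - f - L u) - L o.
          point : ∀ π → Inj π → sq (f π - L c′ π) ≤ 2 * sq (1ℚ - f π - L u π) + 2 * sq (L o π)
          point π inj = subst (λ x → sq (f π - x) ≤ 2 * sq (1ℚ - f π - L u π) + 2 * sq (L o π))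
            (sym (trans (lem₂ (L c′ π) (L u π)) (cong (_- L u π) (trans (L-split π) (cong (_+ L o π) (Λ-one π inj))))))
            (by (0≤sq (1ℚ - f π - L u π - L o π)) (lem₁ (f π) (L u π) (L o π)))

    private
      -- M is the largest line sum. With few non-disjoint pairs `heavy` forces M to about U/2, hence
      -- M - 1 ≥ a/20, and then `bound` limits the cosets off the line. The linear summand U in
      -- `heavy` keeps this true down to a = 3.
      long-line : ∀ {M} → sq U + U - P C ≤ 2 * M * U → M ≤ U → (M - 1ℚ) * (U - M) ≤ P C → U - M ≤ 20 * κ * b
      long-line {M} heavy M≤U bound = *-cancelˡ-≤ a 0<a (by (diff M-large ⊡ diff M≤U ⊞ ≥0 {20} ⊡ (diff bound ⊞ diff P≤)) (lem a b κ M U (P C)))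
        where
        lem : ∀ a b κ M U p → a * (20 * κ * b) ≡ a * (U - M) + ((20 * (M - 1ℚ) - a) * (U - M) + 20 * (p - (M - 1ℚ) * (U - M) + (κ * (a * b) - p)))
        lem = solve-∀ R
        alg : ∀ i t M U p → 200 * (U * (20 * (M - 1ℚ))) ≡ 200 * (U * (3 + i)) + (2000 * (2 * M * U - (U * U + U - p)) + 20 * U * (100 * U - 49 * (3 + i) + (34 * i + 2)) + (3 + i) * (100 * U - 49 * (3 + i))
          + (3 + i) * (49 + (2 + i) * (48 + (1 - 1000000000 * t) + 835912000 * t)) + 2000 * (82044 * t * ((3 + i) * (2 + i)) - p))
        alg = solve-∀ R
        lem₁ : ∀ a b t M U p → a ≡ 3 + ι m → b ≡ 2 + ι m → 200 * (U * (20 * (M - 1ℚ))) ≡ 200 * (U * a) + (2000 * (2 * M * U - (U * U + U - p)) + 20 * U * (100 * U - 49 * a + (34 * ι m + 2)) + a * (100 * U - 49 * a)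
          + a * (49 + b * (48 + (1 - 1000000000 * t) + 835912000 * t)) + 2000 * (82044 * t * (a * b) - p))
        lem₁ _ _ t M U p refl refl = alg (ι m) t M U p
        M-large : a ≤ 20 * (M - 1ℚ)
        M-large = *-cancelˡ-≤ U 0<U (*-cancelˡ-≤ 200 (>0 {200})
          (by (≥0 {2000} ⊡ diff heavy ⊞ ≥0 {20} ⊡ ℚ.<⇒≤ 0<U ⊡ (diff many ⊞ (≥0 {34} ⊡ 0≤ι m ⊞ ≥0 {2})) ⊞ 0≤ι N ⊡ diff many
              ⊞ 0≤ι N ⊡ (≥0 {49} ⊞ 0≤ι N-1 ⊡ (≥0 {48} ⊞ diff small ⊞ ≥0 {835912000} ⊡ 0≤t)) ⊞ ≥0 {2000} ⊡ diff P≤)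
            (lem₁ a b t M U (P C) (ι-3+ m) (ι-2+ m))))

      cut : ∀ x y → x * (1ℚ - y) ≡ x - y * x
      cut = solve-∀ R

      nonneg-row : ∀ (D : CosetSet N) i → 0ℚ ≤ row (indicator D) i
      nonneg-row D i = ∑-nonneg λ j → 0≤⟦⟧ (D i j)

    complement-outcome : Outcome N f t
    complement-outcome = choose (argmax (row u)) (argmax (col u))
      where
      -- U² + U - P equals R₂ + C₂, and each of these is at most the largest line sum of its kind
      -- times U.
      heavy-line : ∀ R* S* M → R₂ u ≤ R* * U → C₂ u ≤ S* * U → R* ≤ M → S* ≤ M → sq U + U - P C ≤ 2 * M * U
      heavy-line R* S* M r s p q = by (diff r ⊞ diff s ⊞ ℚ.<⇒≤ 0<U ⊡ diff p ⊞ ℚ.<⇒≤ 0<U ⊡ diff q) (lem R* S* M U (R₂ u) (C₂ u))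
        where lem : ∀ r s M U x y → 2 * M * U ≡ U * U + U - (U * U - x - y + U) + (r * U - x + (s * U - y) + U * (M - r) + U * (M - s))
              lem = solve-∀ R
      by-row : ∀ i → sq U + U - P C ≤ 2 * row u i * U → Outcome N f t
      by-row i heavy = line-outcome (λ k _ → ⌊ i ≟F k ⌋) one
          (≤-trans (≡⇒≤ outside) (long-line heavy (∑-≥-term (row u) (nonneg-row C) i) (line-bound C i)))
        where
        one : ∀ π → Inj π → ∑ (λ k → δ i k) ≡ 1ℚ
        one π _ = trans (∑-cong λ k → sym (ℚ.*-identityʳ (δ i k))) (∑-δ i (λ _ → 1ℚ))
        outside : ∑ (λ k → ∑ (λ l → ⟦ C k l ∧ not ⌊ i ≟F k ⌋ ⟧)) ≡ U - row u i
        outside = trans (∑-cong λ k → trans (∑-cong λ l → trans (⟦∧⟧ (C k l) _) (trans (cong (u k l *_) (⟦not⟧ ⌊ i ≟F k ⌋)) (cut (u k l) (δ i k)))) (trans (∑-- _ _) (cong (λ x → row u k - x) (∑-* (δ i k) (u k)))))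
          (trans (∑-- _ _) (cong (λ x → U - x) (∑-δ i (row u))))
      by-col : ∀ j → sq U + U - P C ≤ 2 * col u j * U → Outcome N f t
      by-col j heavy = line-outcome (λ _ l → ⌊ j ≟F l ⌋) one
          (≤-trans (≡⇒≤ outside) (long-line heavy
            (≤-trans (∑-≥-term (col u) (λ l → nonneg-row (flip-set C) l) j) (≡⇒≤ flip-total))
            (subst₂ _≤_ (cong (λ x → (col u j - 1ℚ) * (x - col u j)) flip-total) (P-flip C) (line-bound (flip-set C) j))))
        where
        flip-total : ∑ (col u) ≡ U
        flip-total = ∑-swap (λ l k → u k l)
        one : ∀ π → Inj π → ∑ (λ k → δ j (π k)) ≡ 1ℚ
        one π inj = trans (∑-permute π inj (δ j)) (trans (∑-cong λ k → sym (ℚ.*-identityʳ (δ j k))) (∑-δ j (λ _ → 1ℚ)))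
        outside : ∑ (λ k → ∑ (λ l → ⟦ C k l ∧ not ⌊ j ≟F l ⌋ ⟧)) ≡ U - col u j
        outside = trans (∑-cong λ k → trans (∑-cong λ l → trans (⟦∧⟧ (C k l) _) (trans (cong (u k l *_) (⟦not⟧ ⌊ j ≟F l ⌋)) (cut (u k l) (δ j l)))) (trans (∑-- _ _) (cong (λ x → row u k - x) (∑-δ j (u k)))))
          (∑-- _ _)
      choose : (∃ λ i → ∀ k → row u k ≤ row u i) → (∃ λ j → ∀ l → col u l ≤ col u j) → Outcome N f t
      choose (i , i-max) (j , j-max) = pick-larger (ℚ.≤-total (col u j) (row u i))
        where
        rows : R₂ u ≤ row u i * U
        rows = ∑-sq-≤-max (row u) (nonneg-row C) (row u i) i-max
        cols : C₂ u ≤ col u j * U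
        cols = ≤-trans (∑-sq-≤-max (col u) (λ l → nonneg-row (flip-set C) l) (col u j) j-max) (≡⇒≤ (cong (col u j *_) (∑-swap (λ l k → u k l))))
        pick-larger : col u j ≤ row u i ⊎ row u i ≤ col u j → Outcome N f t
        pick-larger (inj₁ q) = by-row i (heavy-line (row u i) (col u j) (row u i) rows cols ≤-refl q)
        pick-larger (inj₂ q) = by-col j (heavy-line (row u i) (col u j) (col u j) rows cols q ≤-refl)

-- Small cases and large errors

-- Dictated by `large-error`, where 2 + 2ε ≤ Kε is required as soon as ε ≥ 1/(10⁹ K₂); this takes
-- about 2.8 · 10¹⁶.
K : ℚ
K = 100000000000000000

record Approximable (n : ℕ) (f : Sym n → ℚ) (ε : ℚ) : Set where
  field
    C : CosetSet n
    few : total (indicator C) ≤ 2 * ι n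
    pairs-few : P C ≤ 2 * (K * ε * (ι n * ι n))
    close : E n (λ π → sq (f π - L (indicator C) π)) ≤ K * ε

Outcome⇒Approximable : ∀ {n f ε} → 0ℚ ≤ ε → Outcome n f (K₂ * ε) → Approximable n f ε
Outcome⇒Approximable {n} {f} {ε} 0≤ε O = record
  { C = C ; few = few
  ; pairs-few = ≤-trans pairs-few (by (≥0 {199998853763276000} ⊡ 0≤ε ⊡ (0≤ι n ⊡ 0≤ι n)) (lem₁ ε (ι n * ι n)))
  ; close = ≤-trans close (by (≥0 {99907727971660000} ⊡ 0≤ε) (lem₂ ε)) }
  where
  open Outcome O
  lem₁ : ∀ ε x → 2 * (100000000000000000 * ε * x) ≡ 82044 * (13971000 * ε) * x + 199998853763276000 * ε * x
  lem₁ = solve-∀ R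
  lem₂ : ∀ ε → 100000000000000000 * ε ≡ 6604540 * (13971000 * ε) + 99907727971660000 * ε
  lem₂ = solve-∀ R

module _ {m : ℕ} (c : Matrix (suc (suc (suc m)))) where
  private
    N : ℕ
    N = suc (suc (suc m))
    ε t : ℚ
    ε = E N (φ ∘ L c)
    t = K₂ * ε
    0≤ε : 0ℚ ≤ ε
    0≤ε = E-nonneg N λ π _ → 0≤φ (L c π)
    0≤t : 0ℚ ≤ t
    0≤t = ≥0 {K₂} ⊡ 0≤ε
    f-close : ε ≤ t
    f-close = by (≥0 {13970999} ⊡ 0≤ε) (lem ε)
      where lem : ∀ ε → 13971000 * ε ≡ ε + 13970999 * ε
            lem = solve-∀ R

  small-error : 1000000000 * t ≤ 1 → E N (L c) ≤ ½ → Outcome N (L c) t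
  small-error small half = cases (a₀-Bit refl small 0≤t approx)
    where
    base-small : 251000 * ε ≤ 1
    base-small = by (diff small ⊞ ≥0 {13970999999749000} ⊡ 0≤ε) (lem ε)
      where lem : ∀ ε → 1 ≡ 251000 * ε + (1 - 1000000000 * (13971000 * ε) + 13970999999749000 * ε)
            lem = solve-∀ R
    approx : Approx m (L c) (E N (L c)) t
    approx = round-linear c small (good-base c base-small)
    cases : Bit (Approx.a₀ approx) → Outcome N (L c) t
    cases (inj₁ p) = direct 0≤t f-close (cosets refl small 0≤t f-close approx p)
    cases (inj₂ p) = complement-outcome small 0≤t f-close half
      (cosets (trans (E-- N (λ _ → 1ℚ) (L c)) (cong (_- E N (L c)) (E-const N 1ℚ))) small 0≤t
        (subst (_≤ t) (E-cong N λ π _ → sym (φ-complement (L c π))) f-close) (complement approx) (cong (λ x → 1ℚ - x) p))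

total-empty : ∀ n → total (indicator {n} (λ _ _ → false)) ≡ 0ℚ
total-empty n = trans (∑-cong λ _ → ∑-0 n) (∑-0 n)

-- The empty set suffices when ε is bounded below, because E[f²] ≤ 2 + 2ε is then O(ε).
large-error : ∀ {n} (f : Sym n → ℚ) {ε} → 1 ≤ 1000000000 * (K₂ * ε) → E n (φ ∘ f) ≤ ε → Approximable n f ε
large-error {n} f {ε} big f-close = record { C = ∅ ; few = few ; pairs-few = pairs-few ; close = close }
  where
  ∅ : CosetSet n
  ∅ _ _ = false
  u : Matrix n
  u = indicator ∅
  0≤ε : 0ℚ ≤ ε
  0≤ε = ≤-trans (E-nonneg n λ π _ → 0≤φ (f π)) f-close
  few : total u ≤ 2 * ι n
  few = ≤-trans (≡⇒≤ (total-empty n)) (≥0 {2} ⊡ 0≤ι n)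
  pairs-few : P ∅ ≤ 2 * (K * ε * (ι n * ι n))
  pairs-few = ≤-trans (≤-trans (by ((∑-nonneg λ i → 0≤sq (row u i)) ⊞ (∑-nonneg λ j → 0≤sq (col u j))) (lem (total u) (R₂ u) (C₂ u)))
      (≡⇒≤ (cong (λ x → sq x + x) (total-empty n)))) (≥0 {2} ⊡ (≥0 {K} ⊡ 0≤ε ⊡ (0≤ι n ⊡ 0≤ι n)))
    where lem : ∀ t r c → t * t + t ≡ t * t - r - c + t + (r + c)
          lem = solve-∀ R
  point : ∀ y → sq y ≤ 2 + 2 * φ y
  point y = go (φ-attained y)
    where
    lem₀ : ∀ y → 2 + 2 * ((y - 0ℚ) * (y - 0ℚ)) ≡ y * y + (2 + y * y)
    lem₀ = solve-∀ R
    lem₁ : ∀ y → 2 + 2 * ((y - 1ℚ) * (y - 1ℚ)) ≡ y * y + (y - 2) * (y - 2)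
    lem₁ = solve-∀ R
    go : Nearest y → sq y ≤ 2 + 2 * φ y
    go (_ , inj₁ refl , q) = by (≥0 {2} ⊞ 0≤sq y) (trans (cong (λ z → 2 + 2 * z) q) (lem₀ y))
    go (_ , inj₂ refl , q) = by (0≤sq (y - 2)) (trans (cong (λ z → 2 + 2 * z) q) (lem₁ y))
  close : E n (λ π → sq (f π - L u π)) ≤ K * ε
  close = ≤-trans (≡⇒≤ (E-cong n λ π _ → cong sq (trans (cong (λ x → f π - x) (∑-0 n)) (minus-0 (f π)))))
    (≤-trans (E-mono n λ π _ → point (f π)) (≤-trans (E-+-≤ n (≡⇒≤ (E-const n 2)) (E-*-≤ n 2 ≥0 f-close))
      (by (≥0 {2} ⊡ diff big ⊞ ≥0 {72057999999999998} ⊡ 0≤ε) (lem ε))))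
    where
    lem : ∀ ε → 100000000000000000 * ε ≡ 2 + 2 * ε + (2 * (1000000000 * (13971000 * ε) - 1) + 72057999999999998 * ε)
    lem = solve-∀ R

-- For n ≤ 2 every function on S_n factors through π ↦ π(0), so the values can be rounded separately.
module _ {n : ℕ} (f : Sym (suc n) → ℚ) (F : Fin (suc n) → ℚ) (factors : ∀ π → Inj π → f π ≡ F (π zero)) where
  private
    N : ℕ
    N = suc n
    bit : ∀ y → ∃ λ q → φ y ≡ sq (y - ⟦ q ⟧)
    bit y = go (φ-attained y)
      where go : Nearest y → ∃ λ q → φ y ≡ sq (y - ⟦ q ⟧)
            go (_ , inj₁ refl , p) = false , p
            go (_ , inj₂ refl , p) = true , p
    C : CosetSet N
    C i j = ⌊ zero {n} ≟F i ⌋ ∧ proj₁ (bit (F j))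
    u : Matrix N
    u = indicator C
    v : Fin N → ℚ
    v j = ⟦ proj₁ (bit (F j)) ⟧
    o : Fin N
    o = zero
    u≡ : ∀ i j → u i j ≡ δ o i * v j
    u≡ i j = ⟦∧⟧ ⌊ o ≟F i ⌋ (proj₁ (bit (F j)))
    row≡ : ∀ i → row u i ≡ δ o i * ∑ v
    row≡ i = trans (∑-cong λ j → u≡ i j) (∑-* (δ o i) v)
    col≡ : ∀ j → col u j ≡ v j
    col≡ j = trans (∑-cong λ i → u≡ i j) (∑-δ o (λ _ → v j))
    total≡ : total u ≡ ∑ v
    total≡ = trans (∑-cong row≡) (∑-δ o (λ _ → ∑ v))
    R₂≡ : R₂ u ≡ sq (∑ v)
    R₂≡ = trans (∑-cong λ i → trans (cong sq (row≡ i)) (lem (δ o i) (∑ v))) (trans (∑-δ o (λ i → δ o i * sq (∑ v))) (trans (cong (_* sq (∑ v)) (δ-yes {i = o} refl)) (ℚ.*-identityˡ (sq (∑ v)))))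
      where lem : ∀ d x → d * x * (d * x) ≡ d * (d * (x * x))
            lem = solve-∀ R
    C₂≡ : C₂ u ≡ ∑ v
    C₂≡ = ∑-cong λ j → trans (cong sq (col≡ j)) (⟦⟧-idem (proj₁ (bit (F j))))
    P≡0 : P C ≡ 0ℚ
    P≡0 = trans (cong₂ (λ x y → x - C₂ u + y) (cong₂ (λ x y → sq x - y) total≡ R₂≡) total≡) (trans (cong (λ x → sq (∑ v) - sq (∑ v) - x + ∑ v) C₂≡) (lem (sq (∑ v)) (∑ v)))
      where lem : ∀ x y → x - x - y + y ≡ 0ℚ
            lem = solve-∀ R

  -- All chosen cosets lie in row 0, so they form no non-disjoint pair, and rounding each value of f
  -- to its nearest bit leaves exactly the error E[dist(f,{0,1})²].
  one-row : ∀ {ε} → 0ℚ ≤ ε → E N (φ ∘ f) ≤ ε → Approximable N f ε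
  one-row {ε} 0≤ε f-close = record { C = C ; few = few ; pairs-few = ≤-trans (≡⇒≤ P≡0) (≥0 {2} ⊡ (≥0 {K} ⊡ 0≤ε ⊡ (0≤ι N ⊡ 0≤ι N))) ; close = close }
    where
    few : total u ≤ 2 * ι N
    few = ≤-trans (≡⇒≤ total≡) (≤-trans (∑-mono λ j → ⟦⟧≤1 (proj₁ (bit (F j)))) (≤-trans (≡⇒≤ (∑-const N 1ℚ)) (by (0≤ι N) (lem (ι N)))))
      where lem : ∀ a → 2 * a ≡ a * 1ℚ + a
            lem = solve-∀ R
    close : E N (λ π → sq (f π - L u π)) ≤ K * ε
    close = ≤-trans (≡⇒≤ (E-cong N λ π inj → trans (cong₂ (λ x y → sq (x - y)) (factors π inj) (trans (∑-cong λ i → u≡ i (π i)) (∑-δ o (v ∘ π))))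
        (trans (sym (proj₂ (bit (F (π zero))))) (cong φ (sym (factors π inj))))))
      (≤-trans f-close (by (≥0 {99999999999999999} ⊡ 0≤ε) (lem ε)))
      where lem : ∀ ε → 100000000000000000 * ε ≡ ε + 99999999999999999 * ε
            lem = solve-∀ R

factor₁ : ∀ (c : Matrix 1) π → Inj π → L c π ≡ c zero (π zero)
factor₁ c π _ = trans (∑-suc _) (trans (cong (c zero (π zero) +_) (∑-empty _)) (ℚ.+-identityʳ (c zero (π zero))))

factor₂ : ∀ (c : Matrix 2) π → Inj π → L c π ≡ c zero (π zero) + c (suc zero) (transpose zero (suc zero) (π zero))
factor₂ c π inj = trans (∑-suc _) (cong (c zero (π zero) +_) (trans (∑-suc _) (trans (cong₂ _+_ (cong (c (suc zero)) (other (π zero) (π (suc zero)) λ p → 0≢1 (inj p))) (∑-empty _)) (ℚ.+-identityʳ (c (suc zero) (transpose zero (suc zero) (π zero)))))))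
  where
  0≢1 : ¬ (Fin.zero {1} ≡ suc zero)
  0≢1 ()
  other : ∀ (x y : Fin 2) → ¬ (x ≡ y) → y ≡ transpose zero (suc zero) x
  other zero zero p = contradiction refl p
  other zero (suc zero) p = refl
  other (suc zero) zero p = refl
  other (suc zero) (suc zero) p = contradiction refl p

approximable : ∀ n → 1 ℕ.≤ n → ∀ {ε} → 0ℚ ≤ ε → (c : Matrix n) → E n (φ ∘ L c) ≤ ε → E n (L c) ≤ ½ → Approximable n (L c) ε
approximable (suc zero) _ 0≤ε c close _ = one-row (L c) (c zero) (factor₁ c) 0≤ε close
approximable (suc (suc zero)) _ 0≤ε c close _ = one-row (L c) (λ j → c zero j + c (suc zero) (transpose zero (suc zero) j)) (factor₂ c) 0≤ε close
approximable n@(suc (suc (suc m))) _ {ε} 0≤ε c close half = go (1000000000 * (K₂ * ε′) ℚ.≤? 1)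
  where
  -- The construction runs with the exact error of f; the bounds are weakened to ε afterwards.
  ε′ : ℚ
  ε′ = E n (φ ∘ L c)
  lem : ∀ x y → 1000000000 * (13971000 * y) ≡ 1000000000 * (13971000 * x) + 13971000000000000 * (y - x)
  lem = solve-∀ R
  weaken : Approximable n (L c) ε′ → Approximable n (L c) ε
  weaken A = record { C = C ; few = few ; pairs-few = ≤-trans pairs-few (by (≥0 {2} ⊡ (≥0 {K} ⊡ diff close ⊡ (0≤ι n ⊡ 0≤ι n))) (lem₁ ε ε′ (ι n * ι n))) ; close = ≤-trans near (*-monoˡ (≥0 {K}) close) }
    where
    open Approximable A renaming (close to near)
    lem₁ : ∀ ε ε′ x → 2 * (100000000000000000 * ε * x) ≡ 2 * (100000000000000000 * ε′ * x) + 2 * (100000000000000000 * (ε - ε′) * x)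
    lem₁ = solve-∀ R
  go : Dec (1000000000 * (K₂ * ε′) ≤ 1) → Approximable n (L c) ε
  go (yes small) = weaken (Outcome⇒Approximable (E-nonneg n λ π _ → 0≤φ (L c π)) (small-error c small half))
  go (no big) = large-error (L c) (≤-trans (≰-≥ big) (by (≥0 {13971000000000000} ⊡ diff close) (lem ε′ ε))) close

-- The mean of h² - h is P/(ab), at most 2Aε·a/b, and a ≤ 2b from n = 2 on. For n = 1 the value h is
-- itself a bit.
converse : ∀ n → 1 ℕ.≤ n → ∀ {A ε} → 0ℚ ≤ A → 0ℚ ≤ ε → (C : CosetSet n) → P C ≤ 2 * (A * ε * (ι n * ι n)) → E n (φ ∘ L (indicator C)) ≤ 4 * A * ε
converse (suc zero) _ {A} {ε} 0≤A 0≤ε C _ = ≤-trans (E-mono 1 point) (≤-trans (≡⇒≤ (E-const 1 0ℚ)) (≥0 {4} ⊡ 0≤A ⊡ 0≤ε))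
  where
  self : ∀ x → x - x ≡ 0ℚ
  self = solve-∀ R
  point : ∀ π → Inj π → φ (L (indicator C) π) ≤ 0ℚ
  point π inj = subst (λ h → φ h ≤ 0ℚ) (sym (factor₁ (indicator C) π inj)) (≤-trans (φ≤pairs (⟦⟧-Int (C zero (π zero))))
    (≡⇒≤ (trans (cong (_- ⟦ C zero (π zero) ⟧) (⟦⟧-idem (C zero (π zero)))) (self ⟦ C zero (π zero) ⟧))))
converse n@(suc (suc k)) _ {A} {ε} 0≤A 0≤ε C few = ≤-trans (E-mono n λ π _ → φ≤pairs (indicator-Int C π))
  (*-cancelˡ-≤ (a * b) (0<ι (suc k) ⊡< 0<ι k) (≤-trans (≡⇒≤ (E-pairs C)) (≤-trans few
    (by (≥0 {2} ⊡ (0≤A ⊡ 0≤ε) ⊡ (0≤ι n ⊡ 0≤ι k)) (lem a b (ι k) A ε (ι-suc (suc k)) (ι-suc k))))))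
  where
  a b : ℚ
  a = ι n
  b = ι (suc k)
  alg : ∀ i A ε → (1 + (1 + i)) * (1 + i) * (4 * A * ε) ≡ 2 * (A * ε * ((1 + (1 + i)) * (1 + (1 + i)))) + 2 * (A * ε) * ((1 + (1 + i)) * i)
  alg = solve-∀ R
  lem : ∀ a b i A ε → a ≡ 1 + b → b ≡ 1 + i → a * b * (4 * A * ε) ≡ 2 * (A * ε * (a * a)) + 2 * (A * ε) * (a * i)
  lem _ _ i A ε refl refl = alg i A ε

-- Translation into the definitions of the statement

𝔼-linear : ∀ n (c : Matrix n) g → 𝔼 n (λ π → g (linear n c π)) ≡ E n (λ π → g (L c π))
𝔼-linear n c g = trans (E-def n _) (E-cong n λ π _ → cong g (linear≡L c π))

theorem1p2 : (Σ ℚ λ K → 0ℚ < K ×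
    (∀ (n : ℕ) → 1 ℕ.≤ n → ∀ (ε : ℚ) → 0ℚ ≤ ε →
    ∀ (c : Fin n → Fin n → ℚ) →
    𝔼 n (λ π → sq (dist01 (linear n c π))) ≤ ε →
    𝔼 n (linear n c) ≤ ½ →
    Σ (CosetSet n) λ C →
    (ℕtoℚ (card n C) ≤ K * ℕtoℚ n)
    × (ℕtoℚ (nonDisjointPairs n C) ≤ K * ε * ℕtoℚ (n ℕ.* n))
    × (𝔼 n (λ π → sq (linear n c π - indicatorSum n C π)) ≤ K * ε)))
    ×
    (∀ (A : ℚ) → 0ℚ < A → Σ ℚ λ B → 0ℚ < B ×
    (∀ (n : ℕ) → 1 ℕ.≤ n → ∀ (ε : ℚ) → 0ℚ ≤ ε →
    ∀ (C : CosetSet n) →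
    ℕtoℚ (card n C) ≤ A * ℕtoℚ n →
    ℕtoℚ (nonDisjointPairs n C) ≤ A * ε * ℕtoℚ (n ℕ.* n) →
    𝔼 n (λ π → sq (dist01 (indicatorSum n C π))) ≤ B * ε))
theorem1p2 =
  (K , >0 {K} , λ n 1≤n ε 0≤ε c close half →
    forward n ε 0≤ε c (approximable n 1≤n 0≤ε c (subst (_≤ ε) (𝔼-linear n c φ) close) (subst (_≤ ½) (𝔼-linear n c (λ y → y)) half))) ,
  λ A 0<A → 4 * A , (>0 {4} ⊡< 0<A) , λ n 1≤n ε 0≤ε C _ few →
    subst (_≤ 4 * A * ε) (sym (𝔼-linear n (indicator C) φ)) (converse n 1≤n (ℚ.<⇒≤ 0<A) 0≤ε C
      (≤-trans (≡⇒≤ (sym (pairs-P C))) (*-monoˡ (≥0 {2}) (subst₂ _≤_ (ι-def (nonDisjointPairs n C)) (cong (A * ε *_) (trans (ι-def (n ℕ.* n)) (ι-* n n))) few))))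
  where
  forward : ∀ n ε → 0ℚ ≤ ε → (c : Matrix n) → Approximable n (L c) ε → Σ (CosetSet n) λ C →
    (ℕtoℚ (card n C) ≤ K * ℕtoℚ n)
    × (ℕtoℚ (nonDisjointPairs n C) ≤ K * ε * ℕtoℚ (n ℕ.* n))
    × (𝔼 n (λ π → sq (linear n c π - indicatorSum n C π)) ≤ K * ε)
  forward n ε 0≤ε c A = C ,
    subst₂ _≤_ (trans (sym (card-total C)) (sym (ι-def (card n C)))) (cong (K *_) (sym (ι-def n))) (≤-trans few (by (≥0 {99999999999999998} ⊡ 0≤ι n) (lem (ι n)))) ,
    subst₂ _≤_ (sym (ι-def (nonDisjointPairs n C))) (cong (K * ε *_) (sym (trans (ι-def (n ℕ.* n)) (ι-* n n))))
      (*-cancelˡ-≤ 2 (>0 {2}) (≤-trans (≡⇒≤ (pairs-P C)) pairs-few)) ,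
    subst (_≤ K * ε) (sym (trans (E-def n _) (E-cong n λ π _ → cong₂ (λ x y → sq (x - y)) (linear≡L c π) (linear≡L (indicator C) π)))) near
    where
    open Approximable A renaming (close to near)
    lem : ∀ a → 100000000000000000 * a ≡ 2 * a + 99999999999999998 * a
    lem = solve-∀ R
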